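{- For each $\mathcal C\in\{\#\mathrm{para}_{W}\text{ - }\mathrm{L},\ \#\mathrm{para}_{W[1]}\text{ - }\mathrm{L},\ \#\mathrm{para}_{\beta}\text{ - }\mathrm{L},\ \#\mathrm{para}_{\beta\text{ -tail}}\text{ - }\mathrm{L}\}$, the class $\mathcal C$ is closed under addition and multiplication: if $F_1,F_2\in\mathcal C$, then the functions $(x,k)\mapsto F_1(x,k)+F_2(x,k)$ and $(x,k)\mapsto F_1(x,k)\cdot F_2(x,k)$ are in $\mathcal C$.
   Context: Inputs are pairs $(x,k)$, $x\in\{0,1\}^*$, parameter $k\in\mathbb N$; parameterised functions are $F:\{0,1\}^*\times\mathbb N\to\mathbb N$. Machines are TMs with random access to the input (a logarithmic-size index tape allows reading any input bit in one step). A nondeterministic TM is a deterministic TM with an extra read-only choice tape (not counted for space); a nondeterministic step is a step in which the choice-tape head moves to a cell not visited before; $\#\mathrm{acc}_M(x,k)$ is the number of accepting computation paths of $M$ on $(x,k)$. A $\mathrm{para}\text{ - }\mathrm{L}$-machine uses space $O(\log|x|+f(k))$ for a computable $f$. A nondeterministic machine is $k$-bounded if for a computable $f$ it reads at most $f(k)\cdot\log|x|$ choice-tape bits on every input $(x,k)$; it has read-once access if its choice-tape head moves only one way; it is tail-nondeterministic if for a computable $g$ it makes at most $g(k)\cdot\log|x|$ steps after its first nondeterministic step on every input $(x,k)$. $F\in\#\mathrm{para}_{W}\text{ - }\mathrm{L}$ iff there is a $k$-bounded nondeterministic $\mathrm{para}\text{ - }\mathrm{L}$-machine $M$ with $\#\mathrm{acc}_M(x,k)=F(x,k)$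 for all $(x,k)$; $\#\mathrm{para}_{\beta}\text{ - }\mathrm{L}$ additionally requires read-once access, $\#\mathrm{para}_{W[1]}\text{ - }\mathrm{L}$ additionally requires tail-nondeterminism, and $\#\mathrm{para}_{\beta\text{ -tail}}\text{ - }\mathrm{L}$ requires both. -}

module Defs where

open import Data.Bool.Base using (Bool; true; false)
open import Data.Empty using (⊥)
open import Data.Fin.Base using (Fin)
open import Data.List.Base as List using (List; []; _∷_; _++_; drop; foldr; length; replicate; reverse)
open import Data.Maybe.Base using (Maybe; just; nothing)
open import Data.Nat.Base using (ℕ; zero; suc; _+_; _*_; _≤_; _<_; _⊔_)
open import Data.Nat.Logarithm using (⌈log₂_⌉)
open import Data.Product using (Σ-syntax; ∃-syntax; _×_; _,_)
open import Data.Unit.Base using (⊤)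
open import Data.Vec.Base as Vec using (Vec; []; _∷_)
open import Data.Vec.Relation.Binary.Pointwise.Inductive using (Pointwise)
open import Function.Bundles using (_↔_)
open import Relation.Binary.Construct.Closure.ReflexiveTransitive using (Star; ε; _◅_)
open import Relation.Binary.PropositionalEquality.Core using (_≡_; _≢_)
open import Relation.Nullary.Negation.Core using (¬_)

------------------------------------------------------------------------
-- Computable functions: partial recursive codes with their graph semantics

data Code : ℕ → Set where
  zeroᶜ : ∀ {n} → Code n
  sucᶜ  : Code 1
  proj  : ∀ {n} → Fin n → Code n
  comp  : ∀ {m n} → Code m → Vec (Code n) m → Code n
  prec  : ∀ {n} → Code n → Code (2 + n) → Code (suc n)
  min   : ∀ {n} → Code (suc n) → Code n

data Eval : ∀ {n} → Code n → Vec ℕ n → ℕ → Set where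
  e-zero  : ∀ {n} {xs : Vec ℕ n} → Eval zeroᶜ xs 0
  e-suc   : ∀ {x} → Eval sucᶜ (x ∷ []) (suc x)
  e-proj  : ∀ {n} {xs : Vec ℕ n} (i : Fin n) → Eval (proj i) xs (Vec.lookup xs i)
  e-comp  : ∀ {m n} {h : Code m} {gs : Vec (Code n) m} {xs ys y} →
            Pointwise (λ g z → Eval g xs z) gs ys → Eval h ys y → Eval (comp h gs) xs y
  e-prec₀ : ∀ {n} {g : Code n} {h xs y} →
            Eval g xs y → Eval (prec g h) (0 ∷ xs) y
  e-prec₁ : ∀ {n} {g : Code n} {h t xs r y} →
            Eval (prec g h) (t ∷ xs) r → Eval h (t ∷ r ∷ xs) y →
            Eval (prec g h) (suc t ∷ xs) y
  e-min   : ∀ {n} {g : Code (suc n)} {xs t} →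
            Eval g (t ∷ xs) 0 →
            (∀ s → s < t → ∃[ v ] Eval g (s ∷ xs) (suc v)) →
            Eval (min g) xs t

Computable : (ℕ → ℕ) → Set
Computable f = Σ[ e ∈ Code 1 ] (∀ k → Eval e (k ∷ []) (f k))

------------------------------------------------------------------------
-- Inputs

Word : Set
Word = List Bool

ParamFun : Set
ParamFun = Word → ℕ → ℕ

data InputSymbol : Set where
  bit : Bool → InputSymbol
  sep : InputSymbol

-- The pair (x , k) is presented to a machine as x # 1ᵏ.
encode : Word → ℕ → List InputSymbol
encode x k = List.map bit x ++ sep ∷ replicate k (bit true)

-- Rounded up, and at least 1 so that bounds of the form f(k)·log|x| do not
-- degenerate for |x| ≤ 1.
log : ℕ → ℕ
log n = 1 ⊔ ⌈log₂ n ⌉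

------------------------------------------------------------------------
-- Tapes

data Move : Set where
  left stay right : Move

-- A one-way infinite tape.  Only the cells visited so far are stored; `before`
-- lists the cells to the left of the head, nearest first.
record Tape (A : Set) : Set where
  constructor tape
  field
    before  : List A
    current : A
    after   : List A

module _ {A : Set} where

  open Tape

  blankTape : A → Tape A
  blankTape b = tape [] b []

  cells : Tape A → List A
  cells t = reverse (before t) ++ current t ∷ after t

  size : Tape A → ℕ
  size t = length (cells t)

  write : A → Tape A → Tape A
  write a t = record t { current = a }

  -- `b` is the blank symbol; moving left on the leftmost cell has no effect.
  shift : A → Move → Tape A → Tape A
  shift b left  (tape []       a rs)       = tape [] a rs
  shift b left  (tape (l ∷ ls) a rs)       = tape ls l (a ∷ rs)
  shift b stay  t                          = t
  shift b right (tape ls       a [])       = tape (a ∷ ls) b []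
  shift b right (tape ls       a (r ∷ rs)) = tape (a ∷ ls) r rs

-- The index tape is over {0,1} with blank 0, least significant bit leftmost.
address : Tape Bool → ℕ
address t = foldr digit 0 (cells t)
  where
  digit : Bool → ℕ → ℕ
  digit false n = 2 * n
  digit true  n = suc (2 * n)

-- The choice tape starts with an endmarker cell, visited initially, followed by
-- choice bits.  Only visited bits are stored: `upto` are those from the head
-- back to the endmarker (nearest first), `beyond` those to the right of the
-- head.  The head is on the endmarker iff `upto` is empty.
record ChoiceTape : Set where
  constructor choiceTape
  field
    upto   : List Bool
    beyond : List Bool

open ChoiceTape

unread : ChoiceTape
unread = choiceTape [] []

bitsRead : ChoiceTape → ℕ
bitsRead t = length (upto t) + length (beyond t)

scanned : ChoiceTape → Maybe Bool
scanned t = List.head (upto t)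

-- Entering an unvisited cell reveals its content, which may be either bit.
data ChoiceMove : Move → ChoiceTape → ChoiceTape → Set where
  stay    : ∀ {t} → ChoiceMove stay t t
  atEnd   : ∀ {bs} → ChoiceMove left (choiceTape [] bs) (choiceTape [] bs)
  back    : ∀ {b as bs} → ChoiceMove left (choiceTape (b ∷ as) bs) (choiceTape as (b ∷ bs))
  revisit : ∀ {b as bs} → ChoiceMove right (choiceTape as (b ∷ bs)) (choiceTape (b ∷ as) bs)
  fresh   : ∀ {as} (b : Bool) → ChoiceMove right (choiceTape as []) (choiceTape (b ∷ as) [])

EntersNewCell : ∀ {m t u} → ChoiceMove m t u → Set
EntersNewCell (fresh _) = ⊤
EntersNewCell _         = ⊥

------------------------------------------------------------------------
-- Machines

Finite : Set → Set
Finite A = ∃[ n ] (A ↔ Fin n)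

record Instruction (Q Γ : Set) (tapes : ℕ) : Set where
  field
    next        : Q
    indexAction : Bool × Move
    workActions : Vec (Γ × Move) tapes
    choiceMove  : Move

record Machine : Set₁ where
  field
    Q        : Set
    Q-finite : Finite Q
    Γ        : Set
    Γ-finite : Finite Γ
    blank    : Γ
    tapes    : ℕ
    start    : Q
    -- `just true`: accepting, `just false`: rejecting, `nothing`: not halting
    verdict  : Q → Maybe Bool
    -- The arguments after the state are the input symbol at the address on the
    -- index tape (`nothing` if out of range), and the symbols scanned on the
    -- index tape, the choice tape (`nothing` is the endmarker) and the work
    -- tapes.  Irrelevant on halting states.
    δ        : Q → Maybe InputSymbol → Bool → Maybe Bool → Vec Γ tapes →
               Instruction Q Γ tapes

module Semantics (M : Machine) (x : Word) (k : ℕ) where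

  open Machine M
  open Instruction
  open Tape using (current)

  record Config : Set where
    constructor config
    field
      state  : Q
      index  : Tape Bool
      work   : Vec (Tape Γ) tapes
      choice : ChoiceTape

  open Config public

  initial : Config
  initial = config start (blankTape false) (Vec.replicate tapes (blankTape blank)) unread

  inputSymbol : Config → Maybe InputSymbol
  inputSymbol c = List.head (drop (address (index c)) (encode x k))

  instruction : Config → Instruction Q Γ tapes
  instruction c =
    δ (state c) (inputSymbol c) (current (index c)) (scanned (choice c)) (Vec.map current (work c))

  act : {A : Set} → A → A × Move → Tape A → Tape A
  act b (a , m) t = shift b m (write a t)

  advance : Config → ChoiceTape → Config
  advance c t = config
    (next i)
    (act false (indexAction i) (index c))
    (Vec.zipWith (act blank) (workActions i) (work c))
    t
    where i = instruction c

  infix 4 _⟶_ _⟶*_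

  data _⟶_ (c : Config) : Config → Set where
    step : ∀ {t} → verdict (state c) ≡ nothing →
           ChoiceMove (choiceMove (instruction c)) (choice c) t → c ⟶ advance c t

  _⟶*_ : Config → Config → Set
  _⟶*_ = Star _⟶_

  steps : ∀ {c d} → c ⟶* d → ℕ
  steps ε        = 0
  steps (_ ◅ ss) = suc (steps ss)

  Nondeterministic : ∀ {c d} → c ⟶ d → Set
  Nondeterministic (step _ m) = EntersNewCell m

  AllDeterministic : ∀ {c d} → c ⟶* d → Set
  AllDeterministic ε        = ⊤
  AllDeterministic (s ◅ ss) = (¬ Nondeterministic s) × AllDeterministic ss

  AcceptingPath : Set
  AcceptingPath = Σ[ c ∈ Config ] (initial ⟶* c) × verdict (state c) ≡ just true

  -- The choice tape is not counted.
  space : Config → ℕ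
  space c = size (index c) + Vec.sum (Vec.map size (work c))

open Semantics

#acc[_]⟨_,_⟩≡_ : Machine → Word → ℕ → ℕ → Set
#acc[ M ]⟨ x , k ⟩≡ n = Fin n ↔ AcceptingPath M x k

------------------------------------------------------------------------
-- Resource bounds

-- Space O(log|x| + f(k)), with an index tape of size logarithmic in the input.
ParaL : Machine → Set
ParaL M =
  Σ[ f ∈ (ℕ → ℕ) ] Computable f × (∃[ a ] (∀ x k {c} → (_⟶*_ M x k (initial M x k) c) →
    space M x k c ≤ a * (log (length x) + f k) ×
    size (index c) ≤ a * log (length (encode x k))))

KBounded : Machine → Set
KBounded M =
  Σ[ f ∈ (ℕ → ℕ) ] Computable f × (∀ x k {c} → (_⟶*_ M x k (initial M x k) c) →
    bitsRead (choice c) ≤ f k * log (length x))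

ReadOnce : Machine → Set
ReadOnce M =
  ∀ x k {c} → (_⟶*_ M x k (initial M x k) c) → Machine.verdict M (state c) ≡ nothing →
    Instruction.choiceMove (instruction M x k c) ≢ left

TailNondeterministic : Machine → Set
TailNondeterministic M =
  Σ[ g ∈ (ℕ → ℕ) ] Computable g × (∀ x k {c c′ d}
    (ss : _⟶*_ M x k (initial M x k) c) (s : _⟶_ M x k c c′) (ts : _⟶*_ M x k c′ d) →
    AllDeterministic M x k ss → Nondeterministic M x k s →
    steps M x k ts ≤ g k * log (length x))

------------------------------------------------------------------------
-- The counting classes

data Class : Set where
  W W[1] β β-tail : Class

Restriction : Class → Machine → Set
Restriction W      M = ⊤
Restriction W[1]   M = TailNondeterministic M
Restriction β      M = ReadOnce M
Restriction β-tail M = ReadOnce M × TailNondeterministic M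

infix 4 _∈#para[_]-L

_∈#para[_]-L : ParamFun → Class → Set₁
F ∈#para[ C ]-L =
  Σ[ M ∈ Machine ] ParaL M × KBounded M × Restriction C M ×
    (∀ x k → #acc[ M ]⟨ x , k ⟩≡ F x k)

{-# OPTIONS --safe #-}

-- Both machines are run one after the other, for the product on consecutive
-- segments of the choice tape, for the sum after a bit that selects one of them.
-- Two things have to be arranged.
--
-- Choice tape: a two-way machine must neither leave its segment nor forget where
-- it ends.  So every choice bit is stored together with a guess whether it is the
-- last one read, of which exactly one is right, and with a cell that tells it
-- apart from the endmarker of a segment.
--
-- Tail-nondeterminism: the deterministic prefixes of both machines have to be
-- run before the first nondeterministic step.  The index tape of the suspended
-- machine is kept as a track of a work tape whose head moves along with the
-- index head, and is exchanged with the index tape by one sweep.  A prefix that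
-- does not halt would block the other machine; it is detected by a counter
-- with one digit for each step taken from an unvisited cell, which overflows only
-- if some configuration has been repeated.

module Submission where

open import Axiom.UniquenessOfIdentityProofs.WithK using (uip)
open import Data.Bool.Base using (Bool; true; false; not; _∨_)
open import Data.Empty using (⊥)
open import Data.Fin.Base as Fin using (Fin; zero; suc; toℕ)
import Data.Fin.Properties as Fin
open import Data.List.Base as List using (List; []; _∷_; _++_; drop; foldr; length; replicate; reverse)
import Data.List.Properties as List
open import Data.List.Relation.Unary.All as All using (All; []; _∷_)
import Data.List.Relation.Unary.All.Properties as All
open import Data.Maybe.Base as Maybe using (Maybe; just; nothing)
open import Data.Nat.Base
open import Data.Nat.Logarithm using (⌈log₂_⌉)
open import Data.Nat.Properties
open import Data.Nat.Tactic.RingSolver using (solve-∀)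
open import Data.Product as Product using (Σ-syntax; ∃-syntax; _×_; _,_; proj₁; proj₂)
open import Data.Product.Function.NonDependent.Propositional using (_×-↔_)
open import Data.Sum.Base as Sum using (_⊎_; inj₁; inj₂)
open import Data.Sum.Function.Propositional using (_⊎-↔_)
open import Data.Unit.Base using (⊤; tt)
open import Data.Vec.Base as Vec using (Vec; []; _∷_)
import Data.Vec.Properties as Vec
open import Data.Vec.Relation.Binary.Pointwise.Inductive using ([]; _∷_)
open import Function.Base using (_∘_; id)
open import Function.Bundles using (Injection; _↔_; mk↔ₛ′; Inverse; _⇔_; mk⇔; Equivalence)
open import Function.Properties.Inverse using (↔⇒↣; ↔-sym; ↔-trans; ↔-refl)
open import Relation.Binary.Construct.Closure.ReflexiveTransitive using (ε; _◅_)
open import Relation.Binary.PropositionalEquality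
open import Relation.Nullary using (¬_; yes; no; contradiction)
open import Defs

-- Paths are counted through words: on a fixed input an accepting path is determined by the choice
-- bits that it consumes, and no accepted word is a proper prefix of another. So it suffices that
-- the composite accepts exactly the words `us ++ true ∷ vs` for the product, and `true ∷ us` and
-- `false ∷ true ∷ vs` for the sum. Any bit directly in front of a segment is then `true` and serves
-- as its endmarker; this is why the extra cell of a stored bit holds `false`. Knowing the last bit
-- allows the head to be brought to the end of the segment before a separator is revealed.
--
-- The clock cannot be set in advance, since a machine does not compute its own space bound. Its
-- length follows the space used so far, and its base is so large that the digits count beyond the
-- number of configurations of that width.
--
-- The whole content of the index tape is the address, and its length must stay logarithmic, so two
-- addresses cannot share it; but trailing zeros, being high-order digits, are harmless. The
-- exchange that gives the tape back takes place in the tail. It is linear in the space bound, which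
-- a tail bound absorbs.

data View (S : Set) : Set where
  halt   : Bool → View S
  det    : S → View S
  branch : (Bool → S) → View S

mapView : ∀ {A B} → (A → B) → View A → View B
mapView g (halt b)   = halt b
mapView g (det s)    = det (g s)
mapView g (branch f) = branch (g ∘ f)

data ViewRel {A B : Set} (R : A → B → Set) : View A → View B → Set where
  halt   : ∀ {b} → ViewRel R (halt b) (halt b)
  det    : ∀ {s t} → R s t → ViewRel R (det s) (det t)
  branch : ∀ {f g} → (∀ b → R (f b) (g b)) → ViewRel R (branch f) (branch g)

-- In all four types below a machine is viewed as a coalgebra v; the words index
-- computations by the choice bits they consume.

data Run {S} (v : S → View S) (P : S → Set) : S → ℕ → S → Set where
  []   : ∀ {s} → Run v P s 0 s
  step : ∀ {s t u n} → P s → v s ≡ det t → Run v P t n u → Run v P s (suc n) u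

data Acc {S} (v : S → View S) : S → List Bool → Set where
  done   : ∀ {s} → v s ≡ halt true → Acc v s []
  det    : ∀ {s t ws} → v s ≡ det t → Acc v t ws → Acc v s ws
  branch : ∀ {s f ws} → v s ≡ branch f → ∀ b → Acc v (f b) ws → Acc v s (b ∷ ws)

data Reach {S} (v : S → View S) : S → S → Set where
  here   : ∀ {s} → Reach v s s
  det    : ∀ {s t u} → v s ≡ det t → Reach v t u → Reach v s u
  branch : ∀ {s f u} → v s ≡ branch f → ∀ b → Reach v (f b) u → Reach v s u

data Within {S} (v : S → View S) : ℕ → S → Set where
  halt   : ∀ {s n b} → v s ≡ halt b → Within v n s
  det    : ∀ {s t n} → v s ≡ det t → Within v n t → Within v (suc n) s
  branch : ∀ {s f n} → v s ≡ branch f → (∀ b → Within v n (f b)) → Within v (suc n) s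

Any : {S : Set} → S → Set
Any _ = ⊤

Stuck : ∀ {S} → (S → View S) → S → Set
Stuck v s = ∀ {t} → v s ≢ det t

-- Accepted words and deterministic runs of a coalgebra

module _ {S : Set} {v : S → View S} where

  det-inj : ∀ {s t u} → v s ≡ det t → v s ≡ det u → t ≡ u
  det-inj p q with refl ← trans (sym p) q = refl

  branch-inj : ∀ {s f g} → v s ≡ branch f → v s ≡ branch g → f ≡ g
  branch-inj p q with refl ← trans (sym p) q = refl

  -- Once the consumed bits are fixed no choice remains, so a derivation carries no information
  -- beyond its word. This reduces counting accepting paths to counting words.
  acc-unique : ∀ {s ws} (p q : Acc v s ws) → p ≡ q
  acc-unique (done p) (done q) = cong done (uip p q)
  acc-unique (done p) (det q _) with () ← trans (sym p) q
  acc-unique (det p _) (done q) with () ← trans (sym p) q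
  acc-unique (det p a) (det q b) with refl ← det-inj p q =
    cong₂ det (uip p q) (acc-unique a b)
  acc-unique (det p _) (branch q _ _) with () ← trans (sym p) q
  acc-unique (branch p _ _) (det q _) with () ← trans (sym p) q
  acc-unique (branch p b a) (branch q .b a′) with refl ← branch-inj p q =
    cong₂ (λ p a → branch p b a) (uip p q) (acc-unique a a′)

  -- The machine halts as soon as it accepts, and the word lists all bits consumed up to then. This
  -- makes the place of the separator in `us ++ true ∷ vs` unambiguous.
  acc-prefix-free : ∀ {s us vs xs ys} → Acc v s us → Acc v s vs → us ++ xs ≡ vs ++ ys → us ≡ vs
  acc-prefix-free (done p) (done q) _ = refl
  acc-prefix-free (done p) (det q _) _ with () ← trans (sym p) q
  acc-prefix-free (done p) (branch q _ _) _ with () ← trans (sym p) q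
  acc-prefix-free (det p _) (done q) _ with () ← trans (sym p) q
  acc-prefix-free (det p a) (det q b) e with refl ← det-inj p q = acc-prefix-free a b e
  acc-prefix-free (det p _) (branch q _ _) _ with () ← trans (sym p) q
  acc-prefix-free (branch p _ _) (done q) _ with () ← trans (sym p) q
  acc-prefix-free (branch p _ _) (det q _) _ with () ← trans (sym p) q
  acc-prefix-free (branch p b a) (branch q b′ a′) e
    with refl ← branch-inj p q | refl , e′ ← List.∷-injective e =
    cong (b ∷_) (acc-prefix-free a a′ e′)

  len : ∀ {s ws} → Acc v s ws → ℕ
  len (done _)       = 0
  len (det _ a)      = suc (len a)
  len (branch _ _ a) = suc (len a)

  not-rejected : ∀ {s ws} → v s ≡ halt false → ¬ Acc v s ws
  not-rejected p (done q) with () ← trans (sym p) q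
  not-rejected p (det q _) with () ← trans (sym p) q
  not-rejected p (branch q _ _) with () ← trans (sym p) q

  acc-halted : ∀ {s ws} → v s ≡ halt true → Acc v s ws → ws ≡ []
  acc-halted p (done q) = refl
  acc-halted p (det q _) with () ← trans (sym p) q
  acc-halted p (branch q _ _) with () ← trans (sym p) q

  acc-det : ∀ {s t ws} → v s ≡ det t → (a : Acc v s ws) → Σ[ a′ ∈ Acc v t ws ] len a ≡ suc (len a′)
  acc-det p (done q) with () ← trans (sym p) q
  acc-det p (det q a) with refl ← det-inj p q = a , refl
  acc-det p (branch q _ _) with () ← trans (sym p) q

  acc-branch : ∀ {s f ws} → v s ≡ branch f → (a : Acc v s ws) →
    ∃[ b ] ∃[ ws′ ] ws ≡ b ∷ ws′ × (Σ[ a′ ∈ Acc v (f b) ws′ ] len a ≡ suc (len a′))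
  acc-branch p (done q) with () ← trans (sym p) q
  acc-branch p (det q _) with () ← trans (sym p) q
  acc-branch p (branch q b a) with refl ← branch-inj p q = b , _ , refl , a , refl

  module _ {P : S → Set} where

    _+++_ : ∀ {s t u m n} → Run v P s m t → Run v P t n u → Run v P s (m + n) u
    []         +++ r′ = r′
    step p e r +++ r′ = step p e (r +++ r′)

    run-acc : ∀ {s t n ws} → Run v P s n t → Acc v t ws → Acc v s ws
    run-acc []           a = a
    run-acc (step _ e r) a = det e (run-acc r a)

    acc-run : ∀ {s t n ws} → Run v P s n t → (a : Acc v s ws) →
      Σ[ a′ ∈ Acc v t ws ] len a ≡ n + len a′
    acc-run []           a = a , refl
    acc-run (step _ e r) a with a₁ , q₁ ← acc-det e a with a₂ , q₂ ← acc-run r a₁ =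
      a₂ , trans q₁ (cong suc q₂)

    run-reach : ∀ {s t u n} → Run v P s n t → Reach v t u → Reach v s u
    run-reach []           a = a
    run-reach (step _ e r) a = det e (run-reach r a)

    -- A state reached from the start of a run lies on it or beyond it.
    reach-run : ∀ {s t u n} → Run v P s n t → Reach v s u → P u ⊎ Reach v t u
    reach-run []           a    = inj₂ a
    reach-run (step p e r) here = inj₁ p
    reach-run (step p e r) (det q a) with refl ← det-inj e q = reach-run r a
    reach-run (step p e r) (branch q _ _) with () ← trans (sym e) q

    run-within : ∀ {s t n m} → Run v P s n t → Within v m t → Within v (n + m) s
    run-within []           w = w
    run-within (step _ e r) w = det e (run-within r w)

    within-run : ∀ {s t n m} → Run v P s n t → Within v m s → Within v m t
    within-run []           w = w
    within-run (step _ e r) (halt q) with () ← trans (sym e) q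
    within-run (step _ e r) (det q w) with refl ← det-inj e q = within-mono (within-run r w)
      where
      within-mono : ∀ {n s} → Within v n s → Within v (suc n) s
      within-mono (halt q)     = halt q
      within-mono (det q w)    = det q (within-mono w)
      within-mono (branch q w) = branch q (within-mono ∘ w)
    within-run (step _ e r) (branch q _) with () ← trans (sym e) q

  within-≤ : ∀ {m n s} → m ≤ n → Within v m s → Within v n s
  within-≤ _         (halt q)     = halt q
  within-≤ (s≤s m≤n) (det q w)    = det q (within-≤ m≤n w)
  within-≤ (s≤s m≤n) (branch q w) = branch q (within-≤ m≤n ∘ w)

  weaken : ∀ {P Q : S → Set} {s n t} → (∀ {s} → P s → Q s) → Run v P s n t → Run v Q s n t
  weaken f []           = []
  weaken f (step p e r) = step (f p) e (weaken f r)

  reach-++ : ∀ {s t u} → Reach v s t → Reach v t u → Reach v s u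
  reach-++ here           r = r
  reach-++ (det e q)      r = det e (reach-++ q r)
  reach-++ (branch e b q) r = branch e b (reach-++ q r)

  reach-det : ∀ {s t u} → Reach v s t → v t ≡ det u → Reach v s u
  reach-det r e = reach-++ r (det e here)

  reach-branch : ∀ {s t f} → Reach v s t → v t ≡ branch f → ∀ b → Reach v s (f b)
  reach-branch r e b = reach-++ r (branch e b here)

  module _ {P Q : S → Set} where

    -- Used against a repeated configuration on a run that gets stuck: it would have two different
    -- distances to the end.
    stuck-unique : ∀ {s t u m n} → Run v P s m t → Run v Q s n u → Stuck v t → Stuck v u → m ≡ n
    stuck-unique []           []           _  _  = refl
    stuck-unique []           (step _ e _) st _  = contradiction e st
    stuck-unique (step _ e _) []           _  su = contradiction e su
    stuck-unique (step _ e r) (step _ q r′) st su with refl ← det-inj e q =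
      cong suc (stuck-unique r r′ st su)

    -- Up to the first branching there is only one computation, so the branching state `u` cannot
    -- lie before `t`; a time bound at `t` is therefore also one after the branching.
    first-branch : ∀ {s t u m n N f} → Run v P s m t → Within v N t → Run v Q s n u →
      v u ≡ branch f → ∀ b → Within v N (f b)
    first-branch [] w r′ e b with within-run r′ w
    ... | halt q with () ← trans (sym e) q
    ... | det q _ with () ← trans (sym e) q
    ... | branch q w′ with refl ← branch-inj e q = within-≤ (n≤1+n _) (w′ b)
    first-branch (step _ q _) w [] e b with () ← trans (sym e) q
    first-branch (step _ q r) w (step _ q′ r′) e b with refl ← det-inj q q′ =
      first-branch r w r′ e b

  acc-stuck : ∀ {s ws} → Acc v s ws → ∃[ n ] ∃[ t ] Run v Any s n t × Stuck v t
  acc-stuck (done e)       = _ , _ , [] , λ q → contradiction (trans (sym e) q) λ ()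
  acc-stuck (branch e _ _) = _ , _ , [] , λ q → contradiction (trans (sym e) q) λ ()
  acc-stuck (det e a) with n , t , r , st ← acc-stuck a = suc n , t , step tt e r , st

  -- For machines that work in bursts: `R` holds between bursts, `P` at all states inside them. A
  -- burst has at least one step, which lets an induction on the length of a computation get through
  -- it.
  data Progress (P R : S → Set) (s : S) : Set where
    halts    : ∀ {b} → P s → v s ≡ halt b → Progress P R s
    runs     : ∀ {n t} → Run v P s (suc n) t → R t → Progress P R s
    branches : ∀ {f} → P s → v s ≡ branch f → (∀ b → R (f b)) → Progress P R s

  reach-length : ∀ {s t} → Reach v s t → ℕ
  reach-length here           = 0
  reach-length (det _ r)      = suc (reach-length r)
  reach-length (branch _ _ r) = suc (reach-length r)

  module _ {P R : S → Set} (progress : ∀ {s} → R s → Progress P R s) where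

    private
      descend : ∀ {s t u n} → Run v P s n t → (r : Reach v s u) →
        P u ⊎ (Σ[ r′ ∈ Reach v t u ] reach-length r ≡ n + reach-length r′)
      descend []           r    = inj₂ (r , refl)
      descend (step p e r) here = inj₁ p
      descend (step p e r) (det q r′) with refl ← det-inj e q with descend r r′
      ... | inj₁ p′       = inj₁ p′
      ... | inj₂ (r″ , l) = inj₂ (r″ , cong suc l)
      descend (step p e r) (branch q _ _) with () ← trans (sym e) q

      -- What remains of a computation beyond a burst is shorter, but not a subterm; hence the
      -- explicit bound `N`.
      safe-within : ∀ N {s u} → R s → (r : Reach v s u) → reach-length r ≤ N → P u
      safe-within N r ρ l with progress r
      safe-within N r here l             | halts p e = p
      safe-within N r (det q _) l        | halts p e with () ← trans (sym e) q
      safe-within N r (branch q _ _) l   | halts p e with () ← trans (sym e) q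
      safe-within N r here l             | branches p e k = p
      safe-within N r (det q _) l        | branches p e k with () ← trans (sym e) q
      safe-within (suc N) r (branch q b ρ) (s≤s l) | branches p e k with refl ← branch-inj e q =
        safe-within N (k b) ρ l
      safe-within N r ρ l                | runs {n} w r′ with descend w ρ
      ... | inj₁ p = p
      safe-within (suc N) r ρ l | runs {n} w r′ | inj₂ (ρ′ , e) =
        safe-within N r′ ρ′ (≤-pred (≤-trans (s≤s (m≤n+m _ n)) (≤-trans (≤-reflexive (sym e)) l)))
      safe-within zero r ρ l | runs {n} w r′ | inj₂ (ρ′ , e) with () ← ≤-trans (≤-reflexive (sym e)) l

    safe : ∀ {s u} → R s → Reach v s u → P u
    safe r ρ = safe-within _ r ρ ≤-refl

  at : ∀ {P : S → Set} {s n t} → Run v P s n t → Fin (suc n) → S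
  at {s = s} _        zero    = s
  at (step _ _ r)     (suc i) = at r i

  from : ∀ {P : S → Set} {s n t} (r : Run v P s n t) i → Run v P (at r i) (n ∸ toℕ i) t
  from []           zero    = []
  from (step p e r) zero    = step p e r
  from (step _ _ r) (suc i) = from r i

  run-invariant : ∀ {P I : S → Set} → (∀ {s t} → v s ≡ det t → I s → I t) →
    ∀ {s n t} (r : Run v P s n t) → I s → ∀ i → I (at r i)
  run-invariant pres r            h zero    = h
  run-invariant pres (step _ e r) h (suc i) = run-invariant pres r (pres e h) i

  run-invariant′ : ∀ {P I : S → Set} → (∀ {s t} → v s ≡ det t → I t → I s) →
    ∀ {s n t} (r : Run v P s n t) → I t → I s
  run-invariant′ pres []           h = h
  run-invariant′ pres (step _ e r) h = pres e (run-invariant′ pres r h)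

-- Lockstep simulation between coalgebras

module _ {A B C : Set} {R : A → B → Set} {f : C → A} {g : C → B} where

  map-rel : (∀ c → R (f c) (g c)) → ∀ w → ViewRel R (mapView f w) (mapView g w)
  map-rel r (halt b)   = halt
  map-rel r (det c)    = det (r c)
  map-rel r (branch h) = branch (r ∘ h)

module _ {A B : Set} {R : A → B → Set} where

  halt-rel : ∀ {s t b} → ViewRel R s t → s ≡ halt b → t ≡ halt b
  halt-rel halt refl = refl

  halt-rel′ : ∀ {s t b} → ViewRel R s t → t ≡ halt b → s ≡ halt b
  halt-rel′ halt refl = refl

  det-rel : ∀ {s t s′} → ViewRel R s t → s ≡ det s′ → ∃[ t′ ] t ≡ det t′ × R s′ t′
  det-rel (det r) refl = _ , refl , r

  det-rel′ : ∀ {s t t′} → ViewRel R s t → t ≡ det t′ → ∃[ s′ ] s ≡ det s′ × R s′ t′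
  det-rel′ (det r) refl = _ , refl , r

  branch-rel : ∀ {s t f} → ViewRel R s t → s ≡ branch f →
    ∃[ g ] t ≡ branch g × (∀ b → R (f b) (g b))
  branch-rel (branch r) refl = _ , refl , r

  branch-rel′ : ∀ {s t g} → ViewRel R s t → t ≡ branch g →
    ∃[ f ] s ≡ branch f × (∀ b → R (f b) (g b))
  branch-rel′ (branch r) refl = _ , refl , r

module Bisimulation {A B : Set} {v : A → View A} {w : B → View B} (R : A → B → Set)
                    (related : ∀ a b → R a b → ViewRel R (v a) (w b)) where

  acc→ : ∀ {a b ws} → R a b → Acc v a ws → Acc w b ws
  acc→ r (done e) = done (halt-rel (related _ _ r) e)
  acc→ r (det e a) with _ , q , r′ ← det-rel (related _ _ r) e = det q (acc→ r′ a)
  acc→ r (branch e b a) with _ , q , r′ ← branch-rel (related _ _ r) e = branch q b (acc→ (r′ b) a)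

  acc← : ∀ {a b ws} → R a b → Acc w b ws → Acc v a ws
  acc← r (done e) = done (halt-rel′ (related _ _ r) e)
  acc← r (det e a) with _ , q , r′ ← det-rel′ (related _ _ r) e = det q (acc← r′ a)
  acc← r (branch e b a) with _ , q , r′ ← branch-rel′ (related _ _ r) e = branch q b (acc← (r′ b) a)

  reach→ : ∀ {a b a′} → R a b → Reach v a a′ → ∃[ b′ ] Reach w b b′ × R a′ b′
  reach→ r here = _ , here , r
  reach→ r (det e p) with _ , q , r′ ← det-rel (related _ _ r) e with b′ , p′ , r″ ← reach→ r′ p =
    b′ , det q p′ , r″
  reach→ r (branch e b p) with _ , q , r′ ← branch-rel (related _ _ r) e
    with b′ , p′ , r″ ← reach→ (r′ b) p = b′ , branch q b p′ , r″

  within← : ∀ {a b n} → R a b → Within w n b → Within v n a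
  within← r (halt e) = halt (halt-rel′ (related _ _ r) e)
  within← r (det e p) with _ , q , r′ ← det-rel′ (related _ _ r) e = det q (within← r′ p)
  within← r (branch e p) with _ , q , r′ ← branch-rel′ (related _ _ r) e =
    branch q λ b → within← (r′ b) (p b)

  run← : ∀ {a b b′ n} → R a b → Run w Any b n b′ → ∃[ a′ ] Run v Any a n a′ × R a′ b′
  run← r [] = _ , [] , r
  run← r (step _ e p) with _ , q , r′ ← det-rel′ (related _ _ r) e with a′ , p′ , r″ ← run← r′ p =
    a′ , step tt q p′ , r″

-- Machines as coalgebras, accepting paths as words

resolve : {A : Set} → Maybe Bool → View A → View A
resolve (just b) _ = halt b
resolve nothing  v = v

moved : Move → ChoiceTape → View ChoiceTape
moved left  (choiceTape [] bs)       = det (choiceTape [] bs)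
moved left  (choiceTape (b ∷ as) bs) = det (choiceTape as (b ∷ bs))
moved stay  t                        = det t
moved right (choiceTape as (b ∷ bs)) = det (choiceTape (b ∷ as) bs)
moved right (choiceTape as [])       = branch λ b → choiceTape (b ∷ as) []

resolve-rel : ∀ {A B : Set} {R : A → B → Set} h {v w} → ViewRel R v w → ViewRel R (resolve h v) (resolve h w)
resolve-rel (just b) _ = halt
resolve-rel nothing  r = r

resolve-det : ∀ {A B : Set} h (g : A → B) w {d} → resolve h (mapView g w) ≡ det d →
  h ≡ nothing × (∃[ u ] w ≡ det u × d ≡ g u)
resolve-det nothing g (det u) refl = refl , u , refl , refl

resolve-branch : ∀ {A B : Set} h (g : A → B) w {f} → resolve h (mapView g w) ≡ branch f →
  h ≡ nothing × (∃[ f′ ] w ≡ branch f′ × f ≡ g ∘ f′)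
resolve-branch nothing g (branch f) refl = refl , f , refl , refl

moved≢halt : ∀ {m t b} → moved m t ≢ halt b
moved≢halt {left}  {choiceTape [] bs}       ()
moved≢halt {left}  {choiceTape (b ∷ as) bs} ()
moved≢halt {stay}                           ()
moved≢halt {right} {choiceTape as []}       ()
moved≢halt {right} {choiceTape as (b ∷ bs)} ()

newBits : ∀ {m t u} → ChoiceMove m t u → List Bool
newBits (fresh b) = b ∷ []
newBits _         = []

moved-det : ∀ {m t u} → moved m t ≡ det u → Σ[ c ∈ ChoiceMove m t u ] newBits c ≡ [] × ¬ EntersNewCell c
moved-det {left}  {choiceTape [] bs}       refl = atEnd , refl , id
moved-det {left}  {choiceTape (b ∷ as) bs} refl = back , refl , id
moved-det {stay}                           refl = stay , refl , id
moved-det {right} {choiceTape as (b ∷ bs)} refl = revisit , refl , id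

moved-branch : ∀ {m t f} → moved m t ≡ branch f → ∀ b →
  Σ[ c ∈ ChoiceMove m t (f b) ] newBits c ≡ b ∷ [] × EntersNewCell c
moved-branch {left}  {choiceTape [] bs}       ()
moved-branch {left}  {choiceTape (b ∷ as) bs} ()
moved-branch {right} {choiceTape as []} refl b = fresh b , refl , tt

choiceMove-view : ∀ {m t u} (c : ChoiceMove m t u) →
  (newBits c ≡ [] × ¬ EntersNewCell c × moved m t ≡ det u) ⊎
  (∃[ f ] ∃[ b ] newBits c ≡ b ∷ [] × EntersNewCell c × moved m t ≡ branch f × u ≡ f b)
choiceMove-view stay      = inj₁ (refl , id , refl)
choiceMove-view atEnd     = inj₁ (refl , id , refl)
choiceMove-view back      = inj₁ (refl , id , refl)
choiceMove-view revisit   = inj₁ (refl , id , refl)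
choiceMove-view (fresh b) = inj₂ (_ , b , refl , tt , refl , refl)

-- `m` and `t` decide whether a bit is revealed, so the two concatenations are split at the same
-- place; a revealed bit then fixes the new tape.
choiceMove-unique : ∀ {m t u u′ r r′} (c : ChoiceMove m t u) (c′ : ChoiceMove m t u′) →
  newBits c ++ r ≡ newBits c′ ++ r′ →
  Σ[ e ∈ u ≡ u′ ] subst (ChoiceMove m t) e c ≡ c′ × r ≡ r′
choiceMove-unique stay      stay       e    = refl , refl , e
choiceMove-unique atEnd     atEnd      e    = refl , refl , e
choiceMove-unique back      back       e    = refl , refl , e
choiceMove-unique revisit   revisit    e    = refl , refl , e
choiceMove-unique (fresh b) (fresh .b) refl = refl , refl , refl

view : (M : Machine) (x : Word) (k : ℕ) → Semantics.Config M x k → View (Semantics.Config M x k)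
view M x k c = resolve (Machine.verdict M (state c)) (mapView (advance c) (moved (choiceMove (instruction c)) (choice c)))
  where
  open Semantics M x k
  open Instruction

-- The choice tape may already hold visited cells when M is started.
initialOn : (M : Machine) (x : Word) (k : ℕ) → List Bool → Semantics.Config M x k
initialOn M x k u = record (Semantics.initial M x k) { choice = choiceTape u [] }

module Paths (M : Machine) (x : Word) (k : ℕ) where

  open Machine M using (verdict)
  open Semantics M x k
  open Instruction

  private
    v = view M x k

  bits : ∀ {c d} → c ⟶* d → List Bool
  bits ε              = []
  bits (step _ m ◅ p) = newBits m ++ bits p

  view-halt : ∀ {c b} → verdict (state c) ≡ just b → v c ≡ halt b
  view-halt e rewrite e = refl

  halt-view : ∀ {c b} → v c ≡ halt b → verdict (state c) ≡ just b
  halt-view {c} e with verdict (state c)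
  halt-view refl | just b = refl
  halt-view {c} e | nothing
    with moved (choiceMove (instruction c)) (choice c) in q
  halt-view () | nothing | det _
  halt-view () | nothing | branch _
  halt-view {c} e | nothing | halt b = contradiction q (moved≢halt {choiceMove (instruction c)})

  view-step : ∀ {c} → verdict (state c) ≡ nothing →
    v c ≡ mapView (advance c) (moved (choiceMove (instruction c)) (choice c))
  view-step e rewrite e = refl

  det-step : ∀ {c d} → v c ≡ det d →
    Σ[ s ∈ c ⟶ d ] ¬ Nondeterministic s × (∀ {d′} (p : d ⟶* d′) → bits (s ◅ p) ≡ bits p)
  det-step {c} e with q , t , r , refl ← resolve-det (verdict (state c)) (advance c) (moved (choiceMove (instruction c)) (choice c)) e
    with m , n , ¬new ← moved-det {choiceMove (instruction c)} r =
    step q m , ¬new , λ p → cong (_++ bits p) n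

  branch-step : ∀ {c f} → v c ≡ branch f → ∀ b →
    Σ[ s ∈ c ⟶ f b ] Nondeterministic s × (∀ {d′} (p : f b ⟶* d′) → bits (s ◅ p) ≡ b ∷ bits p)
  branch-step {c} e b with q , t , r , refl ← resolve-branch (verdict (state c)) (advance c) (moved (choiceMove (instruction c)) (choice c)) e
    with m , n , new ← moved-branch {choiceMove (instruction c)} r b =
    step q m , new , λ p → cong (_++ bits p) n

  step-view : ∀ {c d} (s : c ⟶ d) →
    (v c ≡ det d × ¬ Nondeterministic s × (∀ {d′} (p : d ⟶* d′) → bits (s ◅ p) ≡ bits p)) ⊎
    (∃[ f ] ∃[ b ] v c ≡ branch f × d ≡ f b × Nondeterministic s ×
      (∀ {d′} (p : d ⟶* d′) → bits (s ◅ p) ≡ b ∷ bits p))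
  step-view {c} (step q m) with choiceMove-view m
  ... | inj₁ (n , ¬new , e) =
    inj₁ (trans (view-step q) (cong (mapView (advance c)) e) , ¬new , λ p → cong (_++ bits p) n)
  ... | inj₂ (f , b , n , new , e , refl) =
    inj₂ (_ , b , trans (view-step q) (cong (mapView (advance c)) e) , refl , new ,
          λ p → cong (_++ bits p) n)

  reach→path : ∀ {c d} → Reach v c d → c ⟶* d
  reach→path here           = ε
  reach→path (det e r)      = proj₁ (det-step e) ◅ reach→path r
  reach→path (branch e b r) = proj₁ (branch-step e b) ◅ reach→path r

  path→reach : ∀ {c d} → c ⟶* d → Reach v c d
  path→reach ε = here
  path→reach (s ◅ p) with step-view s
  ... | inj₁ (e , _)                = det e (path→reach p)
  ... | inj₂ (f , b , e , refl , _) = branch e b (path→reach p)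

  path→acc : ∀ {c d} (p : c ⟶* d) → verdict (state d) ≡ just true → Acc v c (bits p)
  path→acc ε q = done (view-halt q)
  path→acc (s ◅ p) q with step-view s
  ... | inj₁ (e , _ , n) = subst (Acc v _) (sym (n p)) (det e (path→acc p q))
  ... | inj₂ (f , b , e , refl , _ , n) = subst (Acc v _) (sym (n p)) (branch e b (path→acc p q))

  Accepted : Config → Set
  Accepted c = Σ[ d ∈ Config ] (c ⟶* d) × verdict (state d) ≡ just true

  acc→path : ∀ {c ws} → Acc v c ws → Σ[ (d , p , q) ∈ Accepted c ] bits p ≡ ws
  acc→path (done e) = (_ , ε , halt-view e) , refl
  acc→path (det e a) with (d , p , q) , r ← acc→path a | s , _ , n ← det-step e =
    (d , s ◅ p , q) , trans (n p) r
  acc→path (branch e b a) with (d , p , q) , r ← acc→path a | s , _ , n ← branch-step e b =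
    (d , s ◅ p , q) , trans (n p) (cong (b ∷_) r)

  path-unique : ∀ {c d d′} (p : c ⟶* d) (q : verdict (state d) ≡ just true)
    (p′ : c ⟶* d′) (q′ : verdict (state d′) ≡ just true) → bits p ≡ bits p′ →
    _≡_ {A = Accepted c} (d , p , q) (d′ , p′ , q′)
  path-unique ε q ε q′ _ = cong (λ q → _ , ε , q) (uip q q′)
  path-unique ε q (step q′ _ ◅ _) _ _ with () ← trans (sym q) q′
  path-unique (step q′ _ ◅ _) _ ε q _ with () ← trans (sym q) q′
  path-unique (step h m ◅ p) q (step h′ m′ ◅ p′) q′ e
    with refl ← uip h h′ | refl , refl , r ← choiceMove-unique m m′ e =
    cong (λ (d , p , q) → d , step h m ◅ p , q) (path-unique p q p′ q′ r)

  Words : Config → Set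
  Words c = ∃[ ws ] Acc v c ws

  -- A path can be rebuilt from the bits revealed along it (`path-unique`), and a word has only one
  -- derivation (`acc-unique`).
  accepted↔words : ∀ {c} → Accepted c ↔ Words c
  accepted↔words = mk↔ₛ′
    (λ (d , p , q) → bits p , path→acc p q)
    (λ (ws , a) → proj₁ (acc→path a))
    (λ (ws , a) → words-≡ (proj₂ (acc→path a)))
    (λ (d , p , q) → path-unique _ _ p q (proj₂ (acc→path (path→acc p q))))
    where
    words-≡ : ∀ {c} {(ws , a) (ws′ , a′) : Words c} → ws ≡ ws′ → (ws , a) ≡ (ws′ , a′)
    words-≡ refl = cong (_ ,_) (acc-unique _ _)

  count→ : ∀ {n} → #acc[ M ]⟨ x , k ⟩≡ n → Fin n ↔ Words (initialOn M x k [])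
  count→ i = ↔-trans i accepted↔words

  count← : ∀ {n} → Fin n ↔ Words (initialOn M x k []) → #acc[ M ]⟨ x , k ⟩≡ n
  count← i = ↔-trans i (↔-sym accepted↔words)

  within→steps : ∀ {n c d} → Within v n c → (p : c ⟶* d) → steps p ≤ n
  within→steps w ε = z≤n
  within→steps w (s ◅ p) with step-view s
  within→steps (halt q) (s ◅ p) | inj₁ (e , _) with () ← trans (sym e) q
  within→steps (det q w) (s ◅ p) | inj₁ (e , _) with refl ← det-inj {v = v} e q = s≤s (within→steps w p)
  within→steps (branch q w) (s ◅ p) | inj₁ (e , _) with () ← trans (sym e) q
  within→steps (halt q) (s ◅ p) | inj₂ (_ , _ , e , _) with () ← trans (sym e) q
  within→steps (det q w) (s ◅ p) | inj₂ (_ , _ , e , _) with () ← trans (sym e) q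
  within→steps (branch q w) (s ◅ p) | inj₂ (_ , b , e , refl , _)
    with refl ← branch-inj {v = v} e q = s≤s (within→steps (w b) p)

  steps→within : ∀ {n c} → (∀ {d} (p : c ⟶* d) → steps p ≤ n) → Within v n c
  steps→within {n} {c} h with v c in e
  ... | halt b = halt e
  steps→within {zero} {c} h | det d with () ← h (proj₁ (det-step e) ◅ ε)
  steps→within {suc n} {c} h | det d = det e (steps→within λ p → ≤-pred (h (proj₁ (det-step e) ◅ p)))
  steps→within {zero} {c} h | branch f with () ← h (proj₁ (branch-step e true) ◅ ε)
  steps→within {suc n} {c} h | branch f =
    branch e λ b → steps→within λ p → ≤-pred (h (proj₁ (branch-step e b) ◅ p))

  deterministic→run : ∀ {c d} (p : c ⟶* d) → AllDeterministic p → ∃[ n ] Run v Any c n d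
  deterministic→run ε _ = 0 , []
  deterministic→run (s ◅ p) (¬new , a) with step-view s
  ... | inj₁ (e , _) with n , r ← deterministic→run p a = suc n , step tt e r
  ... | inj₂ (_ , _ , _ , _ , new , _) = contradiction new ¬new

  run→deterministic : ∀ {c d n} → Run v Any c n d → Σ[ p ∈ c ⟶* d ] AllDeterministic p
  run→deterministic [] = ε , tt
  run→deterministic (step _ e r) with p , a ← run→deterministic r | s , ¬new , _ ← det-step e =
    s ◅ p , ¬new , a

tail→within : ∀ {M} ((g , _) : TailNondeterministic M) x k {n c f} →
  Run (view M x k) Any (initialOn M x k []) n c → view M x k c ≡ branch f →
  ∀ b → Within (view M x k) (g k * log (length x)) (f b)
tail→within {M} (g , _ , bound) x k r e b =
  steps→within λ ts → bound x k (proj₁ (run→deterministic r)) (proj₁ (branch-step e b)) ts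
    (proj₂ (run→deterministic r)) (proj₁ (proj₂ (branch-step e b)))
  where open Paths M x k

-- Tail-nondeterminism speaks of every way to reach the first nondeterministic step. By
-- `first-branch`, a single state on the deterministic prefix from which everything halts in time is
-- enough.
within→tail : ∀ {M g} → Computable g →
  (∀ x k → ∃[ n ] ∃[ c ] Run (view M x k) Any (initialOn M x k []) n c × Within (view M x k) (g k * log (length x)) c) →
  TailNondeterministic M
within→tail {M} {g} cg prefix = g , cg , bound
  where
  bound : ∀ x k {c c′ d} (ss : Semantics._⟶*_ M x k (Semantics.initial M x k) c) (s : Semantics._⟶_ M x k c c′)
    (ts : Semantics._⟶*_ M x k c′ d) → Semantics.AllDeterministic M x k ss → Semantics.Nondeterministic M x k s →
    Semantics.steps M x k ts ≤ g k * log (length x)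
  bound x k ss s ts all new with Paths.step-view M x k s
  ... | inj₁ (_ , ¬new , _) = contradiction new ¬new
  ... | inj₂ (f , b , e , refl , _) with n , r ← Paths.deterministic→run M x k ss all
                                      with m , d , ρ , w ← prefix x k =
    Paths.within→steps M x k (first-branch ρ w r e b) ts

-- `Restriction` with its two conditions abstracted. They can then be replaced by conditions on
-- machines started with a prefilled choice tape, and carried through each construction for all four
-- classes at once.
Both : Class → Set → Set → Set
Both W      A B = ⊤
Both W[1]   A B = B
Both β      A B = A
Both β-tail A B = A × B

module _ {M : Machine} where

  restriction→both : ∀ C → Restriction C M → Both C (ReadOnce M) (TailNondeterministic M)
  restriction→both W      r = r
  restriction→both W[1]   r = r
  restriction→both β      r = r
  restriction→both β-tail r = r

  both→restriction : ∀ C → Both C (ReadOnce M) (TailNondeterministic M) → Restriction C M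
  both→restriction W      r = r
  both→restriction W[1]   r = r
  both→restriction β      r = r
  both→restriction β-tail r = r

both-map : ∀ {A A′ B B′ : Set} → (A → A′) → (B → B′) → ∀ C → Both C A B → Both C A′ B′
both-map f g W      _       = tt
both-map f g W[1]   b       = g b
both-map f g β      a       = f a
both-map f g β-tail (a , b) = f a , g b

both-zip : ∀ {A₁ A₂ B₁ B₂ : Set} C → Both C A₁ B₁ → Both C A₂ B₂ → Both C (A₁ × A₂) (B₁ × B₂)
both-zip W      _         _         = tt
both-zip W[1]   b₁        b₂        = b₁ , b₂
both-zip β      a₁        a₂        = a₁ , a₂
both-zip β-tail (a₁ , b₁) (a₂ , b₂) = (a₁ , a₂) , (b₁ , b₂)

-- Finite sets

abstract
  finite-↔ : ∀ {A B : Set} → A ↔ B → Finite B → Finite A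
  finite-↔ i (n , j) = n , ↔-trans i j

  finite-⊤ : Finite ⊤
  finite-⊤ = 1 , mk↔ₛ′ (λ _ → zero) (λ _ → tt) (λ { zero → refl }) (λ _ → refl)

  finite-Bool : Finite Bool
  finite-Bool = 2 , ↔-sym Fin.2↔Bool

  finite-Fin : ∀ n → Finite (Fin n)
  finite-Fin n = n , ↔-refl

  finite-⊎ : ∀ {A B : Set} → Finite A → Finite B → Finite (A ⊎ B)
  finite-⊎ (m , i) (n , j) = m + n , ↔-trans (i ⊎-↔ j) (↔-sym Fin.+↔⊎)

  finite-× : ∀ {A B : Set} → Finite A → Finite B → Finite (A × B)
  finite-× (m , i) (n , j) = m * n , ↔-trans (i ×-↔ j) (↔-sym Fin.*↔×)

  finite-Maybe : ∀ {A : Set} → Finite A → Finite (Maybe A)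
  finite-Maybe fin = finite-↔ (mk↔ₛ′
    (λ { nothing → inj₁ tt ; (just a) → inj₂ a })
    (λ { (inj₁ _) → nothing ; (inj₂ a) → just a })
    (λ { (inj₁ _) → refl ; (inj₂ _) → refl })
    (λ { nothing → refl ; (just _) → refl }))
    (finite-⊎ finite-⊤ fin)

  finite-Vec : ∀ {A : Set} → Finite A → ∀ n → Finite (Vec A n)
  finite-Vec fin zero = finite-↔ (mk↔ₛ′ (λ _ → tt) (λ _ → []) (λ _ → refl) (λ { [] → refl })) finite-⊤
  finite-Vec fin (suc n) = finite-↔ (mk↔ₛ′
    (λ as → Vec.head as , Vec.tail as) (λ (a , as) → a ∷ as) (λ _ → refl) (λ { (_ ∷ _) → refl }))
    (finite-× fin (finite-Vec fin n))

-- Computable bounds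

computable-const : ∀ n → Computable (λ _ → n)
computable-const zero = zeroᶜ , λ _ → e-zero
computable-const (suc n) with c , e ← computable-const n =
  comp sucᶜ (c ∷ []) , λ k → e-comp (e k ∷ []) e-suc

addᶜ : Code 2
addᶜ = prec (proj zero) (comp sucᶜ (proj (suc zero) ∷ []))

addᶜ-eval : ∀ m n → Eval addᶜ (m ∷ n ∷ []) (m + n)
addᶜ-eval zero    n = e-prec₀ (e-proj zero)
addᶜ-eval (suc m) n = e-prec₁ (addᶜ-eval m n) (e-comp (e-proj (suc zero) ∷ []) e-suc)

computable-+ : ∀ {f g} → Computable f → Computable g → Computable (λ k → f k + g k)
computable-+ (c , e) (c′ , e′) =
  comp addᶜ (c ∷ c′ ∷ []) , λ k → e-comp (e k ∷ e′ k ∷ []) (addᶜ-eval _ _)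

computable-* : ∀ {f} n → Computable f → Computable (λ k → n * f k)
computable-* zero    _ = computable-const 0
computable-* (suc n) c = computable-+ c (computable-* n c)

-- Additive constants go into the factor of the O-notation; this works because `log` is never 0.
+-bound : ∀ {m} a b {X} → 1 ≤ X → m ≤ a * X + b → m ≤ (a + b) * X
+-bound a b {X} 1≤X h = ≤-trans h (≤-trans (+-monoʳ-≤ (a * X) (≤-trans (≤-reflexive (sym (*-identityʳ b)))
  (*-monoʳ-≤ b 1≤X))) (≤-reflexive (sym (*-distribʳ-+ X a b))))

1≤log : ∀ n → 1 ≤ log n
1≤log n = m≤m⊔n 1 ⌈log₂ n ⌉

-- Tapes

act : ∀ {A : Set} → A → A × Move → Tape A → Tape A
act b (a , m) t = shift b m (write a t)

mapTape : ∀ {A B : Set} → (A → B) → Tape A → Tape B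
mapTape f (tape ls a rs) = tape (List.map f ls) (f a) (List.map f rs)

module _ {A B : Set} (f : A → B) where

  map-act : ∀ b a m t → mapTape f (act b (a , m) t) ≡ act (f b) (f a , m) (mapTape f t)
  map-act b a left  (tape []       _ rs)       = refl
  map-act b a left  (tape (l ∷ ls) _ rs)       = refl
  map-act b a stay  (tape ls       _ rs)       = refl
  map-act b a right (tape ls       _ [])       = refl
  map-act b a right (tape ls       _ (r ∷ rs)) = refl

  cells-map : ∀ t → cells (mapTape f t) ≡ List.map f (cells t)
  cells-map (tape ls a rs) = sym (trans (List.map-++ f (reverse ls) (a ∷ rs))
    (cong (_++ f a ∷ List.map f rs) (List.reverse-map f ls)))

  size-map : ∀ t → size (mapTape f t) ≡ size t
  size-map t = trans (cong length (cells-map t)) (List.length-map f (cells t))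

size-length : ∀ {A : Set} (t : Tape A) → size t ≡ length (Tape.before t) + suc (length (Tape.after t))
size-length (tape ls a rs) = trans (List.length-++ (reverse ls)) (cong (_+ _) (List.length-reverse ls))

cells-shift : ∀ {A : Set} (b : A) m t →
  cells (shift b m t) ≡ cells t ⊎ (cells (shift b m t) ≡ cells t ++ b ∷ [] × Tape.current (shift b m t) ≡ b)
cells-shift b left  (tape []       a rs)       = inj₁ refl
cells-shift b left  (tape (l ∷ ls) a rs)       =
  inj₁ (sym (trans (cong (_++ a ∷ rs) (List.unfold-reverse l ls)) (List.++-assoc (reverse ls) _ _)))
cells-shift b stay  t                          = inj₁ refl
cells-shift b right (tape ls       a [])       =
  inj₂ (cong (_++ b ∷ []) (List.unfold-reverse a ls) , refl)
cells-shift b right (tape ls       a (r ∷ rs)) =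
  inj₁ (trans (cong (_++ r ∷ rs) (List.unfold-reverse a ls)) (List.++-assoc (reverse ls) _ _))

size-write : ∀ {A : Set} (a : A) t → size (write a t) ≡ size t
size-write a t = trans (size-length (write a t)) (sym (size-length t))

size-act : ∀ {A : Set} (b : A) p t → size t ≤ size (act b p t)
size-act b (a , m) t with cells-shift b m (write a t)
... | inj₁ e = ≤-reflexive (trans (sym (size-write a t)) (cong length (sym e)))
... | inj₂ (e , _) = ≤-trans (≤-reflexive (sym (size-write a t)))
  (≤-trans (m≤m+n _ 1) (≤-reflexive (trans (sym (List.length-++ (cells (write a t)))) (cong length (sym e)))))

sizes : ∀ {A : Set} {n} → Vec (Tape A) n → ℕ
sizes ts = Vec.sum (Vec.map size ts)

idle : ∀ {A : Set} {n} → Vec A n → Vec (A × Move) n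
idle = Vec.map (_, stay)

idle-act : ∀ {A : Set} (b : A) {n} (ts : Vec (Tape A) n) →
  Vec.zipWith (act b) (idle (Vec.map Tape.current ts)) ts ≡ ts
idle-act b []       = refl
idle-act b (t ∷ ts) = cong (t ∷_) (idle-act b ts)

map-acts : ∀ {A B : Set} (f : A → B) b {n} (as : Vec (A × Move) n) ts →
  Vec.map (mapTape f) (Vec.zipWith (act b) as ts) ≡
  Vec.zipWith (act (f b)) (Vec.map (Product.map₁ f) as) (Vec.map (mapTape f) ts)
map-acts f b []             []       = refl
map-acts f b ((a , m) ∷ as) (t ∷ ts) = cong₂ _∷_ (map-act f b a m t) (map-acts f b as ts)

map-currents : ∀ {A B : Set} (f : A → B) {n} (ts : Vec (Tape A) n) →
  Vec.map Tape.current (Vec.map (mapTape f) ts) ≡ Vec.map f (Vec.map Tape.current ts)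
map-currents f []       = refl
map-currents f (t ∷ ts) = cong (f (Tape.current t) ∷_) (map-currents f ts)

sizes-map : ∀ {A B : Set} (f : A → B) {n} (ts : Vec (Tape A) n) → sizes (Vec.map (mapTape f) ts) ≡ sizes ts
sizes-map f []       = refl
sizes-map f (t ∷ ts) = cong₂ _+_ (size-map f t) (sizes-map f ts)

sizes-++ : ∀ {A : Set} {m n} (ss : Vec (Tape A) m) (ts : Vec (Tape A) n) → sizes (ss Vec.++ ts) ≡ sizes ss + sizes ts
sizes-++ []       ts = refl
sizes-++ (s ∷ ss) ts = trans (cong (size s +_) (sizes-++ ss ts)) (sym (+-assoc (size s) _ _))


-- Padding on the right consists of high-order zeros. The digit function of `address` is local to it
-- and depends on the tape, so it enters as any function that obeys the two equations.
address-cong : (d d′ : Bool → ℕ → ℕ) →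
  (∀ n → d false n ≡ 2 * n) → (∀ n → d true n ≡ suc (2 * n)) →
  (∀ n → d′ false n ≡ 2 * n) → (∀ n → d′ true n ≡ suc (2 * n)) →
  ∀ {as} bs p → as ≡ bs ++ replicate p false → foldr d 0 as ≡ foldr d′ 0 bs
address-cong d d′ d₀ d₁ d′₀ d′₁ {as} = go
  where
  go : ∀ {as} bs p → as ≡ bs ++ replicate p false → foldr d 0 as ≡ foldr d′ 0 bs
  go []           zero    refl = refl
  go []           (suc p) refl = trans (d₀ _) (cong (2 *_) (go [] p refl))
  go (false ∷ bs) p       refl = trans (d₀ _) (trans (cong (2 *_) (go bs p refl)) (sym (d′₀ _)))
  go (true  ∷ bs) p       refl = trans (d₁ _) (trans (cong (λ n → suc (2 * n)) (go bs p refl)) (sym (d′₁ _)))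

address-padded : ∀ s t p → cells s ≡ cells t ++ replicate p false → address s ≡ address t
address-padded s t p e =
  address-cong _ _ (λ _ → refl) (λ _ → refl) (λ _ → refl) (λ _ → refl) (cells t) p e

-- Machines with typed tapes

record Op (Q S Γ₁ Γ₂ : Set) (n₁ n₂ : ℕ) : Set where
  constructor op
  field
    next  : Q
    dual  : (Bool × S) × Move
    acts₁ : Vec (Γ₁ × Move) n₁
    acts₂ : Vec (Γ₂ × Move) n₂
    move  : Move

-- The index tape carries an extra track over S, held on a work tape whose head
-- moves together with the index head.
record Typed : Set₁ where
  field
    Q         : Set
    Q-finite  : Finite Q
    S         : Set
    S-finite  : Finite S
    S-blank   : S
    Γ₁        : Set
    Γ₁-finite : Finite Γ₁
    blank₁    : Γ₁
    n₁        : ℕ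
    Γ₂        : Set
    Γ₂-finite : Finite Γ₂
    blank₂    : Γ₂
    n₂        : ℕ
    start     : Q
    verdict   : Q → Maybe Bool
    program   : Q → Maybe InputSymbol → Bool × S → Maybe Bool → Vec Γ₁ n₁ → Vec Γ₂ n₂ →
                Op Q S Γ₁ Γ₂ n₁ n₂

module Compile (T : Typed) where

  open Typed T
  open Op

  -- All work tapes of a machine share one alphabet. A tape of one sort keeps the components of the
  -- other sorts blank.
  Γ : Set
  Γ = S × Γ₁ × Γ₂

  ι : Bool × S → Γ
  ι (_ , s) = s , blank₁ , blank₂

  ι₁ : Γ₁ → Γ
  ι₁ a = S-blank , a , blank₂

  ι₂ : Γ₂ → Γ
  ι₂ a = S-blank , blank₁ , a

  lower : Op Q S Γ₁ Γ₂ n₁ n₂ → Instruction Q Γ (suc (n₁ + n₂))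
  lower o = record
    { next        = next o
    ; indexAction = Product.map₁ proj₁ (dual o)
    ; workActions = Product.map₁ ι (dual o) ∷
                    (Vec.map (Product.map₁ ι₁) (acts₁ o) Vec.++ Vec.map (Product.map₁ ι₂) (acts₂ o))
    ; choiceMove  = move o
    }

  machine : Machine
  machine = record
    { Q        = Q
    ; Q-finite = Q-finite
    ; Γ        = Γ
    ; Γ-finite = finite-× S-finite (finite-× Γ₁-finite Γ₂-finite)
    ; blank    = S-blank , blank₁ , blank₂
    ; tapes    = suc (n₁ + n₂)
    ; start    = start
    ; verdict  = verdict
    ; δ        = λ q i b c γs → lower (program q i (b , proj₁ (Vec.head γs)) c
                   (Vec.map (proj₁ ∘ proj₂) (Vec.take n₁ (Vec.tail γs)))
                   (Vec.map (proj₂ ∘ proj₂) (Vec.drop n₁ (Vec.tail γs))))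
    }

  record TConfig : Set where
    constructor tconfig
    field
      state  : Q
      dual   : Tape (Bool × S)
      work₁  : Vec (Tape Γ₁) n₁
      work₂  : Vec (Tape Γ₂) n₂
      choice : ChoiceTape

  open TConfig public

  tinitial : List Bool → TConfig
  tinitial u = tconfig start (blankTape (false , S-blank)) (Vec.replicate n₁ (blankTape blank₁))
    (Vec.replicate n₂ (blankTape blank₂)) (choiceTape u [])

  -- The dual tape counts twice, as it occupies the index tape and a work tape of the same size.
  tspace : TConfig → ℕ
  tspace a = size (dual a) + (size (dual a) + (sizes (work₁ a) + sizes (work₂ a)))

  perform : Op Q S Γ₁ Γ₂ n₁ n₂ → TConfig → ChoiceTape → TConfig
  perform o a t = tconfig (next o) (act (false , S-blank) (dual o) (TConfig.dual a))
    (Vec.zipWith (act blank₁) (acts₁ o) (work₁ a)) (Vec.zipWith (act blank₂) (acts₂ o) (work₂ a)) t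

  module _ (x : Word) (k : ℕ) where

    open Semantics machine x k using (Config; config; instruction; advance; space)

    symbolAt : Tape Bool → Maybe InputSymbol
    symbolAt t = List.head (drop (address t) (encode x k))

    current-op : TConfig → Op Q S Γ₁ Γ₂ n₁ n₂
    current-op a = program (state a) (symbolAt (mapTape proj₁ (dual a))) (Tape.current (dual a))
      (scanned (choice a)) (Vec.map Tape.current (work₁ a)) (Vec.map Tape.current (work₂ a))

    tview : TConfig → View TConfig
    tview a = resolve (verdict (state a)) (mapView (perform (current-op a) a) (moved (move (current-op a)) (choice a)))

    tview-halt : ∀ a {b} → verdict (state a) ≡ just b → tview a ≡ halt b
    tview-halt a e rewrite e = refl

    ⌊_⌋ : TConfig → Config
    ⌊ a ⌋ = config (state a) (mapTape proj₁ (dual a))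
      (mapTape ι (dual a) ∷ (Vec.map (mapTape ι₁) (work₁ a) Vec.++ Vec.map (mapTape ι₂) (work₂ a)))
      (choice a)

    take-++ : ∀ {A : Set} {m n} (xs : Vec A m) (ys : Vec A n) → Vec.take m (xs Vec.++ ys) ≡ xs
    take-++ []       ys = refl
    take-++ (x ∷ xs) ys = cong (x ∷_) (take-++ xs ys)

    drop-++ : ∀ {A : Set} {m n} (xs : Vec A m) (ys : Vec A n) → Vec.drop m (xs Vec.++ ys) ≡ ys
    drop-++ []       ys = refl
    drop-++ (x ∷ xs) ys = drop-++ xs ys

    map-id : ∀ {A B : Set} (f : A → B) (g : B → A) → (∀ a → g (f a) ≡ a) →
      ∀ {n} (ts : Vec (Tape A) n) →
      Vec.map g (Vec.map Tape.current (Vec.map (mapTape f) ts)) ≡ Vec.map Tape.current ts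
    map-id f g inv []       = refl
    map-id f g inv (t ∷ ts) = cong₂ _∷_ (inv (Tape.current t)) (map-id f g inv ts)

    instruction-lower : ∀ a → instruction ⌊ a ⌋ ≡ lower (current-op a)
    instruction-lower a = cong₂ (λ γs₁ γs₂ → lower (program (state a)
          (symbolAt (mapTape proj₁ (dual a))) (Tape.current (dual a)) (scanned (choice a)) γs₁ γs₂))
      (trans (cong (Vec.map _ ∘ Vec.take n₁) currents)
        (trans (cong (Vec.map _) (take-++ (Vec.map Tape.current ts₁) (Vec.map Tape.current ts₂)))
          (map-id ι₁ _ (λ _ → refl) (work₁ a))))
      (trans (cong (Vec.map _ ∘ Vec.drop n₁) currents)
        (trans (cong (Vec.map _) (drop-++ (Vec.map Tape.current ts₁) (Vec.map Tape.current ts₂)))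
          (map-id ι₂ _ (λ _ → refl) (work₂ a))))
      where
      ts₁ = Vec.map (mapTape ι₁) (work₁ a)
      ts₂ = Vec.map (mapTape ι₂) (work₂ a)
      currents = Vec.map-++ Tape.current ts₁ ts₂

    advance-by : Instruction Q Γ (suc (n₁ + n₂)) → Config → ChoiceTape → Config
    advance-by i c t = config (Instruction.next i) (act false (Instruction.indexAction i) (Config.index c))
      (Vec.zipWith (act (Machine.blank machine)) (Instruction.workActions i) (Config.work c)) t

    advance-lower : ∀ a t → advance ⌊ a ⌋ t ≡ ⌊ perform (current-op a) a t ⌋
    advance-lower a t = trans (cong (λ i → advance-by i ⌊ a ⌋ t) (instruction-lower a))
      (cong₂ (λ i w → config (next o) i w t)
        (sym (map-act proj₁ _ _ _ (dual a)))
        (cong₂ _∷_ (sym (map-act ι _ _ _ (dual a)))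
          (trans (Vec.zipWith-++ _ (Vec.map (Product.map₁ ι₁) (acts₁ o)) _ (Vec.map (mapTape ι₁) (work₁ a)) _)
            (sym (cong₂ Vec._++_ (map-acts ι₁ _ (acts₁ o) (work₁ a)) (map-acts ι₂ _ (acts₂ o) (work₂ a)))))))
      where o = current-op a

    Lowers : Config → TConfig → Set
    Lowers c a = c ≡ ⌊ a ⌋

    lowers : ∀ {c a} → Lowers c a → ViewRel Lowers (view machine x k c) (tview a)
    lowers {a = a} refl = resolve-rel (verdict (state a))
      (subst (λ i → ViewRel Lowers (mapView (advance ⌊ a ⌋) (moved (Instruction.choiceMove i) (choice a)))
          (mapView (perform (current-op a) a) (moved (move (current-op a)) (choice a))))
        (sym (instruction-lower a)) (map-rel (advance-lower a) (moved (move (current-op a)) (choice a))))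

    lower-initial : ∀ u → Lowers (initialOn machine x k u) (tinitial u)
    lower-initial u = cong (λ w → config start (blankTape false) (blankTape (S-blank , blank₁ , blank₂) ∷ w) (choiceTape u [])) (replicate-split n₁ n₂)
      where
      replicate-split : ∀ m n → Vec.replicate (m + n) (blankTape (S-blank , blank₁ , blank₂)) ≡
        Vec.map (mapTape ι₁) (Vec.replicate m (blankTape blank₁)) Vec.++
        Vec.map (mapTape ι₂) (Vec.replicate n (blankTape blank₂))
      replicate-split zero    zero    = refl
      replicate-split zero    (suc n) = cong (_ ∷_) (replicate-split zero n)
      replicate-split (suc m) n       = cong (_ ∷_) (replicate-split m n)

    space-lower : ∀ a → space ⌊ a ⌋ ≡ tspace a
    space-lower a = cong₂ _+_ (size-map proj₁ (dual a)) (cong₂ _+_ (size-map ι (dual a))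
      (trans (sizes-++ (Vec.map (mapTape ι₁) (work₁ a)) _)
        (cong₂ _+_ (sizes-map ι₁ (work₁ a)) (sizes-map ι₂ (work₂ a)))))

    open Bisimulation {v = view machine x k} {w = tview} Lowers (λ c a → lowers {c} {a}) public

-- Tapes whose cells record whether they have been visited

bit# : Bool → ℕ
bit# false = 0
bit# true  = 1

unvisited# : Bool → ℕ
unvisited# v = bit# (not v)

marks : ∀ {A : Set} → List (A × Bool) → ℕ
marks []             = 0
marks ((_ , v) ∷ cs) = bit# v + marks cs

marks-++ : ∀ {A : Set} (cs ds : List (A × Bool)) → marks (cs ++ ds) ≡ marks cs + marks ds
marks-++ []             ds = refl
marks-++ ((_ , v) ∷ cs) ds = trans (cong (bit# v +_) (marks-++ cs ds)) (sym (+-assoc (bit# v) _ _))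

marks≤length : ∀ {A : Set} (cs : List (A × Bool)) → marks cs ≤ length cs
marks≤length []                 = z≤n
marks≤length ((_ , false) ∷ cs) = m≤n⇒m≤1+n (marks≤length cs)
marks≤length ((_ , true)  ∷ cs) = s≤s (marks≤length cs)

visited : ∀ {A : Set} → Tape (A × Bool) → Bool
visited t = proj₂ (Tape.current t)

module _ {A : Set} (b : A) where

  marks-act : ∀ a m (t : Tape (A × Bool)) →
    marks (cells (act (b , false) ((a , true) , m) t)) ≡ unvisited# (visited t) + marks (cells t)
  marks-act a m t@(tape ls (a′ , v) rs) = trans shifted (written v)
    where
    t′ = write (a , true) t
    shifted : marks (cells (shift (b , false) m t′)) ≡ marks (cells t′)
    shifted with cells-shift (b , false) m t′
    ... | inj₁ e       = cong marks e
    ... | inj₂ (e , _) = trans (cong marks e) (trans (marks-++ (cells t′) _) (+-identityʳ _))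
    written : ∀ v → marks (reverse ls ++ (a , true) ∷ rs) ≡ unvisited# v + marks (reverse ls ++ (a′ , v) ∷ rs)
    written false = trans (marks-++ (reverse ls) _)
      (trans (+-suc _ _) (cong suc (sym (marks-++ (reverse ls) _))))
    written true = trans (marks-++ (reverse ls) _) (sym (marks-++ (reverse ls) _))

  -- L counts the steps that started on an unvisited cell.
  Fits : ℕ → Tape (A × Bool) → Set
  Fits L t = (visited t ≡ true → size t ≤ L) × size t ≤ suc L

  fits-grow : ∀ {L} g t → unvisited# (visited t) ≤ g → Fits L t → size t ≤ g + L
  fits-grow {L} g t h (f , f′) with visited t
  ... | true  = ≤-trans (f refl) (m≤n+m L g)
  ... | false = ≤-trans f′ (+-monoˡ-≤ L h)

  -- A tape grows only when the head moves onto a new blank, and that cell is still unvisited when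
  -- the next step starts. So at any time at most one cell, the scanned one, has not been counted
  -- yet.
  fits-act : ∀ {L} g a m t → unvisited# (visited t) ≤ g → Fits L t →
    Fits (g + L) (act (b , false) ((a , true) , m) t)
  fits-act {L} g a m t h f with cells-shift (b , false) m (write (a , true) t)
  ... | inj₁ e = (λ _ → now) , m≤n⇒m≤1+n now
    where
    now = ≤-trans (≤-reflexive (trans (cong length e) (size-write (a , true) t))) (fits-grow g t h f)
  ... | inj₂ (e , c) = (λ q → contradiction (trans (sym (cong proj₂ c)) q) λ ()) ,
    (≤-trans (≤-reflexive (trans (cong length e) (trans (List.length-++ (cells (write (a , true) t)))
      (trans (+-comm _ 1) (cong suc (size-write (a , true) t))))))
      (s≤s (fits-grow g t h f)))

∨-left : ∀ v {w} → unvisited# v ≤ bit# (not v ∨ w)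
∨-left false = ≤-refl
∨-left true  = z≤n

∨-right : ∀ v {w} → bit# w ≤ bit# (not v ∨ w)
∨-right false {false} = z≤n
∨-right false {true}  = ≤-refl
∨-right true          = ≤-refl

∨-sum : ∀ v w → bit# (not v ∨ w) ≤ unvisited# v + bit# w
∨-sum false w = s≤s z≤n
∨-sum true  w = ≤-refl

module _ {A : Set} where

  anyUnvisited : ∀ {n} → Vec (A × Bool) n → Bool
  anyUnvisited []             = false
  anyUnvisited ((_ , v) ∷ as) = not v ∨ anyUnvisited as

  visit : (A × Move) → (A × Bool) × Move
  visit (a , m) = (a , true) , m

  unvisit : ∀ {n} (as : Vec (A × Move) n) → Vec.map (Product.map₁ proj₁) (Vec.map visit as) ≡ as
  unvisit as = trans (sym (Vec.map-∘ _ _ as)) (Vec.map-id as)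

  allMarks : ∀ {n} → Vec (Tape (A × Bool)) n → ℕ
  allMarks []       = 0
  allMarks (t ∷ ts) = marks (cells t) + allMarks ts

  allMarks≤sizes : ∀ {n} (ts : Vec (Tape (A × Bool)) n) → allMarks ts ≤ sizes ts
  allMarks≤sizes []       = z≤n
  allMarks≤sizes (t ∷ ts) = +-mono-≤ (marks≤length (cells t)) (allMarks≤sizes ts)

module _ {A : Set} (b : A) where

  data AllFit (L : ℕ) : ∀ {n} → Vec (Tape (A × Bool)) n → Set where
    []  : AllFit L []
    _∷_ : ∀ {n t} {ts : Vec _ n} → Fits b L t → AllFit L ts → AllFit L (t ∷ ts)

  fits-acts : ∀ {L n} g (as : Vec (A × Move) n) ts → bit# (anyUnvisited (Vec.map Tape.current ts)) ≤ g →
    AllFit L ts → AllFit (g + L) (Vec.zipWith (act (b , false)) (Vec.map visit as) ts)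
  fits-acts g []             []       h []       = []
  fits-acts g ((a , m) ∷ as) (t ∷ ts) h (f ∷ fs) =
    fits-act b g a m t (≤-trans (∨-left (visited t)) h) f ∷ fits-acts g as ts (≤-trans (∨-right (visited t)) h) fs

  -- Several heads may start on unvisited cells in the same step, which is counted once; hence only
  -- an inequality. Together with `fits-acts` it locates the number `L` of counted steps: each tape
  -- has at most `L + 1` cells, and `L` is at most the number of visited cells. A clock of `L`
  -- digits is thus long enough and still fits into the space.
  marks-acts : ∀ {n} (as : Vec (A × Move) n) ts →
    bit# (anyUnvisited (Vec.map Tape.current ts)) + allMarks ts ≤
    allMarks (Vec.zipWith (act (b , false)) (Vec.map visit as) ts)
  marks-acts []             []       = z≤n
  marks-acts ((a , m) ∷ as) (t ∷ ts) rewrite marks-act b a m t with visited t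
  ... | false = s≤s (+-monoʳ-≤ (marks (cells t)) (≤-trans (m≤n+m _ _) (marks-acts as ts)))
  ... | true  = ≤-trans (≤-reflexive (x+[y+z]≡y+[x+z] (bit# (anyUnvisited (Vec.map Tape.current ts))) (marks (cells t)) _))
    (+-monoʳ-≤ (marks (cells t)) (marks-acts as ts))
    where
    x+[y+z]≡y+[x+z] : ∀ x y z → x + (y + z) ≡ y + (x + z)
    x+[y+z]≡y+[x+z] x y z = trans (sym (+-assoc x y z)) (trans (cong (_+ z) (+-comm x y)) (+-assoc y x z))

-- Little-endian counters

module Counter (B : ℕ) where

  -- `unit` needs two digits even if `B` is small, and `L` digits must count at least up to `B ^ L`.
  base : ℕ
  base = 2 + B

  Digit : Set
  Digit = Fin base

  unit : Bool → Digit
  unit false = zero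
  unit true  = suc zero

  inc : Bool → Digit → Digit × Bool
  inc false d = d , false
  inc true  d with suc (toℕ d) <? base
  ... | yes p = Fin.fromℕ< p , false
  ... | no  _ = zero , true

  incs : Bool → List Digit → List Digit × Bool
  incs c []       = [] , c
  incs c (d ∷ ds) = proj₁ (inc c d) ∷ proj₁ (incs (proj₂ (inc c d)) ds) , proj₂ (incs (proj₂ (inc c d)) ds)

  value : List Digit → ℕ
  value []       = 0
  value (d ∷ ds) = toℕ d + base * value ds

  inc-value : ∀ c d → bit# c + toℕ d ≡ toℕ (proj₁ (inc c d)) + base * bit# (proj₂ (inc c d))
  inc-value false d = sym (trans (cong (toℕ d +_) (*-zeroʳ base)) (+-identityʳ _))
  inc-value true d with suc (toℕ d) <? base
  ... | yes p = sym (trans (cong₂ _+_ (Fin.toℕ-fromℕ< p) (*-zeroʳ base)) (+-identityʳ _))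
  ... | no ¬p = trans (≤-antisym (Fin.toℕ<n d) (≮⇒≥ ¬p)) (sym (*-identityʳ base))

  incs-value : ∀ c ds → bit# c + value ds ≡ value (proj₁ (incs c ds)) + base ^ length ds * bit# (proj₂ (incs c ds))
  incs-value c [] = trans (+-identityʳ _) (sym (+-identityʳ _))
  incs-value c (d ∷ ds) = begin
    bit# c + (toℕ d + base * value ds)           ≡⟨ +-assoc (bit# c) _ _ ⟨
    bit# c + toℕ d + base * value ds             ≡⟨ cong (_+ base * value ds) (inc-value c d) ⟩
    toℕ d′ + base * bit# c′ + base * value ds    ≡⟨ +-assoc (toℕ d′) _ _ ⟩
    toℕ d′ + (base * bit# c′ + base * value ds)  ≡⟨ cong (toℕ d′ +_) (*-distribˡ-+ base (bit# c′) _) ⟨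
    toℕ d′ + base * (bit# c′ + value ds)         ≡⟨ cong (λ n → toℕ d′ + base * n) (incs-value c′ ds) ⟩
    toℕ d′ + base * (value ds′ + base ^ length ds * bit# c″)
      ≡⟨ cong (toℕ d′ +_) (*-distribˡ-+ base (value ds′) _) ⟩
    toℕ d′ + (base * value ds′ + base * (base ^ length ds * bit# c″))
      ≡⟨ +-assoc (toℕ d′) _ _ ⟨
    toℕ d′ + base * value ds′ + base * (base ^ length ds * bit# c″)
      ≡⟨ cong (toℕ d′ + base * value ds′ +_) (*-assoc base (base ^ length ds) (bit# c″)) ⟨
    toℕ d′ + base * value ds′ + base * base ^ length ds * bit# c″ ∎
    where
    open ≡-Reasoning
    d′  = proj₁ (inc c d)
    c′  = proj₂ (inc c d)
    ds′ = proj₁ (incs c′ ds)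
    c″  = proj₂ (incs c′ ds)

  incs-length : ∀ c ds → length (proj₁ (incs c ds)) ≡ length ds
  incs-length c []       = refl
  incs-length c (d ∷ ds) = cong suc (incs-length _ ds)

  value-∷ʳ : ∀ ds d → value (ds ++ d ∷ []) ≡ value ds + base ^ length ds * toℕ d
  value-∷ʳ [] d = trans (cong (toℕ d +_) (*-zeroʳ base)) (trans (+-identityʳ _) (sym (+-identityʳ _)))
  value-∷ʳ (d′ ∷ ds) d = begin
    toℕ d′ + base * value (ds ++ d ∷ [])                     ≡⟨ cong (λ n → toℕ d′ + base * n) (value-∷ʳ ds d) ⟩
    toℕ d′ + base * (value ds + base ^ length ds * toℕ d)    ≡⟨ cong (toℕ d′ +_) (*-distribˡ-+ base (value ds) _) ⟩
    toℕ d′ + (base * value ds + base * (base ^ length ds * toℕ d)) ≡⟨ +-assoc (toℕ d′) _ _ ⟨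
    toℕ d′ + base * value ds + base * (base ^ length ds * toℕ d)
      ≡⟨ cong (toℕ d′ + base * value ds +_) (*-assoc base (base ^ length ds) (toℕ d)) ⟨
    toℕ d′ + base * value ds + base * base ^ length ds * toℕ d ∎
    where open ≡-Reasoning

  value-unit : ∀ ds c → value (ds ++ unit c ∷ []) ≡ value ds + base ^ length ds * bit# c
  value-unit ds false = value-∷ʳ ds zero
  value-unit ds true  = value-∷ʳ ds (suc zero)

  value< : ∀ ds → value ds < base ^ length ds
  value< []       = s≤s z≤n
  value< (d ∷ ds) = <-≤-trans (+-monoˡ-< (base * value ds) (Fin.toℕ<n d))
    (≤-trans (≤-reflexive (sym (*-suc base (value ds)))) (*-monoʳ-≤ base (value< ds)))

-- A deterministic computation that is long compared to its space is periodic.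

nth : ∀ {A : Set} → List A → ℕ → Maybe A
nth []       _       = nothing
nth (a ∷ as) zero    = just a
nth (a ∷ as) (suc i) = nth as i

nth-ext : ∀ {A : Set} {L} (as bs : List A) → length as ≤ L → length bs ≤ L →
  (∀ i → i < L → nth as i ≡ nth bs i) → as ≡ bs
nth-ext []       []       _       _       h = refl
nth-ext []       (b ∷ bs) _       (s≤s _) h with () ← h 0 (s≤s z≤n)
nth-ext (a ∷ as) []       (s≤s _) _       h with () ← h 0 (s≤s z≤n)
nth-ext (a ∷ as) (b ∷ bs) (s≤s p) (s≤s q) h with refl ← h 0 (s≤s z≤n) =
  cong (a ∷_) (nth-ext as bs p q λ i l → h (suc i) (s≤s l))

-- A tape is cut into columns counted from the head, so that the position of the head needs no code
-- of its own. Column `i` shows the cells at distance `i + 1` on both sides.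
tapeCode : ∀ {A : Set} → ℕ → Tape A → Maybe A × A × Maybe A
tapeCode i (tape ls a rs) = nth ls i , a , nth rs i

tapeCode-injective : ∀ {A : Set} {L} (s t : Tape A) → 1 ≤ L → size s ≤ suc L → size t ≤ suc L →
  (∀ i → i < L → tapeCode i s ≡ tapeCode i t) → s ≡ t
tapeCode-injective {L = L} s@(tape ls a rs) t@(tape ls′ a′ rs′) 1≤L p q h
  with refl ← cong (proj₁ ∘ proj₂) (h 0 1≤L) =
  cong₂ (λ ls rs → tape ls a rs)
    (nth-ext ls ls′ (≤-pred (left≤ s p)) (≤-pred (left≤ t q)) λ i l → cong proj₁ (h i l))
    (nth-ext rs rs′ (right≤ s p) (right≤ t q) λ i l → cong (proj₂ ∘ proj₂) (h i l))
  where
  left≤ : ∀ t → size t ≤ suc L → suc (length (Tape.before t)) ≤ suc L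
  left≤ t p = ≤-trans (≤-trans (s≤s (m≤m+n _ _)) (≤-reflexive (trans (sym (+-suc (length (Tape.before t)) (length (Tape.after t)))) (sym (size-length t))))) p
  right≤ : ∀ t → size t ≤ suc L → length (Tape.after t) ≤ L
  right≤ t p = ≤-pred (≤-trans (≤-trans (m≤n+m _ (length (Tape.before t))) (≤-reflexive (sym (size-length t)))) p)

module Periodicity (M : Machine) where

  open Machine M

  Cell : Set
  Cell = Q × (Maybe Bool × Bool × Maybe Bool) × Vec (Maybe Γ × Γ × Maybe Γ) tapes

  abstract
    finite-Cell : Finite Cell
    finite-Cell = finite-× Q-finite (finite-× (triple finite-Bool) (finite-Vec (triple Γ-finite) tapes))
      where
      triple : ∀ {A : Set} → Finite A → Finite (Maybe A × A × Maybe A)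
      triple fin = finite-× (finite-Maybe fin) (finite-× fin (finite-Maybe fin))

  ∣Cell∣ : ℕ
  ∣Cell∣ = proj₁ finite-Cell

  module _ (x : Word) (k : ℕ) where

    open Semantics M x k hiding (act)

    private
      v = view M x k

    code : Config → ℕ → Cell
    code c i = state c , tapeCode i (index c) , Vec.map (tapeCode i) (work c)

    Narrow : ℕ → Config → Set
    Narrow L c = size (index c) ≤ suc L × (∀ i → size (Vec.lookup (work c) i) ≤ suc L)

    narrow-back : ∀ {L c d} → v c ≡ det d → Narrow L d → Narrow L c
    narrow-back {c = c} e (p , q)
      with _ , _ , _ , refl ← resolve-det (verdict (state c)) (advance c) (moved (Instruction.choiceMove (instruction c)) (choice c)) e =
      ≤-trans (size-act false (Instruction.indexAction (instruction c)) (index c)) p ,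
      λ i → ≤-trans (≤-trans (size-act blank (Vec.lookup (Instruction.workActions (instruction c)) i) (Vec.lookup (work c) i))
        (≤-reflexive (cong size (sym (Vec.lookup-zipWith (act blank) i (Instruction.workActions (instruction c)) (work c)))))) (q i)

    det-unread : ∀ {c d} → v c ≡ det d → choice c ≡ unread → choice d ≡ unread
    det-unread {c} e h
      with _ , t , r , refl ← resolve-det (verdict (state c)) (advance c) (moved (Instruction.choiceMove (instruction c)) (choice c)) e
      = moved-unread (Instruction.choiceMove (instruction c)) (trans (cong (moved _) (sym h)) r)
      where
      moved-unread : ∀ m {t} → moved m unread ≡ det t → t ≡ unread
      moved-unread left refl = refl
      moved-unread stay refl = refl

    config-≡ : ∀ {q q′ i i′ w w′ t t′} → q ≡ q′ → i ≡ i′ → w ≡ w′ → t ≡ t′ → config q i w t ≡ config q′ i′ w′ t′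
    config-≡ refl refl refl refl = refl

    -- State and scanned symbols are repeated in every column, so one column must exist; `L` columns
    -- then exhaust tapes of `L + 1` cells. Configurations of this width with equal choice tapes are
    -- words of length `L` over `Cell`.
    code-injective : ∀ {L} c d → 1 ≤ L → Narrow L c → Narrow L d → choice c ≡ choice d →
      (∀ i → i < L → code c i ≡ code d i) → c ≡ d
    code-injective {L} c d 1≤L (p , p′) (q , q′) e h = config-≡ (cong proj₁ (h 0 1≤L))
      (tapeCode-injective (index c) (index d) 1≤L p q (λ i l → cong (proj₁ ∘ proj₂) (h i l)))
      (works (work c) (work d) p′ q′ (λ i l → cong (proj₂ ∘ proj₂) (h i l))) e
      where
      works : ∀ {n} (ss ts : Vec (Tape Γ) n) →
        (∀ i → size (Vec.lookup ss i) ≤ suc L) → (∀ i → size (Vec.lookup ts i) ≤ suc L) →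
        (∀ i → i < L → Vec.map (tapeCode i) ss ≡ Vec.map (tapeCode i) ts) → ss ≡ ts
      works []       []       _ _ _ = refl
      works (s ∷ ss) (t ∷ ts) p q h = cong₂ _∷_
        (tapeCode-injective s t 1≤L (p zero) (q zero) λ i l → cong Vec.head (h i l))
        (works ss ts (p ∘ suc) (q ∘ suc) λ i l → cong Vec.tail (h i l))

    -- Tapes never shrink, so the final width bounds the whole run, and the choice tape is unread
    -- throughout. Two of the `n + 1` configurations coincide, and a deterministic machine that
    -- repeats itself never leaves its prefix.
    periodic : ∀ {L n c ws} → Run v Any (initial) n c → Narrow L c → 1 ≤ L → ∣Cell∣ ^ L ≤ n → ¬ Acc v c ws
    periodic {L} {n} {c} r narrow 1≤L large a =
      go (acc-stuck a) (Fin.pigeonhole (s≤s large) (λ i → Fin.funToFin (number (at r i))))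
      where
      number : Config → Fin L → Fin ∣Cell∣
      number c = Inverse.to (proj₂ finite-Cell) ∘ code c ∘ toℕ
      narrow-at : ∀ i → Narrow L (at r i)
      narrow-at i = run-invariant′ narrow-back (from r i) narrow
      unread-at : ∀ i → choice (at r i) ≡ unread
      unread-at = run-invariant det-unread r refl
      same : ∀ c d → Fin.funToFin (number c) ≡ Fin.funToFin (number d) → ∀ i → i < L → code c i ≡ code d i
      same c d e i l = subst (λ i → code c i ≡ code d i) (Fin.toℕ-fromℕ< l)
        (Injection.injective (↔⇒↣ (proj₂ finite-Cell))
          (trans (sym (Fin.finToFun-funToFin (number c) i′))
            (trans (cong (λ z → Fin.finToFun z i′) e) (Fin.finToFun-funToFin (number d) i′))))
        where i′ = Fin.fromℕ< l
      go : (∃[ m ] ∃[ t ] Run v Any c m t × Stuck v t) →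
        (∃[ i ] ∃[ j ] i Fin.< j × Fin.funToFin (number (at r i)) ≡ Fin.funToFin (number (at r j))) → ⊥
      go (m , t , r′ , stuck) (i , j , i<j , e) =
        -- From the same configuration at positions i < j the stuck state would be reached after n -
        -- i + m and also after n - j + m steps.
        <⇒≢ (∸-monoʳ-< i<j (Fin.toℕ≤pred[n] j)) (sym (+-cancelʳ-≡ m _ _
          (stuck-unique (subst (λ s → Run v Any s _ _) same-config (from r i +++ r′)) (from r j +++ r′) stuck stuck)))
        where
        same-config = code-injective (at r i) (at r j) 1≤L (narrow-at i) (narrow-at j)
          (trans (unread-at i) (sym (unread-at j))) (same (at r i) (at r j) e)

-- The clocked machine

module Clocked (M : Machine) where

  open Machine M
  open Instruction
  open Periodicity M
  open Counter ∣Cell∣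

  -- `sim` simulates one step of the deterministic prefix, after which the clock is advanced by
  -- `goRight` and `goLeft`; `run` simulates everything from the first nondeterministic step on,
  -- without clock. `growth` remembers whether the simulated step started on an unvisited cell.
  data State : Set where
    sim run goLeft : Q → State
    goRight        : Q → (carry growth : Bool) → State
    fail           : State

  abstract
    finite-State : Finite State
    finite-State = finite-↔ (mk↔ₛ′
      (λ { (sim q) → inj₁ q ; (run q) → inj₂ (inj₁ q) ; (goLeft q) → inj₂ (inj₂ (inj₁ q))
         ; (goRight q c g) → inj₂ (inj₂ (inj₂ (inj₁ (q , c , g)))) ; fail → inj₂ (inj₂ (inj₂ (inj₂ tt))) })
      (λ { (inj₁ q) → sim q ; (inj₂ (inj₁ q)) → run q ; (inj₂ (inj₂ (inj₁ q))) → goLeft q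
         ; (inj₂ (inj₂ (inj₂ (inj₁ (q , c , g))))) → goRight q c g ; (inj₂ (inj₂ (inj₂ (inj₂ _)))) → fail })
      (λ { (inj₁ q) → refl ; (inj₂ (inj₁ q)) → refl ; (inj₂ (inj₂ (inj₁ q))) → refl
         ; (inj₂ (inj₂ (inj₂ (inj₁ (q , c , g))))) → refl ; (inj₂ (inj₂ (inj₂ (inj₂ _)))) → refl })
      (λ { (sim q) → refl ; (run q) → refl ; (goLeft q) → refl ; (goRight q c g) → refl ; fail → refl }))
      (finite-⊎ Q-finite (finite-⊎ Q-finite (finite-⊎ Q-finite
        (finite-⊎ (finite-× Q-finite (finite-× finite-Bool finite-Bool)) finite-⊤))))

  -- The cells of the clock tape: unvisited, the left end, or a digit.
  Clock : Set
  Clock = Maybe (Maybe Digit)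

  pattern end   = just nothing
  pattern dig d = just (just d)

  -- In the prefix the choice head is still on the endmarker, so moving right is the first
  -- nondeterministic step, whereas the other moves have no effect.
  after : Move → Q → Bool → State
  after right q g = run q
  after stay  q g = goRight q true g
  after left  q g = goRight q true g

  -- After a growth step the clock gets a new digit, which takes over the carry; so only a step
  -- without growth can overflow, and exactly then no tape has become wider than the clock allows.
  tick : Q → Bool → Bool → Clock → State × Clock × Move
  tick q c     g     (dig d) = goRight q (proj₂ (inc c d)) g , dig (proj₁ (inc c d)) , right
  tick q c     true  nothing = goLeft q , dig (unit c) , left
  tick q false false nothing = goLeft q , nothing , left
  tick q true  false nothing = fail , nothing , stay
  tick q c     g     end     = fail , end , stay

  rewind : Q → Clock → State × Clock × Move
  rewind q end     = sim q , end , stay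
  rewind q nothing = goLeft q , nothing , left
  rewind q (dig d) = goLeft q , dig d , left

  verdict′ : State → Maybe Bool
  verdict′ (sim q)         = verdict q
  verdict′ (run q)         = verdict q
  verdict′ (goLeft _)      = nothing
  verdict′ (goRight _ _ _) = nothing
  verdict′ fail            = just false

  private
    TOp = Op State Bool (Γ × Bool) Clock tapes 1

  imitate : State → Clock × Move → Instruction Q Γ tapes → TOp
  imitate s p i = op s (visit (indexAction i)) (Vec.map visit (workActions i)) (p ∷ []) (choiceMove i)

  pause : State × Clock × Move → Bool × Bool → Vec (Γ × Bool) tapes → TOp
  pause (s , p) d γs = op s (d , stay) (idle γs) (p ∷ []) stay

  program : State → Maybe InputSymbol → Bool × Bool → Maybe Bool → Vec (Γ × Bool) tapes → Vec Clock 1 → TOp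
  -- Between simulated steps the clock head waits at the left end. Writing `end` there each time
  -- also installs it in the very first step.
  program (sim q) x d c γs ks = imitate (after (choiceMove i) (next i) (not (proj₂ d) ∨ anyUnvisited γs)) (end , right) i
    where i = δ q x (proj₁ d) c (Vec.map proj₁ γs)
  program (run q) x d c γs ks = imitate (run (next i)) (Vec.head ks , stay) i
    where i = δ q x (proj₁ d) c (Vec.map proj₁ γs)
  program (goLeft q)      _ d _ γs ks = pause (rewind q (Vec.head ks)) d γs
  program (goRight q c g) _ d _ γs ks = pause (tick q c g (Vec.head ks)) d γs
  program fail            _ d _ γs ks = pause (fail , Vec.head ks , stay) d γs

  typed : Typed
  typed = record
    { Q = State ; Q-finite = finite-State ; S = Bool ; S-finite = finite-Bool ; S-blank = false
    ; Γ₁ = Γ × Bool ; Γ₁-finite = finite-× Γ-finite finite-Bool ; blank₁ = blank , false ; n₁ = tapes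
    ; Γ₂ = Clock ; Γ₂-finite = finite-Maybe (finite-Maybe (finite-Fin base)) ; blank₂ = nothing ; n₂ = 1
    ; start = sim start ; verdict = verdict′ ; program = program }

  open Compile typed hiding (state; choice; Γ)

  module _ (x : Word) (k : ℕ) where

    open Semantics M x k hiding (act)

    private
      v  = view M x k
      tv = tview x k

    at-state : State → Tape (Bool × Bool) → Vec (Tape (Γ × Bool)) tapes → Tape Clock → ChoiceTape → TConfig
    at-state s z w C t = tconfig s z w (C ∷ []) t

    erase : Q → Tape (Bool × Bool) → Vec (Tape (Γ × Bool)) tapes → ChoiceTape → Config
    erase q z w t = config q (mapTape proj₁ z) (Vec.map (mapTape proj₁) w) t

    instr : Q → Tape (Bool × Bool) → Vec (Tape (Γ × Bool)) tapes → ChoiceTape → Instruction Q Γ tapes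
    instr q z w t = δ q (symbolAt x k (mapTape proj₁ z)) (proj₁ (Tape.current z)) (scanned t)
      (Vec.map proj₁ (Vec.map Tape.current w))

    instruction-erase : ∀ q z w t → instruction (erase q z w t) ≡ instr q z w t
    instruction-erase q z w t =
      cong (δ q (symbolAt x k (mapTape proj₁ z)) (proj₁ (Tape.current z)) (scanned t)) (map-currents proj₁ w)

    dual′ : Instruction Q Γ tapes → Tape (Bool × Bool) → Tape (Bool × Bool)
    dual′ i = act (false , false) (visit (indexAction i))

    work′ : Instruction Q Γ tapes → Vec (Tape (Γ × Bool)) tapes → Vec (Tape (Γ × Bool)) tapes
    work′ i = Vec.zipWith (act (blank , false)) (Vec.map visit (workActions i))

    advance-erase : ∀ q z w t t′ → let i = instr q z w t in
      advance (erase q z w t) t′ ≡ erase (next i) (dual′ i z) (work′ i w) t′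
    advance-erase q z w t t′ = trans (cong by (instruction-erase q z w t))
      (config-≡ x k refl (sym (map-act proj₁ _ _ _ z))
        (sym (trans (map-acts proj₁ _ (Vec.map visit (workActions i)) w)
          (cong (λ as → Vec.zipWith (act blank) as _) (unvisit (workActions i))))) refl)
      where
      i = instr q z w t
      by : Instruction Q Γ tapes → Config
      by i = config (next i) (act false (indexAction i) (mapTape proj₁ z))
        (Vec.zipWith (act blank) (workActions i) (Vec.map (mapTape proj₁) w)) t′

    marked : Tape (Bool × Bool) → Vec (Tape (Γ × Bool)) tapes → ℕ
    marked z w = marks (cells z) + allMarks w

    grows : Tape (Bool × Bool) → Vec (Tape (Γ × Bool)) tapes → Bool
    grows z w = not (visited z) ∨ anyUnvisited (Vec.map Tape.current w)

    marked-grows : ∀ i z w → bit# (grows z w) + marked z w ≤ marked (dual′ i z) (work′ i w)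
    marked-grows i z w = begin
      bit# (grows z w) + (m + n)                      ≤⟨ +-monoˡ-≤ (m + n) (∨-sum (visited z) new) ⟩
      unvisited# (visited z) + bit# new + (m + n)     ≡⟨ interchange (unvisited# (visited z)) (bit# new) m n ⟩
      (unvisited# (visited z) + m) + (bit# new + n)   ≡⟨ cong (_+ (bit# new + n)) (marks-act false (proj₁ (indexAction i)) (proj₂ (indexAction i)) z) ⟨
      marks (cells (dual′ i z)) + (bit# new + n)      ≤⟨ +-monoʳ-≤ _ (marks-acts blank (workActions i) w) ⟩
      marked (dual′ i z) (work′ i w)                  ∎
      where
      open ≤-Reasoning
      m = marks (cells z)
      n = allMarks w
      new = anyUnvisited (Vec.map Tape.current w)
      interchange : ∀ a b c d → a + b + (c + d) ≡ (a + c) + (b + d)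
      interchange = solve-∀

    -- The clock is frozen and visited cells stay visited, so its bound persists. The constant 3
    -- covers the left end and a trailing blank, with one cell to spare.
    data Running : TConfig → Config → Set where
      running : ∀ {q z w C t} → size C ≤ 3 + marked z w →
        Running (at-state (run q) z w C t) (erase q z w t)

    running-rel : ∀ {a c} → Running a c → ViewRel Running (tv a) (v c)
    running-rel (running {q} {z} {w} {C} {t} h) = resolve-rel (verdict q)
      (subst (λ j → ViewRel Running
          (mapView (at-state (run (next i)) (dual′ i z) (work′ i w) C) (moved (choiceMove i) t))
          (mapView (advance (erase q z w t)) (moved (choiceMove j) t)))
        (sym (instruction-erase q z w t))
        (map-rel (λ t′ → subst (Running _) (sym (advance-erase q z w t t′))
            (running {z = dual′ i z} {w = work′ i w} {C = C}
              (≤-trans h (+-monoʳ-≤ 3 (≤-trans (m≤n+m _ (bit# (grows z w))) (marked-grows i z w))))))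
          (moved (choiceMove i) t)))
      where i = instr q z w t

    module Rerun = Bisimulation {v = tv} {w = v} Running (λ _ _ → running-rel)

    pause-view : ∀ s p {z w C t} → verdict′ s ≡ nothing →
      current-op x k (at-state s z w C t) ≡ pause p (Tape.current z) (Vec.map Tape.current w) →
      tv (at-state s z w C t) ≡ det (at-state (proj₁ p) z w (act nothing (proj₂ p) C) t)
    pause-view s p {z} {w} {C} {t} e e′ rewrite e | e′ =
      cong (λ w → det (at-state (proj₁ p) z w (act nothing (proj₂ p) C) t)) (idle-act (blank , false) w)

-- One tick of the clock: a sweep over its digits and back

module ClockSweep (M : Machine) (x : Word) (k : ℕ) where

  open Machine M
  open Periodicity M using (∣Cell∣)
  open Counter ∣Cell∣
  open Clocked M
  open Compile typed hiding (state; choice; Γ)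

  private
    tv = tview x k

  focus : List Clock → List Clock → Tape Clock
  focus ls []       = tape ls nothing []
  focus ls (a ∷ rs) = tape ls a rs

  focusˡ : List Clock → List Clock → Tape Clock
  focusˡ []       rs = tape [] end rs
  focusˡ (a ∷ ls) rs = tape ls a rs

  -- A sweep that does not extend the clock leaves one blank cell behind it.
  data Padding : List Clock → Set where
    none : Padding []
    one  : Padding (nothing ∷ [])

  data Control : State → Set where
    goRight : ∀ {q c g} → Control (goRight q c g)
    goLeft  : ∀ {q} → Control (goLeft q)
    fail    : Control fail

  shift-right : ∀ ls a rs → shift nothing right (tape ls a rs) ≡ focus (a ∷ ls) rs
  shift-right ls a []      = refl
  shift-right ls a (_ ∷ _) = refl

  shift-left : ∀ es a rs → shift nothing left (tape (List.map dig es ++ end ∷ []) a rs) ≡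
    focusˡ (List.map dig es ++ end ∷ []) (a ∷ rs)
  shift-left []      a rs = refl
  shift-left (_ ∷ _) a rs = refl

  reverse-digits : ∀ (ds : List Digit) (as : List Clock) → List.map dig ds List.ʳ++ as ≡ List.map dig (reverse ds) ++ as
  reverse-digits ds as = trans (List.ʳ++-defn (List.map dig ds)) (cong (_++ as) (sym (List.reverse-map dig ds)))

  module _ (z : Tape (Bool × Bool)) (w : Vec (Tape (Γ × Bool)) tapes) {P : TConfig → Set} (K : ℕ)
           (ok : ∀ {s C} → Control s → size C ≤ K → P (at-state x k s z w C unread)) where

    private
      here-at : State → Tape Clock → TConfig
      here-at s C = at-state x k s z w C unread

      pause′ : ∀ s p C → verdict′ s ≡ nothing →
        current-op x k (here-at s C) ≡ pause p (Tape.current z) (Vec.map Tape.current w) →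
        tv (here-at s C) ≡ det (here-at (proj₁ p) (act nothing (proj₂ p) C))
      pause′ s p C = pause-view x k s p

    sweep-right : ∀ q g c ds {ps} ls → Padding ps → length ls + suc (length ds + length ps) ≤ K →
      Run tv P (here-at (goRight q c g) (focus ls (List.map dig ds ++ ps))) (length ds)
        (here-at (goRight q (proj₂ (incs c ds)) g) (tape (List.map dig (proj₁ (incs c ds)) List.ʳ++ ls) nothing []))
    sweep-right q g c []       ls none _ = []
    sweep-right q g c []       ls one  _ = []
    sweep-right q g c (d ∷ ds) {ps} ls pad h = step
      (ok goRight (≤-trans (≤-reflexive (trans (size-length (tape ls (dig d) (List.map dig ds ++ ps)))
        (cong (λ n → length ls + suc n) (trans (List.length-++ (List.map dig ds)) (cong (_+ _) (List.length-map dig ds))))))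
        (≤-trans (+-monoʳ-≤ (length ls) (s≤s (n≤1+n _))) h)))
      (trans (pause′ (goRight q c g) (tick q c g (dig d)) (tape ls (dig d) (List.map dig ds ++ ps)) refl refl)
        (cong (λ C → det (here-at (goRight q (proj₂ (inc c d)) g) C)) (shift-right ls _ (List.map dig ds ++ ps))))
      (sweep-right q g (proj₂ (inc c d)) ds _ pad (≤-trans (≤-reflexive (sym (+-suc (length ls) _))) h))

    sweep-left : ∀ q es rs → length es + suc (length rs) ≤ K →
      Run tv P (here-at (goLeft q) (focusˡ (List.map dig es ++ end ∷ []) rs)) (suc (length es))
        (here-at (sim q) (tape [] end (List.map dig es List.ʳ++ rs)))
    sweep-left q []       rs h = step (ok goLeft h) (pause′ (goLeft q) (rewind q end) (tape [] end rs) refl refl) []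
    sweep-left q (e ∷ es) rs h = step
      (ok goLeft (≤-trans (≤-reflexive (trans (size-length (tape (List.map dig es ++ end ∷ []) (dig e) rs))
        (cong (_+ suc (length rs)) (trans (List.length-++ (List.map dig es)) (trans (+-comm _ 1) (cong suc (List.length-map dig es))))))) h))
      (trans (pause′ (goLeft q) (rewind q (dig e)) (tape (List.map dig es ++ end ∷ []) (dig e) rs) refl refl)
        (cong (λ C → det (here-at (goLeft q) C)) (shift-left es (dig e) rs)))
      (sweep-left q es (dig e ∷ rs) (≤-trans (≤-reflexive (+-suc (length es) _)) h))

    module _ (q : Q) (ds : List Digit) {ps : List Clock} (pad : Padding ps) (h : 3 + length ds ≤ K) where

      private
        ds′ = proj₁ (incs true ds)
        c′  = proj₂ (incs true ds)
        es  = reverse ds′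

        stopped = tape (List.map dig es ++ end ∷ []) nothing []

        Sweep : Bool → TConfig → Set
        Sweep g a = ∃[ n ] Run tv P (here-at (goRight q true g) (focus (end ∷ []) (List.map dig ds ++ ps))) n a

        pad≤1 : ∀ {ps} → Padding ps → length ps ≤ 1
        pad≤1 none = z≤n
        pad≤1 one  = ≤-refl

        right-half : ∀ g → Run tv P (here-at (goRight q true g) (focus (end ∷ []) (List.map dig ds ++ ps))) (length ds)
          (here-at (goRight q c′ g) stopped)
        right-half g = subst (λ ls → Run tv P (here-at (goRight q true g) (focus (end ∷ []) (List.map dig ds ++ ps))) (length ds) (here-at (goRight q c′ g) (tape ls nothing [])))
          (reverse-digits ds′ (end ∷ []))
          (sweep-right q g true ds (end ∷ []) pad
            (≤-trans (s≤s (s≤s (≤-trans (+-monoʳ-≤ (length ds) (pad≤1 pad)) (≤-reflexive (+-comm (length ds) 1))))) h))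

        length-es : length es ≡ length ds
        length-es = trans (List.length-reverse ds′) (incs-length true ds)

        end-size : size stopped ≤ K
        end-size = ≤-trans (≤-reflexive (trans (size-length stopped)
          (trans (cong (_+ 1) (trans (List.length-++ (List.map dig es))
            (cong (_+ 1) (trans (List.length-map dig es) length-es))))
            (trans (+-assoc (length ds) 1 1) (+-comm (length ds) 2)))))
          (≤-trans (n≤1+n _) h)

        at-end : ∀ {g} → P (here-at (goRight q c′ g) stopped)
        at-end = ok goRight end-size

        left-half : ∀ a → Run tv P (here-at (goLeft q) (act nothing (a , left) stopped))
          (suc (length es)) (here-at (sim q) (tape [] end (List.map dig ds′ ++ a ∷ [])))
        left-half a = subst₂ (λ C as → Run tv P (here-at (goLeft q) C) (suc (length es)) (here-at (sim q) (tape [] end as)))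
          (sym (shift-left es a []))
          (trans (reverse-digits es (a ∷ [])) (cong (λ ds → List.map dig ds ++ a ∷ []) (List.reverse-involutive ds′)))
          (sweep-left q es (a ∷ []) (≤-trans (≤-reflexive (trans (cong (_+ 2) length-es) (+-comm (length ds) 2)))
            (≤-trans (n≤1+n _) h)))

      sweep-extend : ∃[ n ] Run tv P (here-at (goRight q true true) (focus (end ∷ []) (List.map dig ds ++ ps))) n
        (here-at (sim q) (tape [] end (List.map dig (ds′ ++ unit c′ ∷ []) ++ [])))
      sweep-extend = subst (λ as → Sweep true (here-at (sim q) (tape [] end as)))
        (sym (trans (List.++-identityʳ _) (List.map-++ dig ds′ (unit c′ ∷ []))))
        (_ , (right-half true +++ step at-end (pause′ (goRight q c′ true) (tick q c′ true nothing) stopped refl refl)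
          (left-half (dig (unit c′)))))

      private
        turned : ∀ {c} → c′ ≡ c → let p = tick q c false nothing in
          tv (here-at (goRight q c′ false) stopped) ≡ det (here-at (proj₁ p) (act nothing (proj₂ p) stopped))
        turned refl = pause′ (goRight q c′ false) (tick q c′ false nothing) stopped refl refl

      sweep-keep : c′ ≡ false → ∃[ n ] Run tv P (here-at (goRight q true false) (focus (end ∷ []) (List.map dig ds ++ ps))) n
        (here-at (sim q) (tape [] end (List.map dig ds′ ++ nothing ∷ [])))
      sweep-keep e = _ , (right-half false +++ step at-end (turned e) (left-half nothing))

      sweep-overflow : c′ ≡ true → ∃[ n ] ∃[ C ] size C ≤ K ×
        Run tv P (here-at (goRight q true false) (focus (end ∷ []) (List.map dig ds ++ ps))) n (here-at fail C)
      sweep-overflow e = _ , _ , end-size , (right-half false +++ step at-end (turned e) [])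

-- The clocked machine along the deterministic prefix

module ClockedRuns (M : Machine) (x : Word) (k : ℕ) where

  open Machine M
  open Instruction
  open Periodicity M using (∣Cell∣; Narrow; periodic; config-≡)
  open Counter ∣Cell∣
  open Clocked M
  open ClockSweep M x k
  open Compile typed hiding (state; choice; Γ)
  open Semantics M x k hiding (act)
  open Paths M x k using (view-halt; halt-view; view-step)

  private
    v  = view M x k
    tv = tview x k

  -- The link to a reachable configuration of `M` through which all resource bounds are inherited.
  -- The factor 3 arises since the dual tape counts twice and the clock is about as long as all
  -- simulated tapes together.
  record Safe (a : TConfig) : Set where
    field
      {witness} : Config
      reached   : Reach v initial witness
      index-≡   : size (dual a) ≡ size (index witness)
      space-≤   : tspace a ≤ 3 * space witness + 3
      choice-≡  : TConfig.choice a ≡ choice witness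
      left-only : verdict′ (TConfig.state a) ≡ nothing → Op.move (current-op x k a) ≡ left →
                  verdict (state witness) ≡ nothing × choiceMove (instruction witness) ≡ left

  space-erase : ∀ q z w t → space (erase x k q z w t) ≡ size z + sizes w
  space-erase q z w t = cong₂ _+_ (size-map proj₁ z) (sizes-map proj₁ w)

  make-safe : ∀ {s q z w C t} → size C ≤ 3 + marked x k z w → Reach v initial (erase x k q z w t) →
    (verdict′ s ≡ nothing → Op.move (current-op x k (at-state x k s z w C t)) ≡ left →
      verdict q ≡ nothing × choiceMove (instruction (erase x k q z w t)) ≡ left) →
    Safe (at-state x k s z w C t)
  make-safe {s} {q} {z} {w} {C} {t} h r l = record
    { reached = r ; index-≡ = sym (size-map proj₁ z) ; choice-≡ = refl ; left-only = l ; space-≤ = begin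
        size z + (size z + (sizes w + (size C + 0)))
          ≤⟨ +-monoʳ-≤ (size z) (+-monoʳ-≤ (size z) (+-monoʳ-≤ (sizes w) (+-monoˡ-≤ 0 (≤-trans h
               (+-monoʳ-≤ 3 (+-mono-≤ (marks≤length (cells z)) (allMarks≤sizes w))))))) ⟩
        size z + (size z + (sizes w + (3 + (size z + sizes w) + 0)))
          ≤⟨ m≤m+n _ (sizes w) ⟩
        size z + (size z + (sizes w + (3 + (size z + sizes w) + 0))) + sizes w
          ≡⟨ collect (size z) (sizes w) ⟩
        3 * (size z + sizes w) + 3
          ≡⟨ cong (λ n → 3 * n + 3) (space-erase q z w t) ⟨
        3 * space (erase x k q z w t) + 3 ∎ }
    where
    open ≤-Reasoning
    collect : ∀ d w → d + (d + (w + (3 + (d + w) + 0))) + w ≡ 3 * (d + w) + 3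
    collect = solve-∀

  control-safe : ∀ {s q z w t} → Control s → ∀ {C} → size C ≤ 3 + marked x k z w →
    Reach v initial (erase x k q z w t) → Safe (at-state x k s z w C t)
  control-safe goRight h r = make-safe h r λ _ ()
  control-safe goLeft  h r = make-safe h r λ _ ()
  control-safe fail    h r = make-safe h r λ ()

  imitate-safe : ∀ {s q z w C t} → Op.move (current-op x k (at-state x k s z w C t)) ≡ choiceMove (instr x k q z w t) →
    verdict′ s ≡ verdict q →
    size C ≤ 3 + marked x k z w → Reach v initial (erase x k q z w t) → Safe (at-state x k s z w C t)
  imitate-safe {s} {q} {z} {w} {C} {t} e e′ h r = make-safe h r λ p l →
    trans (sym e′) p , trans (cong choiceMove (instruction-erase x k q z w t)) (trans (sym e) l)

  -- Between two simulated steps of the deterministic prefix the clock shows the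
  -- number n of steps simulated so far; it has one digit for each step that
  -- started with some head on an unvisited cell.
  data Parked (n : ℕ) : TConfig → Config → Set where
    parked : ∀ {L q z w a ds ps} → Padding ps → value ds ≡ n → length ds ≡ L →
      Fits false L z → AllFit blank L w → L ≤ marked x k z w →
      Run v Any initial n (erase x k q z w unread) →
      Parked n (at-state x k (sim q) z w (tape [] a (List.map dig ds ++ ps)) unread) (erase x k q z w unread)

  run→reach : ∀ {c d n} → Run v Any c n d → Reach v c d
  run→reach r = run-reach r here

  parked-safe : ∀ {n a c} → Parked n a c → Safe a
  parked-safe (parked {L} {q} {z} {w} {a} {ds} {ps} pad _ len _ _ L≤ r) = imitate-safe refl refl
    (≤-trans (s≤s (≤-trans (≤-reflexive (trans (List.length-++ (List.map dig ds)) (cong (_+ length ps) (trans (List.length-map dig ds) len))))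
      (≤-trans (+-monoʳ-≤ L (pad≤2 pad)) (≤-reflexive (+-comm L 2))))) (+-monoʳ-≤ 3 L≤)) (run→reach r)
    where
    pad≤2 : ∀ {ps} → Padding ps → length ps ≤ 2
    pad≤2 none = z≤n
    pad≤2 one  = s≤s z≤n

  -- Rejecting on overflow loses no accepting path, because `overflowed` comes with a proof that `M`
  -- accepts nothing from there.
  data Outcome (n : ℕ) (a : TConfig) (c : Config) : Set where
    advanced   : ∀ {m a′} → Run tv Safe a (suc m) a′ → Parked (suc n) a′ c → Outcome n a c
    overflowed : ∀ {m a′} → Run tv Safe a (suc m) a′ → tv a′ ≡ halt false → Safe a′ →
                 (∀ {ws} → ¬ Acc v c ws) → Outcome n a c

  moved-unread : ∀ m {t} (q : Q) (g : Bool) → moved m unread ≡ det t → t ≡ unread × after m q g ≡ goRight q true g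
  moved-unread left q g refl = refl , refl
  moved-unread stay q g refl = refl , refl

  size-positive : ∀ {A : Set} (t : Tape A) → 1 ≤ size t
  size-positive t = ≤-trans (m≤n+m 1 (length (Tape.before t) + length (Tape.after t)))
    (≤-reflexive (trans (+-comm _ 1) (trans (sym (+-suc (length (Tape.before t)) _)) (sym (size-length t)))))

  allFit-lookup : ∀ {L n} {ts : Vec (Tape (Γ × Bool)) n} → AllFit blank L ts → ∀ i → size (Vec.lookup ts i) ≤ suc L
  allFit-lookup ((_ , p) ∷ _) zero    = p
  allFit-lookup (_ ∷ ps)      (suc i) = allFit-lookup ps i

  module _ {n : ℕ} {q : Q} {z : Tape (Bool × Bool)} {w : Vec (Tape (Γ × Bool)) tapes}
           {ds : List Digit} {ps : List Clock} (pad : Padding ps) (val : value ds ≡ n)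
           (fit : Fits false (length ds) z) (fits : AllFit blank (length ds) w)
           (L≤ : length ds ≤ marked x k z w) where

    private
      L  = length ds
      i  = instr x k q z w unread
      q′ = next i
      z′ = dual′ x k i z
      w′ = work′ x k i w
      c′ = erase x k q′ z′ w′ unread
      ds′ = proj₁ (incs true ds)

    Swept : Bool → Set
    Swept g = ∃[ m ] ∃[ a′ ] Run tv Safe (at-state x k (goRight q′ true g) z′ w′ (focus (end ∷ []) (List.map dig ds ++ ps)) unread) m a′ ×
      (Parked (suc n) a′ c′ ⊎ (tv a′ ≡ halt false × Safe a′ × (∀ {ws} → ¬ Acc v c′ ws)))

    sweep : Run v Any initial (suc n) c′ → ∀ g → g ≡ grows x k z w → Swept g
    sweep r g e = by-cases g e (proj₂ (incs true ds)) refl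
      where
      marked≤ : bit# g + L ≤ marked x k z′ w′
      marked≤ = ≤-trans (+-monoʳ-≤ (bit# g) L≤) (≤-trans (≤-reflexive (cong (λ g → bit# g + marked x k z w) e)) (marked-grows x k i z w))

      ok : ∀ {s C} → Control s → size C ≤ 3 + L → Safe (at-state x k s z′ w′ C unread)
      ok s h = control-safe s (≤-trans h (+-monoʳ-≤ 3 (≤-trans (m≤n+m L (bit# g)) marked≤))) (run→reach r)

      fit′ : Fits false (bit# g + L) z′
      fit′ = fits-act false (bit# g) (proj₁ (indexAction i)) (proj₂ (indexAction i)) z (≤-trans (∨-left (visited z)) (≤-reflexive (cong bit# (sym e)))) fit

      fits′ : AllFit blank (bit# g + L) w′
      fits′ = fits-acts blank (bit# g) (workActions i) w (≤-trans (∨-right (visited z)) (≤-reflexive (cong bit# (sym e)))) fits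

      counted : ∀ c → proj₂ (incs true ds) ≡ c → value ds′ + base ^ L * bit# c ≡ suc n
      counted c refl = trans (sym (incs-value true ds)) (cong suc val)

      narrow : g ≡ false → Narrow x k L c′
      narrow refl = ≤-trans (≤-reflexive (size-map proj₁ z′)) (proj₂ fit′) , λ j →
        ≤-trans (≤-reflexive (trans (cong size (Vec.lookup-map j (mapTape proj₁) w′)) (size-map proj₁ (Vec.lookup w′ j))))
          (allFit-lookup fits′ j)

      -- Without growth the index head is on a visited cell, so by `Fits` its tape has at most `L`
      -- cells; and it has at least one.
      1≤L : g ≡ false → 1 ≤ L
      1≤L p = ≤-trans (size-positive z) (proj₁ fit (seen (visited z) (trans (sym e) p)))
        where
        seen : ∀ v {w} → not v ∨ w ≡ false → v ≡ true
        seen true _ = refl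

      by-cases : ∀ g′ → g′ ≡ grows x k z w → ∀ c → proj₂ (incs true ds) ≡ c → Swept g′
      by-cases true h c o = _ , _ , proj₂ (sweep-extend z′ w′ (3 + L) ok q′ ds pad ≤-refl) ,
        inj₁ (parked none
          (trans (value-unit ds′ (proj₂ (incs true ds))) (trans (cong (λ l → value ds′ + base ^ l * bit# (proj₂ (incs true ds))) (incs-length true ds)) (counted _ refl)))
          (trans (List.length-++ ds′) (trans (+-comm _ 1) (cong₂ _+_ (sym g#) (incs-length true ds))))
          fit′ fits′ marked≤ r)
        where
        g# : bit# g ≡ 1
        g# = cong bit# (trans e (sym h))
      by-cases false h false o = _ , _ , proj₂ (sweep-keep z′ w′ (3 + L) ok q′ ds pad ≤-refl o) ,
        inj₁ (parked one
          (trans (sym (trans (cong (value ds′ +_) (*-zeroʳ (base ^ L))) (+-identityʳ _))) (counted _ o))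
          (trans (incs-length true ds) (sym (cong (_+ L) g#)))
          fit′ fits′ marked≤ r)
        where
        g# : bit# g ≡ 0
        g# = cong bit# (trans e (sym h))
      -- The lost carry is worth `base ^ L`, so at least that many steps have been simulated. As no
      -- scanned cell was new, all tapes still have at most `L + 1` cells, and `periodic` applies.
      by-cases false h true o with m , C , s , ρ ← sweep-overflow z′ w′ (3 + L) ok q′ ds pad ≤-refl o =
        m , _ , ρ , inj₂ (refl , ok fail s , periodic x k r (narrow g≡) (1≤L g≡)
          (≤-trans (^-monoˡ-≤ L (m≤n+m ∣Cell∣ 2)) (≤-trans (≤-reflexive (sym (*-identityʳ (base ^ L))))
            (≤-trans (m≤n+m _ (value ds′)) (≤-reflexive (counted true o))))))
        where
        g≡ = trans e (sym h)

  outcome : ∀ {n a c d} → Parked n a c → v c ≡ det d → Outcome n a d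
  outcome {n} {d = d} P@(parked {q = q} {z} {w} {a} {ds} {ps} pad val refl fit fits L≤ r) e =
    build (resolve-det (verdict q) (advance c) (moved (choiceMove (instruction c)) unread) e)
    where
    c = erase x k q z w unread
    i = instr x k q z w unread
    g = grows x k z w
    parked-config = at-state x k (sim q) z w (tape [] a (List.map dig ds ++ ps)) unread

    build′ : ∀ {t} → verdict q ≡ nothing → moved (choiceMove i) unread ≡ det t →
      t ≡ unread × after (choiceMove i) (next i) g ≡ goRight (next i) true g → d ≡ advance c t →
      Outcome n parked-config d
    build′ h m (refl , after≡) p = finish (sweep pad val fit fits L≤
      (subst (Run v Any initial (suc n)) d≡ (subst (λ n → Run v Any initial n d) (+-comm n 1) (r +++ step tt e []))) g refl)
      where
      d≡ = trans p (advance-erase x k q z w unread unread)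
      first : tv parked-config ≡ det (at-state x k (goRight (next i) true g) (dual′ x k i z) (work′ x k i w)
        (focus (end ∷ []) (List.map dig ds ++ ps)) unread)
      first = trans (cong₂ (λ h u → resolve h (mapView
          (at-state x k (after (choiceMove i) (next i) g) (dual′ x k i z) (work′ x k i w)
            (shift nothing right (tape [] end (List.map dig ds ++ ps)))) u)) h m)
        (cong₂ (λ s C → det (at-state x k s (dual′ x k i z) (work′ x k i w) C unread)) after≡
          (shift-right [] end (List.map dig ds ++ ps)))
      finish : Swept pad val fit fits L≤ g → Outcome n parked-config d
      finish (_ , a′ , ρ , inj₁ P′) = advanced (step (parked-safe P) first ρ) (subst (Parked (suc n) a′) (sym d≡) P′)
      finish (_ , a′ , ρ , inj₂ (f , s , ¬acc)) = overflowed (step (parked-safe P) first ρ) f s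
        λ {ws} acc → ¬acc (subst (λ d → Acc v d ws) d≡ acc)

    build : (verdict q ≡ nothing × ∃[ t ] moved (choiceMove (instruction c)) unread ≡ det t × d ≡ advance c t) →
      Outcome n parked-config d
    build (h , t , m , p) = build′ h m′ (moved-unread (choiceMove i) (next i) g m′) p
      where m′ = trans (cong (λ i → moved (choiceMove i) unread) (sym (instruction-erase x k q z w unread))) m

-- The clocked machine accepts the same words, and its prefix ends

module ClockedCorrect (M : Machine) (x : Word) (k : ℕ) where

  open Machine M
  open Instruction
  open Periodicity M using (∣Cell∣; config-≡)
  open Counter ∣Cell∣
  open Clocked M
  open ClockSweep M x k
  open ClockedRuns M x k
  open Compile typed hiding (state; choice; Γ)
  open Semantics M x k hiding (act)
  open Paths M x k using (view-halt; halt-view; view-step)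

  private
    v  = view M x k
    tv = tview x k

  parked-halt : ∀ {n a c b} → Parked n a c → v c ≡ halt b → tv a ≡ halt b
  parked-halt {a = a} (parked _ _ _ _ _ _ _) e = tview-halt x k a (halt-view e)

  moved-branch-unread : ∀ m {g} → moved m unread ≡ branch g → m ≡ right × g ≡ (λ b → choiceTape (b ∷ []) [])
  moved-branch-unread right refl = refl , refl

  size-focus : ∀ ls rs → size (focus ls rs) ≤ length ls + suc (length rs)
  size-focus ls []       = ≤-reflexive (size-length (tape ls nothing []))
  size-focus ls (a ∷ rs) = ≤-trans (≤-reflexive (size-length (tape ls a rs))) (+-monoʳ-≤ (length ls) (n≤1+n _))

  parked-branch : ∀ {n a c f} → Parked n a c → v c ≡ branch f →
    ∃[ f′ ] tv a ≡ branch f′ × (∀ b → Running x k (f′ b) (f b))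
  parked-branch {f = f} (parked {L} {q} {z} {w} {a} {ds} {ps} pad _ len _ _ L≤ _) e =
    build (resolve-branch (verdict q) (advance c) (moved (choiceMove (instruction c)) unread) e)
    where
    c = erase x k q z w unread
    i = instr x k q z w unread
    C = shift nothing right (tape [] end (List.map dig ds ++ ps))
    at-move : Move → ChoiceTape → TConfig
    at-move m = at-state x k (after m (next i) (grows x k z w)) (dual′ x k i z) (work′ x k i w) C
    pad≤1 : ∀ {ps} → Padding ps → length ps ≤ 1
    pad≤1 none = z≤n
    pad≤1 one  = ≤-refl
    C≤ : size C ≤ 3 + marked x k (dual′ x k i z) (work′ x k i w)
    C≤ = begin
      size C                                          ≡⟨ cong size (shift-right [] end (List.map dig ds ++ ps)) ⟩
      size (focus (end ∷ []) (List.map dig ds ++ ps)) ≤⟨ size-focus (end ∷ []) (List.map dig ds ++ ps) ⟩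
      2 + length (List.map dig ds ++ ps)              ≡⟨ cong (2 +_) (List.length-++ (List.map dig ds)) ⟩
      2 + (length (List.map dig ds) + length ps)      ≤⟨ +-monoʳ-≤ 2 (+-monoʳ-≤ (length (List.map dig ds)) (pad≤1 pad)) ⟩
      2 + (length (List.map dig ds) + 1)              ≡⟨ cong (2 +_) (+-comm _ 1) ⟩
      3 + length (List.map dig ds)                    ≡⟨ cong (3 +_) (trans (List.length-map dig ds) len) ⟩
      3 + L                                           ≤⟨ +-monoʳ-≤ 3 (≤-trans L≤ (≤-trans (m≤n+m _ (bit# (grows x k z w))) (marked-grows x k i z w))) ⟩
      3 + marked x k (dual′ x k i z) (work′ x k i w)  ∎
      where open ≤-Reasoning
    build : (verdict q ≡ nothing × ∃[ g ] moved (choiceMove (instruction c)) unread ≡ branch g × f ≡ advance c ∘ g) →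
      ∃[ f′ ] tv (at-state x k (sim q) z w (tape [] a (List.map dig ds ++ ps)) unread) ≡ branch f′ ×
        (∀ b → Running x k (f′ b) (f b))
    build (h , g , m , refl)
      with e′ , refl ← moved-branch-unread (choiceMove i)
             (trans (cong (λ i → moved (choiceMove i) unread) (sym (instruction-erase x k q z w unread))) m) =
      (λ b → at-move right (choiceTape (b ∷ []) [])) ,
      cong₂ (λ h m → resolve h (mapView (at-move m) (moved m unread))) h e′ ,
      λ b → subst (Running x k _) (sym (advance-erase x k q z w unread (choiceTape (b ∷ []) [])))
        (running {z = dual′ x k i z} {w = work′ x k i w} {C = C} C≤)

  initial-≡ : erase x k start (blankTape (false , false)) (Vec.replicate tapes (blankTape (blank , false))) unread ≡ initial
  initial-≡ = config-≡ x k refl refl (Vec.map-replicate (mapTape proj₁) _ tapes) refl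

  parked-initial : Parked 0 (tinitial []) (erase x k start (blankTape (false , false)) (Vec.replicate tapes (blankTape (blank , false))) unread)
  parked-initial = parked {ds = []} none refl refl ((λ ()) , s≤s z≤n) (fits tapes) z≤n
    (subst (λ c → Run v Any c 0 erased) initial-≡ [])
    where
    erased = erase x k start (blankTape (false , false)) (Vec.replicate tapes (blankTape (blank , false))) unread
    fits : ∀ n → AllFit blank 0 (Vec.replicate n (blankTape (blank , false)))
    fits zero    = []
    fits (suc n) = ((λ ()) , s≤s z≤n) ∷ fits n

  acc→parked : ∀ {n a c ws} → Parked n a c → Acc v c ws → Acc tv a ws
  acc→parked P (done e) = done (parked-halt P e)
  acc→parked P (det e acc) with outcome P e
  ... | advanced r P′         = run-acc r (acc→parked P′ acc)
  ... | overflowed _ _ _ ¬acc = contradiction acc ¬acc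
  acc→parked P (branch e b acc) with f′ , e′ , r ← parked-branch P e =
    branch e′ b (Rerun.acc← x k (r b) acc)

  -- One simulated step is a whole run here, so the remaining computation is not a subterm; `N`
  -- bounds its length.
  acc←parked : ∀ N {n a c ws} → Parked n a c → (acc : Acc tv a ws) → len acc ≤ N → Acc v c ws
  acc←parked N {c = c} P acc l with v c in e
  acc←parked N P acc l | halt true with refl ← acc-halted (parked-halt P e) acc = done e
  acc←parked N P acc l | halt false = contradiction acc (not-rejected (parked-halt P e))
  acc←parked N P acc l | branch f
    with f′ , e′ , r ← parked-branch P e
    with b , _ , refl , acc′ , _ ← acc-branch e′ acc = branch e b (Rerun.acc→ x k (r b) acc′)
  acc←parked N P acc l | det d with outcome P e
  ... | overflowed r e′ _ _ = contradiction (proj₁ (acc-run r acc)) (not-rejected e′)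
  ... | advanced {m} r P′ with acc-run r acc
  acc←parked (suc N) P acc l | det d | advanced {m} r P′ | acc′ , e′ =
    det e (acc←parked N P′ acc′ (≤-trans (m≤n+m _ m) (≤-pred (≤-trans (≤-reflexive (sym e′)) l))))
  acc←parked zero P acc l | det d | advanced r P′ | acc′ , e′ with () ← ≤-trans (≤-reflexive (sym e′)) l

  data Key (a : TConfig) : Set where
    parked  : ∀ {n c} → Parked n a c → Key a
    running : ∀ {c} → Running x k a c → Reach v initial c → Key a
    failed  : tv a ≡ halt false → Safe a → Key a

  running-safe : ∀ {a c} → Running x k a c → Reach v initial c → Safe a
  running-safe (running h) = imitate-safe refl refl h

  parked-reach : ∀ {n a c} → Parked n a c → Reach v initial c
  parked-reach (parked _ _ _ _ _ _ r) = run→reach r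

  progress : ∀ {a} → Key a → Progress {v = tv} Safe Key a
  progress (failed e s) = halts s e
  progress (running {c} R ρ) with v c in e
  ... | halt b = halts (running-safe R ρ) (halt-rel′ (running-rel x k R) e)
  ... | det d with _ , e′ , R′ ← det-rel′ (running-rel x k R) e =
    runs (step (running-safe R ρ) e′ []) (running R′ (reach-det ρ e))
  ... | branch f with _ , e′ , R′ ← branch-rel′ (running-rel x k R) e =
    branches (running-safe R ρ) e′ (λ b → running (R′ b) (reach-branch ρ e b))
  progress (parked {n} {c} P) with v c in e
  ... | halt b = halts (parked-safe P) (parked-halt P e)
  ... | branch f with _ , e′ , R ← parked-branch P e =
    branches (parked-safe P) e′ (λ b → running (R b) (reach-branch (parked-reach P) e b))
  ... | det d with outcome P e
  ...   | advanced r P′        = runs r (parked P′)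
  ...   | overflowed r e′ s _  = runs r (failed e′ s)

  -- `branching` keeps the deterministic run of `M` up to its own first branching, because the tail
  -- bound of `M` can only be invoked there.
  data Final (a : TConfig) : Set where
    halted    : ∀ {b} → tv a ≡ halt b → Final a
    branching : ∀ {f f′ n c} → Run v Any initial n c → v c ≡ branch f → tv a ≡ branch f′ →
                (∀ b → Running x k (f′ b) (f b)) → Final a

  final-stuck : ∀ {a} → Final a → Stuck tv a
  final-stuck (halted e)          q with () ← trans (sym e) q
  final-stuck (branching _ _ e _) q with () ← trans (sym e) q

  parked-run : ∀ {n a c} → Parked n a c → Run v Any initial n c
  parked-run (parked _ _ _ _ _ _ r) = r

  module _ (S : ℕ) (bounded : ∀ {c} → Reach v initial c → space c ≤ S) where

    -- The clock shows `n` and has no more digits than `M` has visited cells, hence at most `S`.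
    parked-bound : ∀ {n a c} → Parked n a c → n < base ^ S
    parked-bound (parked {L} {q} {z} {w} {ds = ds} _ val len _ _ L≤ r) =
      <-≤-trans (≤-<-trans (≤-reflexive (sym val)) (value< ds))
        (^-monoʳ-≤ base (≤-trans (≤-reflexive len) (≤-trans L≤
          (≤-trans (+-mono-≤ (marks≤length (cells z)) (allMarks≤sizes w))
            (≤-trans (≤-reflexive (sym (space-erase q z w unread))) (bounded (run→reach r)))))))

    -- The fuel `base ^ S` is far too large for a time bound, but only the existence of an end
    -- matters: steps before the first nondeterministic one are not limited.
    final : ∀ N {n a c} → Parked n a c → base ^ S ≤ N + n → ∃[ m ] ∃[ a′ ] Run tv Any a m a′ × Final a′
    final N {c = c} P h with v c in e
    ... | halt b = _ , _ , [] , halted (parked-halt P e)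
    ... | branch f with _ , e′ , R ← parked-branch P e = _ , _ , [] , branching (parked-run P) e e′ R
    final N P h | det d with outcome P e
    ... | overflowed r e′ _ _ = _ , _ , weaken _ r , halted e′
    final zero P h | det d | advanced r P′ = contradiction h (<⇒≱ (parked-bound P))
    final (suc N) {n} P h | det d | advanced r P′
      with m , a′ , r′ , F ← final N P′ (≤-trans h (≤-reflexive (sym (+-suc N n)))) =
      _ , a′ , weaken _ r +++ r′ , F

-- `prefix` is what the clock adds to membership in the class: the deterministic prefix ends, by
-- halting or at a first branching. A machine can then be suspended at a definite configuration.
record Prefixed (C : Class) (F : ParamFun) : Set₁ where
  field
    M           : Machine
    paraL       : ParaL M
    kBounded    : KBounded M
    restriction : Restriction C M
    counts      : ∀ x k → #acc[ M ]⟨ x , k ⟩≡ F x k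
    prefix      : ∀ x k → ∃[ n ] ∃[ c ] Run (view M x k) Any (initialOn M x k []) n c × Stuck (view M x k) c

module ClockedClass (M : Machine) where

  open Clocked M using (typed)
  open Compile typed using (machine; space-lower; lower-initial; lowers; reach→; run←; acc→; acc←; within←; instruction-lower; tinitial; Lowers; tview)
    renaming (⌊_⌋ to lowered)
  module Target = Semantics machine
  module _ (x : Word) (k : ℕ) where
    open ClockedRuns M x k public using (Safe)
    open ClockedCorrect M x k public using (progress; final; Final; halted; branching; final-stuck; parked-initial; initial-≡; acc→parked; acc←parked)
    open ClockedCorrect M x k using (parked)

    source-path : ∀ {a} (s : Safe a) → Semantics._⟶*_ M x k (Semantics.initial M x k) (Safe.witness s)
    source-path s = Paths.reach→path M x k (Safe.reached s)

    safe-at : ∀ {c} → Target._⟶*_ x k (Target.initial x k) c → ∃[ a ] c ≡ lowered x k a × Safe a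
    safe-at p with a , r , e ← reach→ x k (lower-initial x k []) (Paths.path→reach machine x k p) =
      a , e , safe progress (parked parked-initial) r

    halting-prefix : ∀ S → (∀ {c} → Reach (view M x k) (Semantics.initial M x k) c → Semantics.space M x k c ≤ S) →
      ∃[ n ] ∃[ a ] ∃[ c ] Run (view machine x k) Any (initialOn machine x k []) n c × Lowers x k c a × Final a
    halting-prefix S bounded
      with n , a , r , F ← final S bounded _ parked-initial (m≤m+n _ 0)
      with c , r′ , e ← run← x k (lower-initial x k []) r = n , a , c , r′ , e , F

    words : ∀ ws → Acc (view M x k) (Semantics.initial M x k) ws ⇔ Acc (view machine x k) (initialOn machine x k []) ws
    words ws = mk⇔
      (λ acc → acc← x k (lower-initial x k []) (acc→parked parked-initial (subst (λ c → Acc (view M x k) c ws) (sym initial-≡) acc)))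
      (λ acc → subst (λ c → Acc (view M x k) c ws) initial-≡ (acc←parked _ parked-initial (acc→ x k (lower-initial x k []) acc) ≤-refl))

  read-once : ReadOnce M → ReadOnce machine
  read-once once x k p h l with a , refl , s ← safe-at x k p =
    let h′ , l′ = Safe.left-only s h (trans (cong Instruction.choiceMove (sym (instruction-lower x k a))) l)
    in once x k (source-path x k s) h′ l′

  module _ (paraL : ParaL M) where

    private
      f = proj₁ paraL
      c = proj₁ (proj₂ (proj₂ paraL))
      bound = proj₂ (proj₂ (proj₂ paraL))

    paraL′ : ParaL machine
    paraL′ = f , proj₁ (proj₂ paraL) , 3 * c + 3 , λ x k p → space-bound x k p , index-bound x k p
      where
      module _ x k {d} (p : Target._⟶*_ x k (Target.initial x k) d) where
        a = proj₁ (safe-at x k p)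
        e = proj₁ (proj₂ (safe-at x k p))
        s = proj₂ (proj₂ (safe-at x k p))
        space-bound : Target.space x k d ≤ (3 * c + 3) * (log (length x) + f k)
        space-bound = +-bound (3 * c) 3 (≤-trans (1≤log (length x)) (m≤m+n _ (f k))) (begin
          Target.space x k d                                ≡⟨ trans (cong (Target.space x k) e) (space-lower x k a) ⟩
          _                                                 ≤⟨ Safe.space-≤ s ⟩
          3 * Semantics.space M x k (Safe.witness s) + 3    ≤⟨ +-monoˡ-≤ 3 (*-monoʳ-≤ 3 (proj₁ (bound x k (source-path x k s)))) ⟩
          3 * (c * (log (length x) + f k)) + 3              ≡⟨ cong (_+ 3) (*-assoc 3 c _) ⟨
          3 * c * (log (length x) + f k) + 3                ∎)
          where open ≤-Reasoning
        index-bound : size (Target.Config.index d) ≤ (3 * c + 3) * log (length (encode x k))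
        index-bound = begin
          size (Target.Config.index d)                                ≡⟨ trans (cong (size ∘ Target.Config.index) e) (size-map proj₁ (Compile.TConfig.dual a)) ⟩
          size (Compile.TConfig.dual a)                               ≡⟨ Safe.index-≡ s ⟩
          size (Semantics.Config.index (Safe.witness s))              ≤⟨ proj₂ (bound x k (source-path x k s)) ⟩
          c * log (length (encode x k))                               ≤⟨ *-monoˡ-≤ (log (length (encode x k))) (≤-trans (m≤n*m c 3) (m≤m+n (3 * c) 3)) ⟩
          (3 * c + 3) * log (length (encode x k))                     ∎
          where open ≤-Reasoning

    halting : ∀ x k → ∃[ n ] ∃[ a ] ∃[ d ] Run (view machine x k) Any (initialOn machine x k []) n d × Lowers x k d a × Final x k a
    halting x k = halting-prefix x k (c * (log (length x) + f k)) λ r → proj₁ (bound x k (Paths.reach→path M x k r))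

    tail : TailNondeterministic M → TailNondeterministic machine
    tail t@(g , cg , _) = within→tail {machine} {λ k → 1 + g k} (computable-+ (computable-const 1) cg) λ x k →
      let n , a , d , r , e , F = halting x k in n , d , r , within← x k e (from-final x k F)
      where
      from-final : ∀ x k {a} → Final x k a → Within (tview x k) (suc (g k) * log (length x)) a
      from-final x k (halted e) = halt e
      -- The tail bound of `M` starts behind the branching step; the additional 1 in the factor pays
      -- for that step.
      from-final x k (branching r e e′ R) = within-≤ (+-monoˡ-≤ (g k * log (length x)) (1≤log (length x)))
        (branch e′ λ b → Clocked.Rerun.within← M x k (R b) (tail→within t x k r e b))

  bits′ : KBounded M → KBounded machine
  bits′ (h , ch , bound) = h , ch , λ x k p → let a , e , s = safe-at x k p in
    ≤-trans (≤-reflexive (trans (cong (bitsRead ∘ Target.Config.choice) e) (cong bitsRead (Safe.choice-≡ s))))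
      (bound x k (source-path x k s))

words-↔ : ∀ {S T : Set} {v : S → View S} {w : T → View T} {s t} →
  (∀ ws → Acc v s ws ⇔ Acc w t ws) → (∃[ ws ] Acc v s ws) ↔ (∃[ ws ] Acc w t ws)
words-↔ e = mk↔ₛ′ (λ (ws , a) → ws , Equivalence.to (e ws) a) (λ (ws , a) → ws , Equivalence.from (e ws) a)
  (λ (ws , a) → cong (ws ,_) (acc-unique _ a)) (λ (ws , a) → cong (ws ,_) (acc-unique _ a))

clocked : ∀ {C F} → F ∈#para[ C ]-L → Prefixed C F
clocked {C} (M , paraL , kBounded , restriction , counts) = record
  { M           = Compile.machine (Clocked.typed M)
  ; paraL       = paraL′ paraL
  ; kBounded    = bits′ kBounded
  ; restriction = both→restriction C (both-map read-once (tail paraL) C (restriction→both {M} C restriction))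
  ; counts      = λ x k → Paths.count← _ x k (↔-trans (Paths.count→ M x k (counts x k)) (words-↔ (words x k)))
  ; prefix      = λ x k → let n , a , d , r , e , F = halting paraL x k in
                    n , d , r , λ q → final-stuck x k F (proj₁ (proj₂ (det-rel (Compile.lowers _ x k e) q)))
  }
  where open ClockedClass M

-- The tidy machine

-- A choice bit b is stored in three cells: b, a guess whether b is the last bit
-- that is ever read, and false.  The head rests on the third cell, so that a
-- scanned true can serve as the left endmarker.

data Stage : Set where
  untouched unseen seen : Stage

-- Because the head rests on a cell without information, `sim` caches the current bit with its flag.
-- The `r` states read a block to the right. The `l` states step back over a block, and from `l₄` on
-- fetch bit and flag of the block before it. The `s` states carry an accepting computation to the
-- flagged block.
data Aux : Set where
  sim : Maybe (Bool × Bool) → Stage → Aux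
  r₁  : Stage → Aux
  r₂  : Stage → Bool → Aux
  r₃  : Stage → Bool → Bool → Aux
  l₁ l₂ l₃ l₄ : Stage → Aux
  l₅  : Stage → Bool → Aux
  l₆  : Stage → Bool → Bool → Aux
  s₁ s₂ : Aux
  s₃  : Bool → Aux
  fail : Aux

abstract
  finite-Stage : Finite Stage
  finite-Stage = finite-↔ (mk↔ₛ′
    (λ { untouched → inj₁ tt ; unseen → inj₂ (inj₁ tt) ; seen → inj₂ (inj₂ tt) })
    (λ { (inj₁ _) → untouched ; (inj₂ (inj₁ _)) → unseen ; (inj₂ (inj₂ _)) → seen })
    (λ { (inj₁ _) → refl ; (inj₂ (inj₁ _)) → refl ; (inj₂ (inj₂ _)) → refl })
    (λ { untouched → refl ; unseen → refl ; seen → refl }))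
    (finite-⊎ finite-⊤ (finite-⊎ finite-⊤ finite-⊤))

  finite-Aux : Finite Aux
  finite-Aux = finite-↔ (mk↔ₛ′
    (λ { (sim c s) → inj₁ (inj₁ (inj₁ (c , s))) ; (r₁ s) → inj₁ (inj₁ (inj₂ (inj₁ s)))
       ; (r₂ s b) → inj₁ (inj₁ (inj₂ (inj₂ (inj₁ (s , b))))) ; (r₃ s b l) → inj₁ (inj₁ (inj₂ (inj₂ (inj₂ (s , b , l)))))
       ; (l₁ s) → inj₁ (inj₂ (inj₁ s)) ; (l₂ s) → inj₁ (inj₂ (inj₂ (inj₁ s))) ; (l₃ s) → inj₁ (inj₂ (inj₂ (inj₂ s)))
       ; (l₄ s) → inj₂ (inj₁ (inj₁ s)) ; (l₅ s b) → inj₂ (inj₁ (inj₂ (inj₁ (s , b))))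
       ; (l₆ s b l) → inj₂ (inj₁ (inj₂ (inj₂ (s , b , l)))) ; s₁ → inj₂ (inj₂ (inj₁ tt))
       ; s₂ → inj₂ (inj₂ (inj₂ (inj₁ tt))) ; (s₃ b) → inj₂ (inj₂ (inj₂ (inj₂ (inj₁ b)))) ; fail → inj₂ (inj₂ (inj₂ (inj₂ (inj₂ tt)))) })
    (λ { (inj₁ (inj₁ (inj₁ (c , s)))) → sim c s ; (inj₁ (inj₁ (inj₂ (inj₁ s)))) → r₁ s
       ; (inj₁ (inj₁ (inj₂ (inj₂ (inj₁ (s , b)))))) → r₂ s b ; (inj₁ (inj₁ (inj₂ (inj₂ (inj₂ (s , b , l)))))) → r₃ s b l
       ; (inj₁ (inj₂ (inj₁ s))) → l₁ s ; (inj₁ (inj₂ (inj₂ (inj₁ s)))) → l₂ s ; (inj₁ (inj₂ (inj₂ (inj₂ s)))) → l₃ s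
       ; (inj₂ (inj₁ (inj₁ s))) → l₄ s ; (inj₂ (inj₁ (inj₂ (inj₁ (s , b))))) → l₅ s b
       ; (inj₂ (inj₁ (inj₂ (inj₂ (s , b , l))))) → l₆ s b l ; (inj₂ (inj₂ (inj₁ _))) → s₁
       ; (inj₂ (inj₂ (inj₂ (inj₁ _)))) → s₂ ; (inj₂ (inj₂ (inj₂ (inj₂ (inj₁ b))))) → s₃ b ; (inj₂ (inj₂ (inj₂ (inj₂ (inj₂ _))))) → fail })
    (λ { (inj₁ (inj₁ (inj₁ (c , s)))) → refl ; (inj₁ (inj₁ (inj₂ (inj₁ s)))) → refl
       ; (inj₁ (inj₁ (inj₂ (inj₂ (inj₁ (s , b)))))) → refl ; (inj₁ (inj₁ (inj₂ (inj₂ (inj₂ (s , b , l)))))) → refl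
       ; (inj₁ (inj₂ (inj₁ s))) → refl ; (inj₁ (inj₂ (inj₂ (inj₁ s)))) → refl ; (inj₁ (inj₂ (inj₂ (inj₂ s)))) → refl
       ; (inj₂ (inj₁ (inj₁ s))) → refl ; (inj₂ (inj₁ (inj₂ (inj₁ (s , b))))) → refl
       ; (inj₂ (inj₁ (inj₂ (inj₂ (s , b , l))))) → refl ; (inj₂ (inj₂ (inj₁ _))) → refl
       ; (inj₂ (inj₂ (inj₂ (inj₁ _)))) → refl ; (inj₂ (inj₂ (inj₂ (inj₂ (inj₁ b))))) → refl ; (inj₂ (inj₂ (inj₂ (inj₂ (inj₂ _))))) → refl })
    (λ { (sim c s) → refl ; (r₁ s) → refl ; (r₂ s b) → refl ; (r₃ s b l) → refl ; (l₁ s) → refl ; (l₂ s) → refl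
       ; (l₃ s) → refl ; (l₄ s) → refl ; (l₅ s b) → refl ; (l₆ s b l) → refl ; s₁ → refl ; s₂ → refl ; (s₃ b) → refl ; fail → refl }))
    (finite-⊎
      (finite-⊎ (finite-⊎ (finite-× (finite-Maybe (finite-× finite-Bool finite-Bool)) finite-Stage)
                  (finite-⊎ finite-Stage (finite-⊎ (finite-× finite-Stage finite-Bool) (finite-× finite-Stage (finite-× finite-Bool finite-Bool)))))
        (finite-⊎ finite-Stage (finite-⊎ finite-Stage finite-Stage)))
      (finite-⊎ (finite-⊎ finite-Stage (finite-⊎ (finite-× finite-Stage finite-Bool) (finite-× finite-Stage (finite-× finite-Bool finite-Bool))))
        (finite-⊎ finite-⊤ (finite-⊎ finite-⊤ (finite-⊎ finite-Bool finite-⊤)))))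

mark : Bool → Stage → Stage
mark true  _         = seen
mark false untouched = unseen
mark false s         = s

module Tidy (M : Machine) where

  open Machine M
  open Instruction

  State : Set
  State = Q × Aux

  -- A left move at the endmarker becomes `stay`, since the real cell to the left may belong to
  -- another segment. Moving right from a bit flagged as the last one refutes the guess.
  launch : Move → Maybe (Bool × Bool) → Stage → Aux × Move
  launch stay  c                 s = sim c s , stay
  launch left  nothing           s = sim nothing s , stay
  launch left  (just _)          s = l₁ s , left
  launch right nothing           s = r₁ s , right
  launch right (just (_ , false)) s = r₁ s , right
  launch right (just (_ , true))  s = fail , stay

  isTrue : Maybe Bool → Bool
  isTrue (just b) = b
  isTrue nothing  = false

  control : Aux → Maybe Bool → Aux × Move
  control (sim _ _)  _            = s₁ , right
  control (r₁ s)     c            = r₂ s (isTrue c) , right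
  control (r₂ s b)   c            = r₃ s b (isTrue c) , right
  control (r₃ s b l) (just true)  = fail , stay
  control (r₃ s b l) (just false) = sim (just (b , l)) (mark l s) , stay
  control (r₃ s b l) nothing      = fail , stay
  control (l₁ s)     _            = l₂ s , left
  control (l₂ s)     _            = l₃ s , left
  -- A `false` is the third cell of another block; anything else is the endmarker of the segment.
  control (l₃ s)     (just false) = l₄ s , left
  control (l₃ s)     (just true)  = sim nothing s , stay
  control (l₃ s)     nothing      = sim nothing s , stay
  control (l₄ s)     c            = l₅ s (isTrue c) , left
  control (l₅ s l)   c            = l₆ s (isTrue c) l , right
  control (l₆ s b l) _            = sim (just (b , l)) s , right
  control s₁         _            = s₂ , right
  control s₂         c            = s₃ (isTrue c) , right
  control (s₃ _)     _            = s₁ , right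
  control fail       _            = fail , stay

  hold : Q → Aux × Move → Bool → Vec Γ tapes → Instruction State Γ tapes
  hold q (a , m) b γs = record { next = q , a ; indexAction = b , stay ; workActions = idle γs ; choiceMove = m }

  follow : Maybe (Bool × Bool) → Stage → Instruction Q Γ tapes → Instruction State Γ tapes
  follow c s i = record
    { next        = next i , proj₁ (launch (choiceMove i) c s)
    ; indexAction = indexAction i
    ; workActions = workActions i
    ; choiceMove  = proj₂ (launch (choiceMove i) c s)
    }

  simulate : Maybe Bool → Q → Maybe (Bool × Bool) → Stage → Maybe InputSymbol → Bool → Vec Γ tapes → Instruction State Γ tapes
  simulate nothing  q c s x b γs = follow c s (δ q x b (Maybe.map proj₁ c) γs)
  simulate (just _) q c s x b γs = hold q (s₁ , right) b γs

  δ′ : State → Maybe InputSymbol → Bool → Maybe Bool → Vec Γ tapes → Instruction State Γ tapes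
  δ′ (q , sim c s)  x b _ γs = simulate (verdict q) q c s x b γs
  δ′ (q , a)       x b c γs = hold q (control a c) b γs

  -- In stage `unseen` bits were read but none was flagged as the last, so a guess was wrong. In
  -- stage `seen` acceptance is postponed unless the head is on the flagged block: nothing visited
  -- may lie to the right of the head when the next machine takes over.
  finish : Maybe Bool → Maybe (Bool × Bool) → Stage → Maybe Bool
  finish nothing      _                   _         = nothing
  finish (just false) _                   _         = just false
  finish (just true)  _                   untouched = just true
  finish (just true)  _                   unseen    = just false
  finish (just true)  (just (_ , true))   seen      = just true
  finish (just true)  (just (_ , false))  seen      = nothing
  finish (just true)  nothing             seen      = nothing

  verdict′ : State → Maybe Bool
  verdict′ (q , sim c s) = finish (verdict q) c s
  verdict′ (_ , s₃ true) = just true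
  verdict′ (_ , fail)    = just false
  verdict′ _             = nothing

  tidy : Machine
  tidy = record
    { Q = State ; Q-finite = finite-× Q-finite finite-Aux ; Γ = Γ ; Γ-finite = Γ-finite ; blank = blank
    ; tapes = tapes ; start = start , sim nothing untouched ; verdict = verdict′ ; δ = δ′ }

-- Choice bits as blocks of three cells

Flagged : Set
Flagged = List (Bool × Bool)

-- Cells from left to right, starting at the head; only the last one may be flagged.
data Flags : Stage → Flagged → Set where
  none : Flags untouched []
  open-end : ∀ {b} → Flags unseen ((b , false) ∷ [])
  last : ∀ {b} → Flags seen ((b , true) ∷ [])
  more : ∀ {s b d ds} → Flags s (d ∷ ds) → Flags s ((b , false) ∷ d ∷ ds)

data Layout : Stage → Flagged → Flagged → Set where
  at-base : ∀ {s ds} → Flags s ds → Layout s [] ds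
  inside  : ∀ {s a as ds} → All (λ p → proj₂ p ≡ false) as → Flags s (a ∷ ds) → Layout s (a ∷ as) ds

-- The tapes whose scanned cell cannot be mistaken for the third cell of a block: the true
-- endmarker, or a cell holding `true`.
data Base : List Bool → Set where
  bare   : Base []
  marker : ∀ {u} → Base (true ∷ u)

encodeUp : List Bool → Flagged → List Bool
encodeUp u []             = u
encodeUp u ((b , l) ∷ as) = false ∷ l ∷ b ∷ encodeUp u as

encodeDown : Flagged → List Bool
encodeDown []             = []
encodeDown ((b , l) ∷ ds) = b ∷ l ∷ false ∷ encodeDown ds

null : List Bool → Bool
null []      = true
null (_ ∷ _) = false

expand : List Bool → List Bool
expand []       = []
expand (b ∷ bs) = b ∷ null bs ∷ false ∷ expand bs

expand-injective : ∀ as bs → expand as ≡ expand bs → as ≡ bs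
expand-injective []       []       _ = refl
expand-injective (a ∷ as) (b ∷ bs) e with refl , e′ ← List.∷-injective e =
  cong (a ∷_) (expand-injective as bs (proj₂ (List.∷-injective (proj₂ (List.∷-injective e′)))))

-- The bits that may still be read if all guesses made so far are right.
Allowed : Stage → List Bool → Set
Allowed untouched bs = ⊤
Allowed unseen    bs = bs ≢ []
Allowed seen      bs = bs ≡ []

-- Runs of the tidy machine inside one simulated step

module TidyRuns (M : Machine) (x : Word) (k : ℕ) where

  open Machine M
  open Instruction
  open Tidy M
  open Periodicity M using (config-≡)
  open Semantics M x k hiding (act)
  open Paths M x k using (view-halt; halt-view; view-step)

  module T = Semantics tidy x k
  module TP = Paths tidy x k

  private
    v  = view M x k
    tv = view tidy x k

  Works : Set
  Works = Vec (Tape Γ) tapes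

  hold-view : ∀ s q p I V t → verdict′ s ≡ nothing →
    T.instruction (T.config s I V t) ≡ hold q p (Tape.current I) (Vec.map Tape.current V) →
    tv (T.config s I V t) ≡ mapView (T.config (q , proj₁ p) I V) (moved (proj₂ p) t)
  hold-view s q p I V t e e′ = trans (TP.view-step {T.config s I V t} e) (trans
    (cong (λ i → mapView (λ t → T.config (next i) (act false (indexAction i) I) (Vec.zipWith (act blank) (workActions i) V) t)
      (moved (choiceMove i) t)) e′)
    (cong (λ V → mapView (T.config (q , proj₁ p) I V) (moved (proj₂ p) t)) (idle-act blank V)))

  instr : Q → Tape Bool → Works → Flagged → Instruction Q Γ tapes
  instr q I V ups = δ q (List.head (drop (address I) (encode x k))) (Tape.current I)
    (Maybe.map proj₁ (List.head ups)) (Vec.map Tape.current V)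

  erase : Q → Tape Bool → Works → Flagged → Flagged → Config
  erase q I V ups downs = config q I V (choiceTape (List.map proj₁ ups) (List.map proj₁ downs))

  image : List Bool → Stage → Q → Tape Bool → Works → Flagged → Flagged → T.Config
  image u s q I V ups downs = T.config (q , sim (List.head ups) s) I V (choiceTape (encodeUp u ups) (encodeDown downs))

  instruction-erase : ∀ q I V ups downs → instruction (erase q I V ups downs) ≡ instr q I V ups
  instruction-erase q I V ups downs = cong (λ c → δ q _ (Tape.current I) c (Vec.map Tape.current V)) (head-map ups)
    where
    head-map : ∀ ups → List.head (List.map proj₁ ups) ≡ Maybe.map proj₁ (List.head ups)
    head-map []      = refl
    head-map (_ ∷ _) = refl

  index′ : Instruction Q Γ tapes → Tape Bool → Tape Bool
  index′ i = act false (indexAction i)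

  work′ : Instruction Q Γ tapes → Works → Works
  work′ i = Vec.zipWith (act blank) (workActions i)

  advance-erase : ∀ q I V ups downs t → let i = instr q I V ups in
    advance (erase q I V ups downs) t ≡ config (next i) (index′ i I) (work′ i V) t
  advance-erase q I V ups downs t = cong (λ i → config (next i) (index′ i I) (work′ i V) t) (instruction-erase q I V ups downs)

  view-erase : ∀ {q I V ups downs} → verdict q ≡ nothing → let i = instr q I V ups in
    v (erase q I V ups downs) ≡ mapView (config (next i) (index′ i I) (work′ i V))
      (moved (choiceMove i) (choiceTape (List.map proj₁ ups) (List.map proj₁ downs)))
  view-erase {q} {I} {V} {ups} {downs} e = trans (view-step e)
    (cong (λ i → mapView (λ t → config (next i) (index′ i I) (work′ i V) t)
      (moved (choiceMove i) (choiceTape (List.map proj₁ ups) (List.map proj₁ downs)))) (instruction-erase q I V ups downs))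

  view-image : ∀ {s q I V ups t} → verdict q ≡ nothing →
    let i = instr q I V ups ; p = launch (choiceMove i) (List.head ups) s in
    tv (T.config (q , sim (List.head ups) s) I V t) ≡
    mapView (T.config (next i , proj₁ p) (index′ i I) (work′ i V)) (moved (proj₂ p) t)
  view-image {s} {q} {I} {V} {ups} {t} e = trans
    (TP.view-step {T.config (q , sim (List.head ups) s) I V t} (cong (λ h → finish h (List.head ups) s) e))
    (cong (λ h → let i = simulate h q (List.head ups) s (List.head (drop (address I) (encode x k))) (Tape.current I) (Vec.map Tape.current V)
                 in mapView (λ t → T.config (next i) (act false (indexAction i) I) (Vec.zipWith (act blank) (workActions i) V) t)
                      (moved (choiceMove i) t)) e)

  -- `left-only` has a witness of its own: while the tidy machine walks back over a block, `witness`
  -- is already the configuration after the left move of `M`.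
  record Safe (u : List Bool) (d : T.Config) : Set where
    constructor safe-by
    field
      {witness}  : Config
      reached    : Reach v initial witness
      index-≡    : T.index d ≡ index witness
      work-≡     : T.work d ≡ work witness
      bits-≤     : bitsRead (T.choice d) ≤ length u + 3 * bitsRead (choice witness)
      left-only  : verdict′ (T.state d) ≡ nothing → choiceMove (T.instruction d) ≡ left →
                   ∃[ c ] Reach v initial c × verdict (state c) ≡ nothing × choiceMove (instruction c) ≡ left
      accept-end : verdict′ (T.state d) ≡ just true → ChoiceTape.beyond (T.choice d) ≡ []

  length-up : ∀ u ups → length (encodeUp u ups) ≡ length u + 3 * length ups
  length-up u []        = sym (+-identityʳ _)
  length-up u (_ ∷ ups) = trans (cong (3 +_) (length-up u ups)) (shuffle (length u) (length ups))
    where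
    shuffle : ∀ m n → 3 + (m + 3 * n) ≡ m + 3 * suc n
    shuffle = solve-∀

  length-down : ∀ downs → length (encodeDown downs) ≡ 3 * length downs
  length-down []         = refl
  length-down (_ ∷ downs) = trans (cong (3 +_) (length-down downs)) (sym (*-suc 3 (length downs)))

  bits-encode : ∀ u ups downs → length (encodeUp u ups) + length (encodeDown downs) ≡
    length u + 3 * (length (List.map proj₁ ups) + length (List.map proj₁ downs))
  bits-encode u ups downs = trans (cong₂ _+_ (length-up u ups) (length-down downs))
    (trans (+-assoc (length u) _ _) (cong (length u +_) (trans (sym (*-distribˡ-+ 3 (length ups) (length downs)))
      (cong₂ (λ m n → 3 * (m + n)) (sym (List.length-map proj₁ ups)) (sym (List.length-map proj₁ downs))))))

  LeftReachable : Set
  LeftReachable = ∃[ c ] Reach v initial c × verdict (state c) ≡ nothing × choiceMove (instruction c) ≡ left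

  data Simulates (u : List Bool) (s : Stage) : T.Config → Config → Set where
    simulates : ∀ {q I V ups downs} → Layout s ups downs →
      Simulates u s (image u s q I V ups downs) (erase q I V ups downs)

  untouched-empty : ∀ {d ds} → ¬ Flags untouched (d ∷ ds)
  untouched-empty (more f) = untouched-empty f

  finish-end : ∀ {s h ups downs} → Layout s ups downs → finish h (List.head ups) s ≡ just true → encodeDown downs ≡ []
  finish-end {untouched} {just true} (at-base none) e = refl
  finish-end {untouched} {just true} (at-base (more f)) e = contradiction f untouched-empty
  finish-end {untouched} {just true} (inside _ f) e = contradiction f untouched-empty
  finish-end {seen} {just true} (inside {a = _ , true} _ last) e = refl

  simulates-safe : ∀ {u s d c} → Simulates u s d c → Reach v initial c → Safe u d
  simulates-safe {u} {s} (simulates {q} {I} {V} {ups} {downs} layout) r = safe-by r refl refl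
    (≤-reflexive (bits-encode u ups downs)) lefts (finish-end layout)
    where
    lefts : finish (verdict q) (List.head ups) s ≡ nothing → choiceMove (T.instruction (image u s q I V ups downs)) ≡ left → LeftReachable
    lefts h l with verdict q in e
    ... | nothing = _ , r , e , trans (cong choiceMove (instruction-erase q I V ups downs)) (launch-left _ (List.head ups) l)
      where
      launch-left : ∀ m c → proj₂ (launch m c s) ≡ left → m ≡ left
      launch-left left  c                    e = refl
      launch-left right nothing              ()
      launch-left right (just (_ , false))   ()
      launch-left right (just (_ , true))    ()
    lefts h () | just _

  mark-above : ∀ {s d ds} → Flags s (d ∷ ds) → mark (proj₂ d) s ≡ s
  mark-above open-end        = refl
  mark-above last            = refl
  mark-above {unseen} (more f) = refl
  mark-above {seen}   (more f) = refl
  mark-above {untouched} (more f) with () ← untouched-empty f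

  layout-left : ∀ {s a as ds} → Layout s (a ∷ as) ds → Layout s as (a ∷ ds)
  layout-left (inside []         f) = at-base f
  layout-left (inside (refl ∷ p) f) = inside p (more f)

  layout-right : ∀ {s as d ds} → Layout s as (d ∷ ds) → Layout s (d ∷ as) ds
  layout-right (at-base f)         = inside [] f
  layout-right (inside p (more f)) = inside (refl ∷ p) f

  layout-fresh : ∀ {s as} b l → Layout s as [] → (∀ {b as′} → as ≢ (b , true) ∷ as′) →
    Layout (mark l s) ((b , l) ∷ as) []
  layout-fresh b false (at-base none)        _ = inside [] open-end
  layout-fresh b true  (at-base none)        _ = inside [] last
  layout-fresh b false (inside p open-end)   _ = inside (refl ∷ p) open-end
  layout-fresh b true  (inside p open-end)   _ = inside (refl ∷ p) last
  layout-fresh b l     (inside p last)       h = contradiction refl h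

  module Controlled {u : List Bool} (q : Q) (I : Tape Bool) (V : Works) (t : ChoiceTape)
    (reached : Reach v initial (config q I V t)) where

    private
      c = config q I V t

    at-aux : Aux → List Bool → List Bool → T.Config
    at-aux a xs ys = T.config (q , a) I V (choiceTape xs ys)

    module _ (K : ℕ) (K≤ : K ≤ length u + 3 * bitsRead (choice c)) where

      mid : ∀ a xs ys → length xs + length ys ≡ K →
        (verdict′ (q , a) ≡ nothing → choiceMove (T.instruction (at-aux a xs ys)) ≡ left → LeftReachable) →
        (verdict′ (q , a) ≡ just true → ys ≡ []) → Safe u (at-aux a xs ys)
      mid a xs ys e l h = safe-by reached refl refl (≤-trans (≤-reflexive e) K≤) l h

      right-shift : ∀ (xs ys : List Bool) → length xs + suc (length ys) ≡ K → suc (length xs) + length ys ≡ K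
      right-shift xs ys e = trans (sym (+-suc (length xs) (length ys))) e

      left-shift : ∀ (xs ys : List Bool) → suc (length xs) + length ys ≡ K → length xs + suc (length ys) ≡ K
      left-shift xs ys e = trans (+-suc (length xs) (length ys)) e

      tick : ∀ a xs ys {xs′ ys′ n d} → length xs + length ys ≡ K → verdict′ (q , a) ≡ nothing →
        T.instruction (at-aux a xs ys) ≡ hold q (control a (List.head xs)) (Tape.current I) (Vec.map Tape.current V) →
        (proj₂ (control a (List.head xs)) ≡ left → LeftReachable) →
        moved (proj₂ (control a (List.head xs))) (choiceTape xs ys) ≡ det (choiceTape xs′ ys′) →
        Run tv (Safe u) (at-aux (proj₁ (control a (List.head xs))) xs′ ys′) n d →
        Run tv (Safe u) (at-aux a xs ys) (suc n) d
      tick a xs ys e h i l m r = step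
        (mid a xs ys e (λ _ e′ → l (trans (sym (cong choiceMove i)) e′)) λ h′ → contradiction (trans (sym h) h′) λ ())
        (trans (hold-view (q , a) q (control a (List.head xs)) I V (choiceTape xs ys) h i) (cong (mapView _) m)) r

      run-left : ∀ {s b l as ds} → Base u → LeftReachable → length (encodeUp u ((b , l) ∷ as)) + length (encodeDown ds) ≡ K →
        ∃[ n ] n ≤ 6 × Run tv (Safe u) (at-aux (l₁ s) (l ∷ b ∷ encodeUp u as) (false ∷ encodeDown ds)) n
          (image u s q I V as ((b , l) ∷ ds))
      run-left {s} {b} {l} {as} {ds} base lr e = go as base e
        where
        D = encodeDown ds
        lr′ : ∀ {m} → m ≡ left → LeftReachable
        lr′ _ = lr
        e₃ : ∀ U → length (false ∷ l ∷ b ∷ U) + length D ≡ K → length U + length (b ∷ l ∷ false ∷ D) ≡ K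
        e₃ U e = left-shift U (l ∷ false ∷ D) (left-shift (b ∷ U) (false ∷ D) (left-shift (l ∷ b ∷ U) D e))
        descend : ∀ U {n d} → length (false ∷ l ∷ b ∷ U) + length D ≡ K →
          Run tv (Safe u) (at-aux (l₃ s) U (b ∷ l ∷ false ∷ D)) n d →
          Run tv (Safe u) (at-aux (l₁ s) (l ∷ b ∷ U) (false ∷ D)) (2 + n) d
        descend U e r =
          tick (l₁ s) (l ∷ b ∷ U) (false ∷ D) e₁ refl refl lr′ refl
          (tick (l₂ s) (b ∷ U) (l ∷ false ∷ D) (left-shift (b ∷ U) (false ∷ D) e₁) refl refl lr′ refl r)
          where e₁ = left-shift (l ∷ b ∷ U) D e
        go : ∀ as → Base u → length (encodeUp u ((b , l) ∷ as)) + length D ≡ K →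
          ∃[ n ] n ≤ 6 × Run tv (Safe u) (at-aux (l₁ s) (l ∷ b ∷ encodeUp u as) (false ∷ D)) n (image u s q I V as ((b , l) ∷ ds))
        go [] bare   e = 3 , s≤s (s≤s (s≤s z≤n)) , descend u e (tick (l₃ s) u (b ∷ l ∷ false ∷ D) (e₃ u e) refl refl (λ ()) refl [])
        go [] marker e = 3 , s≤s (s≤s (s≤s z≤n)) , descend u e (tick (l₃ s) u (b ∷ l ∷ false ∷ D) (e₃ u e) refl refl (λ ()) refl [])
        go ((b′ , l′) ∷ as) _ e = 6 , ≤-refl , descend (false ∷ l′ ∷ b′ ∷ U) e
          (tick (l₃ s) (false ∷ l′ ∷ b′ ∷ U) (b ∷ l ∷ false ∷ D) e′ refl refl lr′ refl
          (tick (l₄ s) (l′ ∷ b′ ∷ U) (false ∷ b ∷ l ∷ false ∷ D) e″ refl refl lr′ refl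
          (tick (l₅ s l′) (b′ ∷ U) (l′ ∷ false ∷ b ∷ l ∷ false ∷ D) (left-shift (b′ ∷ U) (false ∷ b ∷ l ∷ false ∷ D) e″) refl refl (λ ()) refl
          (tick (l₆ s b′ l′) (l′ ∷ b′ ∷ U) (false ∷ b ∷ l ∷ false ∷ D) e″ refl refl (λ ()) refl []))))
          where
          U  = encodeUp u as
          e′ = e₃ (false ∷ l′ ∷ b′ ∷ U) e
          e″ = left-shift (l′ ∷ b′ ∷ U) (b ∷ l ∷ false ∷ D) e′

      run-right : ∀ {s b l as ds} → mark l s ≡ s → length (b ∷ encodeUp u as) + length (l ∷ false ∷ encodeDown ds) ≡ K →
        Run tv (Safe u) (at-aux (r₁ s) (b ∷ encodeUp u as) (l ∷ false ∷ encodeDown ds)) 3 (image u s q I V ((b , l) ∷ as) ds)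
      run-right {s} {b} {l} {as} {ds} m e = subst
        (λ s′ → Run tv (Safe u) (at-aux (r₁ s) (b ∷ U) (l ∷ false ∷ D)) 3 (image u s′ q I V ((b , l) ∷ as) ds)) m
        (tick (r₁ s) (b ∷ U) (l ∷ false ∷ D) e refl refl (λ ()) refl
        (tick (r₂ s b) (l ∷ b ∷ U) (false ∷ D) e₁ refl refl (λ ()) refl
        (tick (r₃ s b l) (false ∷ l ∷ b ∷ U) D (right-shift (l ∷ b ∷ U) D e₁) refl refl (λ ()) refl [])))
        where
        U  = encodeUp u as
        D  = encodeDown ds
        e₁ = right-shift (b ∷ U) (false ∷ D) e

      -- Only flags are inspected. The flagged block is the rightmost one, so the walk ends with
      -- nothing beyond the head.
      run-seek : ∀ {b l ds} U → Flags seen ((b , l) ∷ ds) → length (b ∷ U) + length (l ∷ false ∷ encodeDown ds) ≡ K →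
        ∃[ n ] ∃[ d ] n ≤ 2 + 3 * length ds × Run tv (Safe u) (at-aux s₁ (b ∷ U) (l ∷ false ∷ encodeDown ds)) n d ×
          Safe u d × tv d ≡ halt true
      run-seek {b} U last e = 2 , at-aux (s₃ true) (false ∷ true ∷ b ∷ U) [] , ≤-refl ,
        tick s₁ (b ∷ U) (true ∷ false ∷ []) e refl refl (λ ()) refl
        (tick s₂ (true ∷ b ∷ U) (false ∷ []) e₁ refl refl (λ ()) refl []) ,
        mid (s₃ true) (false ∷ true ∷ b ∷ U) [] (right-shift (true ∷ b ∷ U) [] e₁) (λ ()) (λ _ → refl) ,
        TP.view-halt {at-aux (s₃ true) (false ∷ true ∷ b ∷ U) []} refl
        where e₁ = right-shift (b ∷ U) (false ∷ []) e
      run-seek {b} {ds = (b′ , l′) ∷ ds} U (more f) e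
        with n , d , n≤ , r , s , h ← run-seek (false ∷ false ∷ b ∷ U) f (right-shift (false ∷ false ∷ b ∷ U) (l′ ∷ false ∷ encodeDown ds)
               (right-shift (false ∷ b ∷ U) (encodeDown ((b′ , l′) ∷ ds)) (right-shift (b ∷ U) (false ∷ encodeDown ((b′ , l′) ∷ ds)) e))) =
        3 + n , d , ≤-trans (+-monoʳ-≤ 3 n≤) (≤-reflexive (bound (length ds))) ,
        tick s₁ (b ∷ U) (false ∷ false ∷ D) e refl refl (λ ()) refl
        (tick s₂ (false ∷ b ∷ U) (false ∷ D) e₁ refl refl (λ ()) refl
        (tick (s₃ false) (false ∷ false ∷ b ∷ U) D (right-shift (false ∷ b ∷ U) D e₁) refl refl (λ ()) refl r)) , s , h
        where
        D  = encodeDown ((b′ , l′) ∷ ds)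
        e₁ = right-shift (b ∷ U) (false ∷ D) e
        bound : ∀ n → 3 + (2 + 3 * n) ≡ 2 + 3 * suc n
        bound = solve-∀

-- The tidy machine imitates single steps

module TidyCorrect (M : Machine) (x : Word) (k : ℕ) where

  open Machine M
  open Instruction
  open Tidy M
  open TidyRuns M x k
  open Semantics M x k hiding (act)
  open Paths M x k using (view-halt; halt-view; view-step)

  private
    v  = view M x k
    tv = view tidy x k

  encode-bound : ∀ u ups downs {K} → K ≤ length (encodeUp u ups) + length (encodeDown downs) →
    K ≤ length u + 3 * (length (List.map proj₁ ups) + length (List.map proj₁ downs))
  encode-bound u ups downs h = ≤-trans h (≤-reflexive (bits-encode u ups downs))

  module _ {u : List Bool} where

    DetOutcome : Stage → T.Config → Config → Set
    DetOutcome s d c′ = ∃[ n ] ∃[ d′ ] n ≤ 7 × Run tv (Safe u) d (suc n) d′ × Simulates u s d′ c′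

    det-outcome : ∀ {s d c c′} → Base u → Simulates u s d c → Reach v initial c → v c ≡ det c′ → DetOutcome s d c′
    det-outcome {s} {c′ = c′} base S@(simulates {q} {I} {V} {ups} {downs} layout) r e =
      by (choiceMove i) refl ups downs layout (simulates-safe S r) (trans (sym (view-erase h)) e) (view-image {t = choiceTape (encodeUp u ups) (encodeDown downs)} h)
      where
      h  = proj₁ (resolve-det (verdict q) (advance (erase q I V ups downs)) (moved (choiceMove (instruction (erase q I V ups downs))) (choice (erase q I V ups downs))) e)
      i  = instr q I V ups
      I′ = index′ i I
      V′ = work′ i V
      r′ = reach-det r e
      lr : choiceMove i ≡ left → LeftReachable
      lr l = _ , r , h , trans (cong choiceMove (instruction-erase q I V ups downs)) l
      three-right : ∀ m n → m + (3 + n) ≡ 3 + m + n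
      three-right = solve-∀
      two-right : ∀ m n → 1 + m + (2 + n) ≡ 3 + m + n
      two-right = solve-∀
      by : ∀ m → m ≡ choiceMove i → ∀ ups downs {d} → Layout s ups downs → Safe u d →
        mapView (config (next i) I′ V′) (moved m (choiceTape (List.map proj₁ ups) (List.map proj₁ downs))) ≡ det c′ →
        tv d ≡ mapView (T.config (next i , proj₁ (launch m (List.head ups) s)) I′ V′)
          (moved (proj₂ (launch m (List.head ups) s)) (choiceTape (encodeUp u ups) (encodeDown downs))) →
        DetOutcome s d c′
      by stay  _ ups     downs layout safe refl t = 0 , _ , z≤n , step safe t [] , simulates layout
      by left  _ []      downs layout safe refl t = 0 , _ , z≤n , step safe t [] , simulates layout
      by left  m ((b , l) ∷ as) downs layout safe refl t
        with n , n≤ , ρ ← Controlled.run-left (next i) I′ V′ _ r′ _ (encode-bound u as ((b , l) ∷ downs) ≤-refl) {s} {b} {l} {as} {downs} base (lr (sym m))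
               (sym (three-right (length (encodeUp u as)) (length (encodeDown downs)))) =
        n , _ , m≤n⇒m≤1+n n≤ , step safe t ρ , simulates (layout-left layout)
      by right _ []                   []       layout safe () t
      by right _ (_ ∷ _)              []       layout safe () t
      by right _ []                   ((b , l) ∷ ds) layout@(at-base f) safe refl t = 3 , _ , s≤s (s≤s (s≤s z≤n)) ,
        step safe t (Controlled.run-right (next i) I′ V′ _ r′ _ (encode-bound u ((b , l) ∷ []) ds (≤-reflexive (two-right (length u) (length (encodeDown ds)))))
          {s} {b} {l} {[]} {ds} (mark-above f) refl) , simulates (layout-right layout)
      by right _ ((b′ , false) ∷ as) ((b , l) ∷ ds) layout@(inside _ (more f)) safe refl t = 3 , _ , s≤s (s≤s (s≤s z≤n)) ,
        step safe t (Controlled.run-right (next i) I′ V′ _ r′ _ (encode-bound u ((b , l) ∷ (b′ , false) ∷ as) ds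
            (≤-reflexive (two-right (length (encodeUp u ((b′ , false) ∷ as))) (length (encodeDown ds)))))
          {s} {b} {l} {(b′ , false) ∷ as} {ds} (mark-above f) refl) , simulates (layout-right layout)

    -- `fresh` is a tree of three branchings, for the bit, the flag and the third cell. A third cell
    -- `true` leads to failure, so that it does not double the number of accepted words.
    data Branching (s : Stage) (d : T.Config) (f : Bool → Config) : Set where
      dead  : ∀ {d′} → s ≡ seen → tv d ≡ det d′ → Safe u d′ → tv d′ ≡ halt false → Branching s d f
      fresh : ∀ {d₁ : Bool → T.Config} {d₂ : Bool → Bool → T.Config} {d₃ : Bool → Bool → Bool → T.Config} {d₄ : Bool → Bool → T.Config} {d₅ : Bool → Bool → T.Config} →
        s ≢ seen → tv d ≡ branch d₁ →
        (∀ b → Safe u (d₁ b) × tv (d₁ b) ≡ branch (d₂ b)) →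
        (∀ b l → Safe u (d₂ b l) × tv (d₂ b l) ≡ branch (d₃ b l)) →
        (∀ b l → Safe u (d₃ b l true) × tv (d₃ b l true) ≡ det (d₅ b l) × Safe u (d₅ b l) × tv (d₅ b l) ≡ halt false) →
        (∀ b l → Safe u (d₃ b l false) × tv (d₃ b l false) ≡ det (d₄ b l) × Simulates u (mark l s) (d₄ b l) (f b)) →
        Branching s d f

    branch-outcome : ∀ {s d c f} → Simulates u s d c → Reach v initial c → v c ≡ branch f → Branching s d f
    branch-outcome {s} {f = f} S@(simulates {q} {I} {V} {ups} {downs} layout) r e =
      by (choiceMove i) ups downs layout (trans (sym (view-erase h)) e) (view-image {t = choiceTape (encodeUp u ups) (encodeDown downs)} h)
      where
      h  = proj₁ (resolve-branch (verdict q) (advance (erase q I V ups downs)) (moved (choiceMove (instruction (erase q I V ups downs))) (choice (erase q I V ups downs))) e)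
      i  = instr q I V ups
      I′ = index′ i I
      V′ = work′ i V
      branching : ∀ {d} ups → Layout s ups [] → s ≢ seen → (∀ {b as′} → ups ≢ (b , true) ∷ as′) →
        f ≡ (λ b → config (next i) I′ V′ (choiceTape (b ∷ List.map proj₁ ups) [])) →
        tv d ≡ branch (λ b → T.config (next i , r₁ s) I′ V′ (choiceTape (b ∷ encodeUp u ups) [])) → Branching s d f
      branching ups layout s≢ un refl t = fresh s≢ t
        (λ b → mid b (r₁ s) (b ∷ U) (s≤s (m≤n+m _ 2)) (λ _ ()) (λ ()) , hold-view (next i , r₁ s) (next i) (r₂ s b , right) I′ V′ (choiceTape (b ∷ U) []) refl refl)
        (λ b l → mid b (r₂ s b) (l ∷ b ∷ U) (s≤s (s≤s (m≤n+m _ 1))) (λ _ ()) (λ ()) , hold-view (next i , r₂ s b) (next i) (r₃ s b l , right) I′ V′ (choiceTape (l ∷ b ∷ U) []) refl refl)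
        (λ b l → mid b (r₃ s b l) (true ∷ l ∷ b ∷ U) ≤-refl (λ _ ()) (λ ()) , hold-view (next i , r₃ s b l) (next i) (fail , stay) I′ V′ (choiceTape (true ∷ l ∷ b ∷ U) []) refl refl ,
                 mid b fail (true ∷ l ∷ b ∷ U) ≤-refl (λ ()) (λ ()) , refl)
        (λ b l → mid b (r₃ s b l) (false ∷ l ∷ b ∷ U) ≤-refl (λ _ ()) (λ ()) ,
                 hold-view (next i , r₃ s b l) (next i) (sim (just (b , l)) (mark l s) , stay) I′ V′ (choiceTape (false ∷ l ∷ b ∷ U) []) refl refl ,
                 simulates (layout-fresh b l layout un))
        where
        U = encodeUp u ups
        mid : ∀ b a xs → length xs ≤ 3 + length U →
          (verdict′ (next i , a) ≡ nothing → choiceMove (T.instruction (T.config (next i , a) I′ V′ (choiceTape xs []))) ≡ left → LeftReachable) →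
          (verdict′ (next i , a) ≡ just true → [] ≡ []) → Safe u (T.config (next i , a) I′ V′ (choiceTape xs []))
        mid b a xs n = Controlled.mid (next i) I′ V′ (choiceTape (b ∷ List.map proj₁ ups) []) (reach-branch r e b) (length xs + 0)
          (encode-bound u ((b , false) ∷ ups) [] (+-monoˡ-≤ 0 n)) a xs [] refl
      by : ∀ m ups downs {d} → Layout s ups downs →
        mapView (config (next i) I′ V′) (moved m (choiceTape (List.map proj₁ ups) (List.map proj₁ downs))) ≡ branch f →
        tv d ≡ mapView (T.config (next i , proj₁ (launch m (List.head ups) s)) I′ V′)
          (moved (proj₂ (launch m (List.head ups) s)) (choiceTape (encodeUp u ups) (encodeDown downs))) →
        Branching s d f
      by left  []      downs layout () t
      by left  (_ ∷ _) downs layout () t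
      by right [] [] layout@(at-base none) refl t = branching [] layout (λ ()) (λ ()) refl t
      by right ((b , true) ∷ as) [] layout@(inside _ last) refl t = dead refl t
        (Controlled.mid (next i) I′ V′ (choiceTape (true ∷ List.map proj₁ ((b , true) ∷ as)) []) (reach-branch r e true)
          (length (encodeUp u ((b , true) ∷ as)) + 0)
          (encode-bound u ((true , true) ∷ (b , true) ∷ as) [] (+-monoˡ-≤ 0 (m≤n+m _ 3))) fail (encodeUp u ((b , true) ∷ as)) [] refl (λ ()) (λ ())) refl
      by right ((b , false) ∷ as) [] layout@(inside _ open-end) refl t = branching ((b , false) ∷ as) layout (λ ()) (λ ()) refl t

    data Halting (s : Stage) (d : T.Config) (c : Config) (b : Bool) : Set where
      accepts : ∀ {n d′} → b ≡ true → Allowed s [] → n ≤ 3 * bitsRead (choice c) → Run tv (Safe u) d n d′ →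
                Safe u d′ → tv d′ ≡ halt true → Halting s d c b
      rejects : (b ≡ true → ¬ Allowed s []) → tv d ≡ halt false → Halting s d c b

    halt-outcome : ∀ {s d c b} → Simulates u s d c → Reach v initial c → v c ≡ halt b → Halting s d c b
    halt-outcome {s} {b = b} S@(simulates {q} {I} {V} {ups} {downs} layout) r e = by s b (halt-view e) ups downs layout (simulates-safe S r) r
      where
      by : ∀ s b → verdict q ≡ just b → ∀ ups downs → Layout s ups downs → Safe u (image u s q I V ups downs) →
        Reach v initial (erase q I V ups downs) → Halting s (image u s q I V ups downs) (erase q I V ups downs) b
      ends : ∀ {s ups downs b′} → finish (verdict q) (List.head ups) s ≡ just b′ → tv (image u s q I V ups downs) ≡ halt b′
      ends {s} {ups} {downs} h = TP.view-halt {image u s q I V ups downs} h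
      by s         false h ups downs layout safe r = rejects (λ ()) (ends (cong (λ h → finish h (List.head ups) s) h))
      by untouched true  h ups downs layout safe r = accepts refl tt z≤n [] safe (ends (cong (λ h → finish h (List.head ups) untouched) h))
      by unseen    true  h ups downs layout safe r = rejects (λ _ n → n refl) (ends (cong (λ h → finish h (List.head ups) unseen) h))
      by seen true h ((b , true) ∷ as) downs layout safe r = accepts refl refl z≤n [] safe (ends (cong (λ h → finish h (just (b , true)) seen) h))
      by seen true h [] ((b , l) ∷ ds) (at-base f) safe r
        with n , d , n≤ , ρ , s , h′ ← Controlled.run-seek q I V _ r _ (encode-bound u [] ((b , l) ∷ ds) (≤-reflexive (sym (+-suc (length u) _)))) u f refl =
        accepts refl refl (≤-trans (s≤s n≤) (≤-reflexive (trans (sym (*-suc 3 (length ds))) (cong (λ n → 3 * suc n) (sym (List.length-map proj₁ ds))))))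
          (step safe (seek-view h) ρ) s h′
        where
        seek-view : verdict q ≡ just true → tv (image u seen q I V [] ((b , l) ∷ ds)) ≡ det (T.config (q , s₁) I V (choiceTape (b ∷ u) (l ∷ false ∷ encodeDown ds)))
        seek-view h = hold-view (q , sim nothing seen) q (s₁ , right) I V (choiceTape u (b ∷ l ∷ false ∷ encodeDown ds)) (cong (λ h → finish h nothing seen) h)
          (cong (λ h → simulate h q nothing seen (List.head (drop (address I) (encode x k))) (Tape.current I) (Vec.map Tape.current V)) h)
      by seen true h ((b′ , false) ∷ as) ((b , l) ∷ ds) (inside _ (more f)) safe r
        with n , d , n≤ , ρ , s , h′ ← Controlled.run-seek q I V _ r _ (encode-bound u ((b′ , false) ∷ as) ((b , l) ∷ ds) (≤-reflexive (sym (+-suc (length (encodeUp u ((b′ , false) ∷ as))) _)))) (encodeUp u ((b′ , false) ∷ as)) f refl =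
        accepts refl refl (≤-trans (s≤s n≤) (≤-trans (≤-reflexive (trans (sym (*-suc 3 (length ds))) (cong (λ n → 3 * suc n) (sym (List.length-map proj₁ ds)))))
          (*-monoʳ-≤ 3 (m≤n+m _ (suc (length (List.map proj₁ as)))))))
          (step safe (seek-view h) ρ) s h′
        where
        U = encodeUp u ((b′ , false) ∷ as)
        seek-view : verdict q ≡ just true → tv (image u seen q I V ((b′ , false) ∷ as) ((b , l) ∷ ds)) ≡
          det (T.config (q , s₁) I V (choiceTape (b ∷ U) (l ∷ false ∷ encodeDown ds)))
        seek-view h = hold-view (q , sim (just (b′ , false)) seen) q (s₁ , right) I V (choiceTape U (b ∷ l ∷ false ∷ encodeDown ds)) (cong (λ h → finish h (just (b′ , false)) seen) h)
          (cong (λ h → simulate h q (just (b′ , false)) seen (List.head (drop (address I) (encode x k))) (Tape.current I) (Vec.map Tape.current V)) h)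

-- The language of the tidy machine

module TidyLanguage (M : Machine) (x : Word) (k : ℕ) where

  open Machine M
  open Instruction
  open Tidy M
  open TidyRuns M x k
  open TidyCorrect M x k
  open Semantics M x k hiding (act)
  open Paths M x k using (view-halt; halt-view; view-step)

  private
    v  = view M x k
    tv = view tidy x k

  allowed-fresh : ∀ s bs → s ≢ seen → Allowed (mark (null bs) s) bs
  allowed-fresh untouched []       h = refl
  allowed-fresh untouched (_ ∷ _)  h = λ ()
  allowed-fresh unseen    []       h = refl
  allowed-fresh unseen    (_ ∷ _)  h = λ ()
  allowed-fresh seen      bs       h = contradiction refl h

  -- The flag is forced to be the truth: a premature flag forbids the bits that follow, and a
  -- missing one demands a further bit. Hence each accepted word of `M` has exactly one accepted
  -- expansion.
  null-fresh : ∀ s l bs → s ≢ seen → Allowed (mark l s) bs → l ≡ null bs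
  null-fresh s         true  []      h a = refl
  null-fresh untouched false []      h a = contradiction refl a
  null-fresh unseen    false []      h a = contradiction refl a
  null-fresh seen      l     bs      h a = contradiction refl h
  null-fresh untouched false (_ ∷ _) h a = refl
  null-fresh unseen    false (_ ∷ _) h a = refl

  allowed-∷ : ∀ s b bs → s ≢ seen → Allowed s (b ∷ bs)
  allowed-∷ untouched b bs h = tt
  allowed-∷ unseen    b bs h = λ ()
  allowed-∷ seen      b bs h = contradiction refl h

  module _ {u : List Bool} (base : Base u) where

    acc→ : ∀ {s d c bs} → Simulates u s d c → Reach v initial c → Allowed s bs → Acc v c bs → Acc tv d (expand bs)
    acc→ S r a (done e) with halt-outcome S r e
    ... | accepts _ _ _ ρ _ h = run-acc ρ (done h)
    ... | rejects n _         = contradiction a (n refl)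
    acc→ S r a (det e p) with _ , _ , _ , ρ , S′ ← det-outcome base S r e = run-acc ρ (acc→ S′ (reach-det r e) a p)
    acc→ {s} S r a (branch {ws = bs} e b p) with branch-outcome S r e
    ... | dead refl _ _ _ with () ← a
    ... | fresh h e₁ e₂ e₃ _ e₅ =
      branch e₁ b (branch (proj₂ (e₂ b)) (null bs) (branch (proj₂ (e₃ b (null bs))) false
        (det (proj₁ (proj₂ (e₅ b (null bs))))
          (acc→ (proj₂ (proj₂ (e₅ b (null bs)))) (reach-branch r e b) (allowed-fresh s bs h) p))))

    acc← : ∀ N {s d c ws} → Simulates u s d c → Reach v initial c → (p : Acc tv d ws) → len p ≤ N →
      ∃[ bs ] ws ≡ expand bs × Allowed s bs × Acc v c bs
    acc← N {c = c} S r p l with v c in e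
    acc← N S r p l | halt b with halt-outcome S r e
    ... | rejects _ h = contradiction p (not-rejected h)
    ... | accepts refl a _ ρ _ h = [] , acc-halted h (proj₁ (acc-run ρ p)) , a , done e
    acc← N S r p l | det c′ with _ , _ , _ , ρ , S′ ← det-outcome base S r e with acc-run ρ p
    acc← zero    S r p l | det c′ | p′ , e′ with () ← ≤-trans (≤-reflexive (sym e′)) l
    acc← (suc N) S r p l | det c′ | p′ , e′
      with bs , refl , a , q ← acc← N S′ (reach-det r e) p′ (≤-trans (m≤n+m _ _) (≤-pred (≤-trans (≤-reflexive (sym e′)) l))) =
      bs , refl , a , det e q
    acc← N S r p l | branch f with branch-outcome S r e
    ... | dead _ h _ h′ = contradiction (proj₁ (acc-det h p)) (not-rejected h′)
    ... | fresh h e₁ e₂ e₃ e₄ e₅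
      with b , _ , refl , p₁ , n₁ ← acc-branch e₁ p
      with m , _ , refl , p₂ , n₂ ← acc-branch (proj₂ (e₂ b)) p₁
      with acc-branch (proj₂ (e₃ b m)) p₂
    ... | true , _ , refl , p₃ , n₃ = contradiction (proj₁ (acc-det (proj₁ (proj₂ (e₄ b m))) p₃)) (not-rejected (proj₂ (proj₂ (proj₂ (e₄ b m)))))
    acc← zero {s} S r p l | branch f | fresh h e₁ e₂ e₃ e₄ e₅ | false , _ , refl , p₃ , n₃ with () ← ≤-trans (≤-reflexive (sym n₁)) l
    acc← (suc N) {s} S r p l | branch f | fresh h e₁ e₂ e₃ e₄ e₅ | false , _ , refl , p₃ , n₃
      with p₄ , n₄ ← acc-det (proj₁ (proj₂ (e₅ b m))) p₃
      with bs , refl , a , q ← acc← N (proj₂ (proj₂ (e₅ b m))) (reach-branch r e b) p₄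
             (≤-trans (≤-trans (≤-trans (n≤1+n _) (≤-reflexive (sym n₄))) (≤-trans (n≤1+n _) (≤-trans (≤-reflexive (sym n₃)) (≤-trans (n≤1+n _) (≤-reflexive (sym n₂))))))
               (≤-pred (≤-trans (≤-reflexive (sym n₁)) l))) =
      b ∷ bs , cong (λ m → b ∷ m ∷ false ∷ expand bs) (null-fresh s m bs h a) , allowed-∷ s b bs h , branch e b q

    data Key (d : T.Config) : Set where
      sim  : ∀ {s c} → Simulates u s d c → Reach v initial c → Key d
      fork : ∀ {f} → Safe u d → tv d ≡ branch f → (∀ b → Key (f b)) → Key d
      move : ∀ {d′} → Safe u d → tv d ≡ det d′ → Key d′ → Key d
      stop : ∀ {b} → Safe u d → tv d ≡ halt b → Key d

    progress : ∀ {d} → Key d → Progress {v = tv} (Safe u) Key d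
    progress (fork s e h) = branches s e h
    progress (move s e h) = runs (step s e []) h
    progress (stop s e)   = halts s e
    progress (sim {c = c} S r) with v c in e
    ... | det c′ with _ , _ , _ , ρ , S′ ← det-outcome base S r e = runs ρ (sim S′ (reach-det r e))
    ... | branch f with branch-outcome S r e
    ...   | dead _ h s h′ = runs (step (simulates-safe S r) h []) (stop s h′)
    ...   | fresh h e₁ e₂ e₃ e₄ e₅ = branches (simulates-safe S r) e₁ λ b →
            fork (proj₁ (e₂ b)) (proj₂ (e₂ b)) λ l → fork (proj₁ (e₃ b l)) (proj₂ (e₃ b l)) (third b l)
      where
      third : ∀ b l e → Key _
      third b l true  = move (proj₁ (e₄ b l)) (proj₁ (proj₂ (e₄ b l))) (stop (proj₁ (proj₂ (proj₂ (e₄ b l)))) (proj₂ (proj₂ (proj₂ (e₄ b l)))))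
      third b l false = move (proj₁ (e₅ b l)) (proj₁ (proj₂ (e₅ b l))) (sim (proj₂ (proj₂ (e₅ b l))) (reach-branch r e b))
    progress (sim S r) | halt b with halt-outcome S r e
    ... | rejects _ h = halts (simulates-safe S r) h
    ... | accepts _ _ _ []            s h = halts s h
    ... | accepts _ _ _ (step p e′ ρ) s h = runs (step p e′ ρ) (stop s h)

    -- A step of `M` costs at most 8 steps, stepping back over a block being the most expensive; the
    -- final walk to the flagged block costs at most 3 for each of the `B` bits.
    within-tidy : ∀ {B} → (∀ {c} → Reach v initial c → bitsRead (choice c) ≤ B) →
      ∀ {n s d c} → Simulates u s d c → Reach v initial c → Within v n c → Within tv (8 * n + 3 * B) d
    within-tidy {B} bound {n} S r (halt e) with halt-outcome S r e
    ... | rejects _ h = halt h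
    ... | accepts _ _ n≤ ρ _ h = within-≤ (≤-trans (≤-trans (≤-reflexive (+-identityʳ _)) (≤-trans n≤ (*-monoʳ-≤ 3 (bound r)))) (m≤n+m _ (8 * n)))
      (run-within ρ (halt {n = 0} h))
    within-tidy {B} bound S r (det {n = n} e w) with _ , _ , m≤ , ρ , S′ ← det-outcome base S r e =
      within-≤ (≤-trans (+-monoˡ-≤ (8 * n + 3 * B) (s≤s m≤)) (≤-reflexive (grow n (3 * B))))
        (run-within ρ (within-tidy bound S′ (reach-det r e) w))
      where
      grow : ∀ n B → 8 + (8 * n + B) ≡ 8 * suc n + B
      grow = solve-∀
    within-tidy {B} bound S r (branch {n = n} e w) with branch-outcome S r e
    ... | dead _ h _ h′ = within-≤ (≤-trans (s≤s z≤n) (≤-reflexive (grow n (3 * B)))) (det {n = 0} h (halt h′))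
      where
      grow : ∀ n B → 8 + (8 * n + B) ≡ 8 * suc n + B
      grow = solve-∀
    ... | fresh h e₁ e₂ e₃ e₄ e₅ = within-≤ (≤-trans (m≤n+m _ 4) (≤-reflexive (grow n (3 * B))))
      (branch e₁ λ b → branch (proj₂ (e₂ b)) λ l → branch (proj₂ (e₃ b l)) (third b l))
      where
      grow : ∀ n B → 8 + (8 * n + B) ≡ 8 * suc n + B
      grow = solve-∀
      third : ∀ b l e → Within tv (1 + (8 * n + 3 * B)) _
      third b l true  = det (proj₁ (proj₂ (e₄ b l))) (halt (proj₂ (proj₂ (proj₂ (e₄ b l)))))
      third b l false = det (proj₁ (proj₂ (e₅ b l))) (within-tidy bound (proj₂ (proj₂ (e₅ b l))) (reach-branch r e b) (w b))

  Imaged : Q → Tape Bool → Works → ℕ → Config → Set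
  Imaged q I V n c = ∃[ q′ ] ∃[ I′ ] ∃[ V′ ] c ≡ erase q′ I′ V′ [] [] ×
    (∀ u → Run tv Any (image u untouched q I V [] []) n (image u untouched q′ I′ V′ [] []))

  -- On an unread tape a deterministic step leaves the choice head on the endmarker, and the tidy
  -- machine copies it by one step with `stay`. So the prefix is the same for every `u`, and a
  -- prefix run on the empty tape can be continued on any other.
  run-image : ∀ {q I V n c} → Run v Any (erase q I V [] []) n c → Imaged q I V n c
  run-image [] = _ , _ , _ , refl , λ _ → []
  run-image {q} {I} {V} {c = c} (step {t = c₁} {n = n} _ e r) = by (choiceMove i) refl (trans (sym (view-erase h)) e)
    where
    h = proj₁ (resolve-det (verdict q) (advance (erase q I V [] [])) (moved (choiceMove (instruction (erase q I V [] []))) unread) e)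
    i = instr q I V []
    go : ∀ m → launch m nothing untouched ≡ (sim nothing untouched , stay) → m ≡ choiceMove i →
      Run v Any (erase (next i) (index′ i I) (work′ i V) [] []) n c → Imaged q I V (suc n) c
    go m l e′ r with q′ , I′ , V′ , c≡ , ρ ← run-image r = q′ , I′ , V′ , c≡ , λ u →
      step tt (trans (view-image {ups = []} {t = choiceTape u []} h)
        (cong (λ p → mapView (T.config (next i , proj₁ p) (index′ i I) (work′ i V)) (moved (proj₂ p) (choiceTape u [])))
          (trans (cong (λ m → launch m nothing untouched) (sym e′)) l))) (ρ u)
    by : ∀ m → m ≡ choiceMove i → mapView (config (next i) (index′ i I) (work′ i V)) (moved m unread) ≡ det c₁ → Imaged q I V (suc n) c
    by left e′ refl = go left refl e′ r
    by stay e′ refl = go stay refl e′ r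

-- What the composition of two machines needs to know about each of them: it may
-- be started with any choice tape on which it takes the scanned cell for the
-- endmarker.
record Good (C : Class) (F : ParamFun) : Set₁ where
  field
    M : Machine

  open Machine M public using (Q)

  v : ∀ x k → Semantics.Config M x k → View (Semantics.Config M x k)
  v = view M

  field
    spaceBound : Σ[ f ∈ (ℕ → ℕ) ] Computable f × (∃[ a ] (∀ x k {u c} → Base u → Reach (v x k) (initialOn M x k u) c →
                   Semantics.space M x k c ≤ a * (log (length x) + f k) ×
                   size (Semantics.Config.index c) ≤ a * log (length (encode x k))))
    bitBound   : Σ[ h ∈ (ℕ → ℕ) ] Computable h × (∀ x k {u c} → Base u → Reach (v x k) (initialOn M x k u) c →
                   bitsRead (Semantics.Config.choice c) ≤ length u + h k * log (length x))
    at-end     : ∀ x k {u c} → Base u → Reach (v x k) (initialOn M x k u) c → v x k c ≡ halt true →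
                   ChoiceTape.beyond (Semantics.Config.choice c) ≡ []
    language   : ∀ x k {u} → Base u → ∀ ws → Acc (v x k) (initialOn M x k u) ws ⇔ Acc (v x k) (initialOn M x k []) ws
    count      : ∀ x k → Fin (F x k) ↔ (∃[ ws ] Acc (v x k) (initialOn M x k []) ws)
    paused     : ∀ x k → List Bool → Semantics.Config M x k
    paused-run : ∀ x k → ∃[ n ] (∀ u → Run (v x k) Any (initialOn M x k u) n (paused x k u))
    paused-on  : ∀ x k u → paused x k u ≡ record (paused x k []) { choice = choiceTape u [] }
    -- Either halted or about to reveal its first bit; this is how the composite recognises the end
    -- of a prefix.
    paused-at  : ∀ x k → (∃[ b ] Machine.verdict M (Semantics.Config.state (paused x k [])) ≡ just b) ⊎
                   (∀ u → Machine.verdict M (Semantics.Config.state (paused x k u)) ≡ nothing ×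
                          Instruction.choiceMove (Semantics.instruction M x k (paused x k u)) ≡ right)
    restriction : Both C
      (∀ x k {u c} → Base u → Reach (v x k) (initialOn M x k u) c →
        Machine.verdict M (Semantics.Config.state c) ≡ nothing →
        Instruction.choiceMove (Semantics.instruction M x k c) ≢ left)
      (Σ[ g ∈ (ℕ → ℕ) ] Computable g × (∀ x k {u} → Base u → Within (v x k) (g k * log (length x)) (paused x k u)))

-- From a halting prefix to a machine that can be composed

module TidyClass {C : Class} {F : ParamFun} (P : Prefixed C F) where

  open Prefixed P
  open Tidy M

  module _ (x : Word) (k : ℕ) where

    open TidyRuns M x k using (Safe; Simulates; simulates; image; erase; view-image; instr) public
    open TidyLanguage M x k public

    initially : ∀ {u} → Simulates u untouched (initialOn tidy x k u) (initialOn M x k [])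
    initially = simulates (at-base none)

    source-path : ∀ {c} → Reach (view M x k) (initialOn M x k []) c → Semantics._⟶*_ M x k (Semantics.initial M x k) c
    source-path = Paths.reach→path M x k

    safe-on : ∀ {u d} → Base u → Reach (view tidy x k) (initialOn tidy x k u) d → Safe u d
    safe-on base = safe (progress base) (sim initially here)

    expanded : ∀ {u} → Base u → ∀ ws → Acc (view tidy x k) (initialOn tidy x k u) ws ⇔
      (∃[ bs ] ws ≡ expand bs × Acc (view M x k) (initialOn M x k []) bs)
    expanded base ws = mk⇔
      (λ p → let bs , e , _ , q = acc← base _ initially here p ≤-refl in bs , e , q)
      (λ { (bs , refl , q) → acc→ base initially here tt q })

    words-tidy : (∃[ bs ] Acc (view M x k) (initialOn M x k []) bs) ↔ (∃[ ws ] Acc (view tidy x k) (initialOn tidy x k []) ws)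
    words-tidy = mk↔ₛ′
      (λ (bs , a) → expand bs , Equivalence.from (expanded bare (expand bs)) (bs , refl , a))
      (λ (ws , a) → let bs , _ , q = Equivalence.to (expanded bare ws) a in bs , q)
      (λ (ws , a) → same (sym (proj₁ (proj₂ (Equivalence.to (expanded bare ws) a)))))
      (λ (bs , a) → same (expand-injective _ _ (sym (proj₁ (proj₂ (Equivalence.to (expanded bare (expand bs))
        (Equivalence.from (expanded bare (expand bs)) (bs , refl , a))))))))
      where
      same : ∀ {S : Set} {v : S → View S} {s} {(ws , a) (ws′ , a′) : ∃[ ws ] Acc v s ws} → ws ≡ ws′ → (ws , a) ≡ (ws′ , a′)
      same refl = cong (_ ,_) (acc-unique _ _)

    private
      final = proj₁ (proj₂ (prefix x k))
      imaged = run-image (proj₁ (proj₂ (proj₂ (prefix x k))))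
      q′ = proj₁ imaged
      I′ = proj₁ (proj₂ imaged)
      V′ = proj₁ (proj₂ (proj₂ imaged))
    paused-source : Semantics.Config M x k
    paused-source = erase q′ I′ V′ [] []

    final≡ : final ≡ paused-source
    final≡ = proj₁ (proj₂ (proj₂ (proj₂ imaged)))

    paused-tidy : List Bool → Semantics.Config tidy x k
    paused-tidy u = image u untouched q′ I′ V′ [] []

    paused-run-tidy : ∃[ n ] (∀ u → Run (view tidy x k) Any (initialOn tidy x k u) n (paused-tidy u))
    paused-run-tidy = _ , proj₂ (proj₂ (proj₂ (proj₂ imaged)))

    paused-reached : Reach (view M x k) (initialOn M x k []) paused-source
    paused-reached = subst (Reach _ _) final≡ (run-reach (proj₁ (proj₂ (proj₂ (prefix x k)))) here)

    paused-run-source : Run (view M x k) Any (initialOn M x k []) (proj₁ (prefix x k)) paused-source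
    paused-run-source = subst (Run (view M x k) Any (initialOn M x k []) _) final≡ (proj₁ (proj₂ (proj₂ (prefix x k))))

    PausedAt : Set
    PausedAt = (∃[ b ] verdict′ (Semantics.Config.state (paused-tidy [])) ≡ just b) ⊎
      (∀ u → verdict′ (Semantics.Config.state (paused-tidy u)) ≡ nothing ×
             Instruction.choiceMove (Semantics.instruction tidy x k (paused-tidy u)) ≡ right)

    paused-at-tidy : PausedAt
    paused-at-tidy = by (view M x k paused-source) refl
      where
      open Machine M using (verdict)
      open Semantics M x k using (instruction; advance)
      stuck : Stuck (view M x k) paused-source
      stuck {t} = subst (λ c → ∀ {t} → view M x k c ≢ det t) final≡ (proj₂ (proj₂ (proj₂ (prefix x k)))) {t}
      halted : ∀ b → finish (just b) nothing untouched ≡ just b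
      halted true  = refl
      halted false = refl
      by : ∀ w → view M x k paused-source ≡ w → PausedAt
      by (halt b) e = inj₁ (b , trans (cong (λ h → finish h nothing untouched) (Paths.halt-view M x k e)) (halted b))
      by (det _)  e = contradiction e stuck
      by (branch f) e
        with h , g , m , _ ← resolve-branch (verdict q′) (advance paused-source)
               (moved (Instruction.choiceMove (instruction paused-source)) unread) e =
        inj₂ λ u → cong (λ h → finish h nothing untouched) h , rights {u} h _ refl (only-right _ m)
        where
        only-right : ∀ m {g} → moved m unread ≡ branch g → m ≡ right
        only-right right refl = refl
        rights : ∀ {u} → verdict q′ ≡ nothing → ∀ i → i ≡ Instruction.choiceMove (instr q′ I′ V′ []) → i ≡ right →
          Instruction.choiceMove (Semantics.instruction tidy x k (paused-tidy u)) ≡ right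
        rights h _ e refl = trans (cong (λ h → Instruction.choiceMove (simulate h q′ nothing untouched
            (List.head (drop (address I′) (encode x k))) (Tape.current I′) (Vec.map Tape.current V′))) h)
          (cong (λ m → proj₂ (launch m nothing untouched)) (sym e))

  tidy-left : ReadOnce M → ∀ x k {u c} → Base u → Reach (view tidy x k) (initialOn tidy x k u) c →
    verdict′ (Semantics.Config.state c) ≡ nothing → Instruction.choiceMove (Semantics.instruction tidy x k c) ≢ left
  tidy-left once x k base r h l with c , r′ , h′ , l′ ← Safe.left-only (safe-on x k base r) h l =
    once x k (source-path x k r′) h′ l′

  tidy-tail : TailNondeterministic M → Σ[ g ∈ (ℕ → ℕ) ] Computable g ×
    (∀ x k {u} → Base u → Within (view tidy x k) (g k * log (length x)) (paused-tidy x k u))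
  tidy-tail t@(g , cg , _) with h , ch , bits ← kBounded =
    -- `1 + g` includes the branching step at the paused configuration, and `h` bounds the bits
    -- passed by the final walk.
    (λ k → 8 * (1 + g k) + 3 * h k) ,
    computable-+ (computable-* 8 (computable-+ (computable-const 1) cg)) (computable-* 3 ch) , λ x k {u} base →
      within-≤ (≤-reflexive (collect (1 + g k) (h k) (log (length x))))
        (within-tidy x k base (λ r → bits x k (source-path x k r)) (simulates {u = u} (at-base none)) (paused-reached x k) (source x k))
    where
    collect : ∀ g h l → 8 * (g * l) + 3 * (h * l) ≡ (8 * g + 3 * h) * l
    collect = solve-∀
    source : ∀ x k → Within (view M x k) ((1 + g k) * log (length x)) (paused-source x k)
    source x k = by (view M x k (paused-source x k)) refl
      where
      by : ∀ w → view M x k (paused-source x k) ≡ w → Within (view M x k) ((1 + g k) * log (length x)) (paused-source x k)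
      by (halt b)   e = halt e
      by (det _)    e = contradiction e (subst (λ c → ∀ {t} → view M x k c ≢ det t) (final≡ x k) (proj₂ (proj₂ (proj₂ (prefix x k)))))
      by (branch f) e = within-≤ (+-monoˡ-≤ (g k * log (length x)) (1≤log (length x)))
        (branch e (tail→within t x k (paused-run-source x k) e))

  good : Good C F
  good = record
    { M = tidy
    ; spaceBound = let f , cf , a , bound = paraL in f , cf , a , λ x k base r →
        let s = safe-on x k base r ; b = bound x k (source-path x k (Safe.reached s)) in
        subst₂ (λ I V → size I + sizes V ≤ a * (log (length x) + f k)) (sym (Safe.index-≡ s)) (sym (Safe.work-≡ s)) (proj₁ b) ,
        subst (λ I → size I ≤ a * log (length (encode x k))) (sym (Safe.index-≡ s)) (proj₂ b)
    ; bitBound = let h , ch , bound = kBounded in (λ k → 3 * h k) , computable-* 3 ch , λ x k {u} base r →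
        let s = safe-on x k base r in ≤-trans (Safe.bits-≤ s) (+-monoʳ-≤ (length u)
          (≤-trans (*-monoʳ-≤ 3 (bound x k (source-path x k (Safe.reached s)))) (≤-reflexive (sym (*-assoc 3 (h k) _)))))
    ; at-end = λ x k {u} {c} base r e → Safe.accept-end (safe-on x k base r) (Paths.halt-view tidy x k {c} e)
    ; language = λ x k base ws → mk⇔
        (λ p → Equivalence.from (expanded x k bare ws) (Equivalence.to (expanded x k base ws) p))
        (λ p → Equivalence.from (expanded x k base ws) (Equivalence.to (expanded x k bare ws) p))
    ; count = λ x k → ↔-trans (Paths.count→ M x k (counts x k)) (words-tidy x k)
    ; paused = paused-tidy
    ; paused-run = paused-run-tidy
    ; paused-on = λ _ _ _ → refl
    ; paused-at = paused-at-tidy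
    ; restriction = both-map tidy-left tidy-tail C (restriction→both {M} C restriction)
    }

-- The dual tape of the composite machine: below each index cell a shadow cell
-- records whether it is leftmost, whether the head of the suspended machine is
-- here, and the content of the index cell of the suspended machine.

Shadow : Set
Shadow = Bool × Bool × Bool

Cell₂ : Set
Cell₂ = Bool × Maybe Shadow

blank₀ : Cell₂
blank₀ = false , nothing

norm : Maybe Shadow → Shadow
norm nothing  = false , false , false
norm (just s) = s

swap : Cell₂ → Cell₂
swap (b , s) = proj₂ (proj₂ (norm s)) , just (proj₁ (norm s) , proj₁ (proj₂ (norm s)) , b)

track : Tape Cell₂ → List Shadow
track t = List.map (norm ∘ proj₂) (cells t)

-- Visited cells from the head to the left end.
data Left : List Cell₂ → Set where
  first : ∀ {b m v} → Left ((b , just (true , m , v)) ∷ [])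
  more  : ∀ {b m v cs} → Left cs → Left ((b , just (false , m , v)) ∷ cs)

data Right : List Cell₂ → Set where
  []   : Right []
  more : ∀ {b m v cs} → Right cs → Right ((b , just (false , m , v)) ∷ cs)

-- The shadow `nothing` means that the cell has not been visited. It occurs only under a head just
-- beyond the visited cells, and so tells a sweep where to turn.
data Wellformed : Tape Cell₂ → Set where
  inside : ∀ {ls c rs} → Left (c ∷ ls) → Right rs → Wellformed (tape ls c rs)
  edge   : ∀ {ls} → Left ls → Wellformed (tape ls blank₀ [])

-- Every simulated step writes a proper shadow, so that leaving a cell makes it visited without
-- altering the suspended tape.
revisiting : Tape Cell₂ → Bool → Cell₂
revisiting t b = b , just (norm (proj₂ (Tape.current t)))

wellformed-act : ∀ b m t → Wellformed t → Wellformed (act blank₀ (revisiting t b , m) t)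
wellformed-act b m _ (edge {[]} ())
wellformed-act b left  _ (edge {l ∷ ls} h) = inside h (more [])
wellformed-act b stay  _ (edge {l ∷ ls} h) = inside (more h) []
wellformed-act b right _ (edge {l ∷ ls} h) = edge (more h)
wellformed-act b left  _ (inside {[]}     first r)      = inside first r
wellformed-act b left  _ (inside {_ ∷ _}  (more h) r)   = inside h (more r)
wellformed-act b stay  _ (inside first r)               = inside first r
wellformed-act b stay  _ (inside (more h) r)            = inside (more h) r
wellformed-act b right _ (inside first [])              = edge first
wellformed-act b right _ (inside (more h) [])           = edge (more h)
wellformed-act b right _ (inside first (more r))        = inside (more first) r
wellformed-act b right _ (inside (more h) (more r))     = inside (more (more h)) r

map-write : ∀ {A B : Set} (f : A → B) a t → f a ≡ f (Tape.current t) → List.map f (cells (write a t)) ≡ List.map f (cells t)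
map-write f a t e = trans (List.map-++ f (reverse (Tape.before t)) _)
  (trans (cong (λ b → List.map f (reverse (Tape.before t)) ++ b ∷ List.map f (Tape.after t)) e)
    (sym (List.map-++ f (reverse (Tape.before t)) _)))

track-act : ∀ b m t → let t′ = act blank₀ (revisiting t b , m) t in
  track t′ ≡ track t ⊎ track t′ ≡ track t ++ (false , false , false) ∷ []
track-act b m t with cells-shift blank₀ m (write (revisiting t b) t)
... | inj₁ e       = inj₁ (trans (cong (List.map _) e) (map-write (norm ∘ proj₂) _ t refl))
... | inj₂ (e , _) = inj₂ (trans (cong (List.map _) e) (trans (List.map-++ (norm ∘ proj₂) (cells (write (revisiting t b) t)) _)
  (cong (_++ _) (map-write (norm ∘ proj₂) _ t refl))))

-- After an exchange the index tape may be longer than that of the simulated machine. The excess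
-- consists of zeros on the right, which neither the address nor the head can tell from blank tape.
data _⊒_ : Tape Bool → Tape Bool → Set where
  padded : ∀ {ls a rs} p → tape ls a (rs ++ replicate p false) ⊒ tape ls a rs

⊒-current : ∀ {s t} → s ⊒ t → Tape.current s ≡ Tape.current t
⊒-current (padded p) = refl

⊒-address : ∀ {s t} → s ⊒ t → address s ≡ address t
⊒-address {s} {t} (padded {ls} {a} {rs} p) = address-padded s t p (sym (List.++-assoc (reverse ls) (a ∷ rs) _))

⊒-act : ∀ b m {s t} → s ⊒ t → act false (b , m) s ⊒ act false (b , m) t
⊒-act b left  (padded {[]}     p)              = padded p
⊒-act b left  (padded {_ ∷ _}  p)              = padded p
⊒-act b stay  (padded p)                       = padded p
⊒-act b right (padded {rs = []}     zero)      = padded 0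
⊒-act b right (padded {rs = []}     (suc p))   = padded p
⊒-act b right (padded {rs = _ ∷ _}  p)         = padded p

-- The padding is used up before the tape is lengthened, so excess and growth combine to a maximum
-- instead of a sum.
size-act-⊒ : ∀ b m {s t} → s ⊒ t → size (act false (b , m) s) ≤ size s ⊔ size (act false (b , m) t)
size-act-⊒ b left  {s} {t} (padded {[]}    p) = ≤-trans (≤-reflexive (size-write b s)) (m≤m⊔n (size s) (size (act false (b , left) t)))
size-act-⊒ b left  {s} {t} (padded {l ∷ ls} {a} {rs} p) = ≤-trans (≤-reflexive (trans
  (size-length (tape ls l (b ∷ rs ++ replicate p false)))
  (trans (+-suc (length ls) _) (sym (size-length s))))) (m≤m⊔n (size s) (size (act false (b , left) t)))
size-act-⊒ b stay  {s} {t} (padded p) = ≤-trans (≤-reflexive (size-write b s)) (m≤m⊔n (size s) (size (act false (b , stay) t)))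
size-act-⊒ b right {s} {t} (padded {rs = []} zero) = m≤n⊔m (size s) (size (act false (b , right) t))
size-act-⊒ b right {s} {t} (padded {ls} {rs = []} (suc p)) = ≤-trans (≤-reflexive (trans
  (size-length (tape (b ∷ ls) false (replicate p false)))
  (trans (sym (+-suc (length ls) _)) (sym (size-length s))))) (m≤m⊔n (size s) (size (act false (b , right) t)))
size-act-⊒ b right {s} {t} (padded {ls} {rs = r ∷ rs} p) = ≤-trans (≤-reflexive (trans
  (size-length (tape (b ∷ ls) r (rs ++ replicate p false)))
  (trans (sym (+-suc (length ls) _)) (sym (size-length s))))) (m≤m⊔n (size s) (size (act false (b , right) t)))

-- The tape t is kept in the shadow: the second component marks its head and the
-- third one is its content.
record Saved (t : Tape Bool) (ss : List Shadow) : Set where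
  field
    {ls rs}  : List Shadow
    {lm}     : Bool
    {pad}    : ℕ
    split    : ss ≡ ls ++ (lm , true , Tape.current t) ∷ rs
    unmarked : All (λ s → proj₁ (proj₂ s) ≡ false) ls
    left-≡   : List.map (proj₂ ∘ proj₂) ls ≡ reverse (Tape.before t)
    right-≡  : List.map (proj₂ ∘ proj₂) rs ≡ Tape.after t ++ replicate pad false

replicate-∷ʳ : ∀ {A : Set} n (a : A) → replicate n a ++ a ∷ [] ≡ a ∷ replicate n a
replicate-∷ʳ zero    a = refl
replicate-∷ʳ (suc n) a = cong (a ∷_) (replicate-∷ʳ n a)

saved-++ : ∀ {t ss} → Saved t ss → Saved t (ss ++ (false , false , false) ∷ [])
saved-++ {t} s = record
  { pad = suc pad ; split = trans (cong (_++ _) split) (List.++-assoc ls _ _) ; unmarked = unmarked ; left-≡ = left-≡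
  ; right-≡ = trans (List.map-++ _ rs _) (trans (cong (_++ _) right-≡) (trans (List.++-assoc (Tape.after t) _ _)
      (cong (Tape.after t ++_) (replicate-∷ʳ pad false)))) }
  where open Saved s

saved-act : ∀ {s} b m t → Saved s (track t) → Saved s (track (act blank₀ (revisiting t b , m) t))
saved-act b m t h with track-act b m t
... | inj₁ e = subst (Saved _) (sym e) h
... | inj₂ e = subst (Saved _) (sym e) (saved-++ h)

-- The shadow before anything is saved. Its zeros become the blank index tape on which the first
-- machine starts.
Clean : List Shadow → Set
Clean = All (λ s → proj₂ s ≡ (false , false))

clean-act : ∀ b m t → Clean (track t) → Clean (track (act blank₀ (revisiting t b , m) t))
clean-act b m t h with track-act b m t
... | inj₁ e = subst Clean (sym e) h
... | inj₂ e = subst Clean (sym e) (All.++⁺ h (refl ∷ []))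

-- Exchanging the index tape with its shadow

pending : Tape Cell₂ → List Cell₂
pending (tape ls (_ , nothing)    rs) = ls
pending (tape ls c@(_ , just _)   rs) = rs List.ʳ++ (c ∷ ls)

flat : List Cell₂ → Tape Cell₂
flat []       = blankTape blank₀
flat (c ∷ cs) = tape [] c cs

-- `pending` lists the cells from right to left, in the order in which they are exchanged, and `ʳ++`
-- turns them round again. The blank on which the sweep turns becomes a visited cell, so an exchange
-- may lengthen the tape by one; if the head was already on it, the size is unchanged.
swept : Tape Cell₂ → Tape Cell₂
swept t = flat (List.map swap (pending t) List.ʳ++ (swap blank₀ ∷ []))

left-ʳ++ : ∀ {ls rs} → Left ls → Right rs → Left (rs List.ʳ++ ls)
left-ʳ++ h []       = h
left-ʳ++ h (more r) = left-ʳ++ (more h) r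

left-pending : ∀ {t} → Wellformed t → Left (pending t)
left-pending (edge h)               = h
left-pending (inside first r)       = left-ʳ++ first r
left-pending (inside (more h) r)    = left-ʳ++ (more h) r

wellformed-flat : ∀ {ls rs} → Left ls → Right rs → Wellformed (flat (List.map swap ls List.ʳ++ rs))
wellformed-flat first    r = inside first r
wellformed-flat (more h) r = wellformed-flat h (more r)

wellformed-swept : ∀ {t} → Wellformed t → Wellformed (swept t)
wellformed-swept h = wellformed-flat (left-pending h) (more [])

flat-cells : ∀ cs → cs ≢ [] → cells (flat cs) ≡ cs
flat-cells []       h = contradiction refl h
flat-cells (c ∷ cs) h = refl

sweep-list : Tape Cell₂ → List Cell₂
sweep-list z = List.map swap (pending z) List.ʳ++ (swap blank₀ ∷ [])

cells-swept : ∀ z → cells (swept z) ≡ sweep-list z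
cells-swept z = flat-cells _ λ e → contradiction
  (trans (sym (cong length e)) (trans (cong length (List.ʳ++-defn (List.map swap (pending z))))
    (trans (List.length-++ (reverse (List.map swap (pending z)))) (+-comm _ 1)))) λ ()

swept-cells : ∀ {t} → Wellformed t → ∃[ n ] n ≤ 1 × cells (swept t) ≡ List.map swap (cells t) ++ replicate n (swap blank₀)
swept-cells {t} h = by h (trans (cells-swept t) (List.ʳ++-defn (List.map swap (pending t))))
  where
  whole : ∀ ls c rs → cells (swept t) ≡ reverse (List.map swap (rs List.ʳ++ (c ∷ ls))) ++ swap blank₀ ∷ [] →
    cells (swept t) ≡ List.map swap (reverse ls ++ c ∷ rs) ++ swap blank₀ ∷ []
  whole ls c rs e = trans e (cong (_++ _) (trans (sym (List.reverse-map swap (rs List.ʳ++ (c ∷ ls))))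
    (cong (List.map swap) (trans (cong reverse (List.ʳ++-defn rs)) (trans (List.reverse-++ (reverse rs) (c ∷ ls))
      (trans (cong₂ _++_ (List.unfold-reverse c ls) (List.reverse-involutive rs)) (List.++-assoc (reverse ls) _ _)))))))
  by : Wellformed t → cells (swept t) ≡ reverse (List.map swap (pending t)) ++ swap blank₀ ∷ [] →
    ∃[ n ] n ≤ 1 × cells (swept t) ≡ List.map swap (cells t) ++ replicate n (swap blank₀)
  by (edge {ls} h) e = 0 , z≤n , trans e (sym (trans (List.++-identityʳ _)
    (trans (List.map-++ swap (reverse ls) _) (cong (_++ _) (List.reverse-map swap ls)))))
  by (inside {ls} {c} {rs} first r)    e = 1 , ≤-refl , whole ls c rs e
  by (inside {ls} {c} {rs} (more h) r) e = 1 , ≤-refl , whole ls c rs e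

point : List Cell₂ → Cell₂ → List Cell₂ → List Cell₂ → Tape Cell₂
point ls c []       rs = tape ls c rs
point ls c (u ∷ us) rs = tape ls u (us ++ c ∷ rs)

flat-point : ∀ us c rs → flat (us ++ c ∷ rs) ≡ point [] c us rs
flat-point []      c rs = refl
flat-point (_ ∷ _) c rs = refl

⊒-split : ∀ {s t} → s ⊒ t → Tape.before s ≡ Tape.before t × Tape.current s ≡ Tape.current t ×
  (∃[ p ] Tape.after s ≡ Tape.after t ++ replicate p false)
⊒-split (padded p) = refl , refl , p , refl

⊒-join : ∀ {s t} p → Tape.before s ≡ Tape.before t → Tape.current s ≡ Tape.current t →
  Tape.after s ≡ Tape.after t ++ replicate p false → s ⊒ t
⊒-join p refl refl refl = padded p

map-split : ∀ {A B : Set} (f : A → B) as {bs b cs} → List.map f as ≡ bs ++ b ∷ cs →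
  ∃[ as₁ ] ∃[ a ] ∃[ as₂ ] as ≡ as₁ ++ a ∷ as₂ × List.map f as₁ ≡ bs × f a ≡ b × List.map f as₂ ≡ cs
map-split f (a ∷ as) {[]} refl = [] , a , as , refl , refl , refl , refl
map-split f (a ∷ as) {b ∷ bs} e with refl , e′ ← List.∷-injective e
  with as₁ , a′ , as₂ , p , q , r , s ← map-split f as {bs} e′ = a ∷ as₁ , a′ , as₂ , cong (a ∷_) p , cong (_ ∷_) q , r , s

all-false : ∀ bs → All (_≡ false) bs → bs ≡ replicate (length bs) false
all-false []       []         = refl
all-false (_ ∷ bs) (refl ∷ h) = cong (false ∷_) (all-false bs h)

flat-⊒-blank : ∀ cs → All (_≡ false) (List.map proj₁ (cells (flat cs))) → mapTape proj₁ (flat cs) ⊒ blankTape false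
flat-⊒-blank []       _       = padded 0
flat-⊒-blank (c ∷ cs) (e ∷ h) = ⊒-join (length (List.map proj₁ cs)) refl e (all-false (List.map proj₁ cs) h)

swept-size : ∀ {z} → Wellformed z → size (swept z) ≤ suc (size z)
swept-size {z} h with n , n≤ , e ← swept-cells h = ≤-trans (≤-reflexive (trans (cong length e)
  (trans (List.length-++ (List.map swap (cells z))) (cong₂ _+_ (List.length-map swap (cells z)) (List.length-replicate n)))))
  (≤-trans (+-monoʳ-≤ (size z) n≤) (≤-reflexive (+-comm (size z) 1)))

swept-⊒-blank : ∀ {z} → Wellformed z → All (λ s → proj₂ (proj₂ s) ≡ false) (track z) → mapTape proj₁ (swept z) ⊒ blankTape false
swept-⊒-blank {z} h a with n , _ , e ← swept-cells h = flat-⊒-blank (List.map swap (pending z) List.ʳ++ (swap blank₀ ∷ []))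
  (subst (All (_≡ false)) (sym (trans (cong (List.map proj₁) e) (List.map-++ proj₁ (List.map swap (cells z)) _)))
    (All.++⁺ (shadows (cells z) a) (blanks n)))
  where
  shadows : ∀ cs → All (λ s → proj₂ (proj₂ s) ≡ false) (List.map (norm ∘ proj₂) cs) → All (_≡ false) (List.map proj₁ (List.map swap cs))
  shadows []       []      = []
  shadows (_ ∷ cs) (e ∷ h) = e ∷ shadows cs h
  blanks : ∀ n → All (_≡ false) (List.map proj₁ (replicate n (swap blank₀)))
  blanks zero    = []
  blanks (suc n) = refl ∷ blanks n

all-reverse : ∀ {A : Set} {P : A → Set} {as} → All P as → All P (reverse as)
all-reverse {P = P} h = go h []
  where
  go : ∀ {as bs} → All P as → All P bs → All P (as List.ʳ++ bs)
  go []      k = k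
  go (p ∷ h) k = go h (p ∷ k)

swept-saved : ∀ {ls b s v rs t} → let z = tape ls (b , just (s , true , v)) rs in Wellformed z →
  All (λ s → proj₁ (proj₂ s) ≡ false) (List.map (norm ∘ proj₂) ls) → mapTape proj₁ z ⊒ t → Saved t (track (swept z))
swept-saved {ls} {b} {s} {v} {rs} {t} h un c with n , _ , e ← swept-cells h | before≡ , refl , p , after≡ ← ⊒-split c = record
  { ls = List.map mark-of (reverse ls) ; rs = List.map mark-of rs ++ replicate n (false , false , false) ; pad = p + n
  ; split = trans (cong (List.map (norm ∘ proj₂)) e) (trans (List.map-++ (norm ∘ proj₂) (List.map swap (reverse ls ++ _ ∷ rs)) _)
      (trans (cong₂ _++_ (trans (sym (List.map-∘ (reverse ls ++ _ ∷ rs))) (List.map-++ mark-of (reverse ls) _)) (List.map-replicate (norm ∘ proj₂) n (swap blank₀)))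
        (List.++-assoc (List.map mark-of (reverse ls)) _ _)))
  ; unmarked = subst (All _) (sym (List.reverse-map mark-of ls)) (all-reverse (marks-of ls un))
  ; left-≡ = trans (sym (List.map-∘ (reverse ls))) (trans (List.reverse-map proj₁ ls) (cong reverse before≡))
  ; right-≡ = trans (List.map-++ (proj₂ ∘ proj₂) (List.map mark-of rs) _) (trans (cong₂ _++_ (trans (sym (List.map-∘ rs)) after≡) (List.map-replicate (proj₂ ∘ proj₂) n _))
      (trans (List.++-assoc (Tape.after t) _ _) (cong (Tape.after t ++_) (sym (replicate-++ p n)))))
  }
  where
  mark-of : Cell₂ → Shadow
  mark-of = norm ∘ proj₂ ∘ swap
  marks-of : ∀ cs → All (λ s → proj₁ (proj₂ s) ≡ false) (List.map (norm ∘ proj₂) cs) → All (λ s → proj₁ (proj₂ s) ≡ false) (List.map mark-of cs)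
  marks-of []       []      = []
  marks-of (_ ∷ cs) (e ∷ h) = e ∷ marks-of cs h
  replicate-++ : ∀ m n → replicate (m + n) false ≡ replicate m false ++ replicate n false
  replicate-++ zero    n = refl
  replicate-++ (suc m) n = cong (false ∷_) (replicate-++ m n)

-- The cells of the swept tape, split at the mark left by the suspended machine.
record Restored (t : Tape Bool) (z : Tape Cell₂) : Set where
  field
    us rs    : List Cell₂
    c        : Cell₂
    start    : swept z ≡ point [] c us rs
    unmarked : All (λ u → proj₁ (proj₂ (norm (proj₂ u))) ≡ false) us
    marked   : proj₁ (proj₂ (norm (proj₂ c))) ≡ true
    covers   : mapTape proj₁ (tape (us List.ʳ++ []) c rs) ⊒ t
    length-≡ : length us + suc (length rs) ≡ size (swept z)

-- An exchange acts cell by cell and leaves the marks in place, so the saved contents come back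
-- around the mark. What the first machine wrote ends up in the shadow, where it affects no further
-- step.
restored : ∀ {t z} → Wellformed z → Saved t (track z) → Restored t z
restored {t} {z} h s = build (swept-cells h) (map-split (norm ∘ proj₂) (cells z) (Saved.split s))
  where
  replicate-++ : ∀ m n → replicate (m + n) false ≡ replicate m false ++ replicate n false
  replicate-++ zero    n = refl
  replicate-++ (suc m) n = cong (false ∷_) (replicate-++ m n)
  contents : ∀ cs → List.map proj₁ (List.map swap cs) ≡ List.map (proj₂ ∘ proj₂) (List.map (norm ∘ proj₂) cs)
  contents cs = trans (sym (List.map-∘ cs)) (List.map-∘ cs)
  unmarks : ∀ cs → All (λ s → proj₁ (proj₂ s) ≡ false) (List.map (norm ∘ proj₂) cs) →
    All (λ u → proj₁ (proj₂ (norm (proj₂ u))) ≡ false) (List.map swap cs)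
  unmarks []       []      = []
  unmarks (_ ∷ cs) (e ∷ h) = e ∷ unmarks cs h
  build : (∃[ n ] n ≤ 1 × cells (swept z) ≡ List.map swap (cells z) ++ replicate n (swap blank₀)) →
    (∃[ as₁ ] ∃[ a ] ∃[ as₂ ] cells z ≡ as₁ ++ a ∷ as₂ × List.map (norm ∘ proj₂) as₁ ≡ Saved.ls s ×
      norm (proj₂ a) ≡ (Saved.lm s , true , Tape.current t) × List.map (norm ∘ proj₂) as₂ ≡ Saved.rs s) → Restored t z
  build (n , _ , e) (as₁ , a , as₂ , p , q , r , f) = record
    { us = us ; rs = rs ; c = swap a
    ; start = trans (cong flat whole) (flat-point us (swap a) rs)
    ; unmarked = unmarks as₁ (subst (All _) (sym q) (Saved.unmarked s))
    ; marked = cong (proj₁ ∘ proj₂) r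
    ; covers = ⊒-join (Saved.pad s + n)
        (trans (cong (List.map proj₁) (trans (List.ʳ++-defn us) (List.++-identityʳ _)))
          (trans (List.reverse-map proj₁ us) (trans (cong reverse lefts) (List.reverse-involutive (Tape.before t)))))
        (cong (proj₂ ∘ proj₂) r)
        (trans (List.map-++ proj₁ (List.map swap as₂) _) (trans (cong₂ _++_ rights (List.map-replicate proj₁ n (swap blank₀)))
          (trans (List.++-assoc (Tape.after t) _ _) (cong (Tape.after t ++_) (sym (replicate-++ (Saved.pad s) n))))))
    ; length-≡ = trans (sym (List.length-++ us)) (cong length (trans (sym whole) (sym (cells-swept z))))
    }
    where
    us = List.map swap as₁
    rs = List.map swap as₂ ++ replicate n (swap blank₀)
    whole : sweep-list z ≡ us ++ swap a ∷ rs
    whole = trans (sym (cells-swept z)) (trans e (trans (cong (λ cs → List.map swap cs ++ replicate n (swap blank₀)) p)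
      (trans (cong (_++ replicate n (swap blank₀)) (List.map-++ swap as₁ (a ∷ as₂))) (List.++-assoc us _ _))))
    lefts : List.map proj₁ us ≡ reverse (Tape.before t)
    lefts = trans (contents as₁) (trans (cong (List.map (proj₂ ∘ proj₂)) q) (Saved.left-≡ s))
    rights : List.map proj₁ (List.map swap as₂) ≡ Tape.after t ++ replicate (Saved.pad s) false
    rights = trans (contents as₂) (trans (cong (List.map (proj₂ ∘ proj₂)) f) (Saved.right-≡ s))

clean-parts : ∀ {ls c rs} → Clean (track (tape ls c rs)) →
  Clean (List.map (norm ∘ proj₂) ls) × proj₂ (norm (proj₂ c)) ≡ (false , false) × Clean (List.map (norm ∘ proj₂) rs)
clean-parts {ls} {c} {rs} h
  with p , q ∷ r ← All.++⁻ (List.map (norm ∘ proj₂) (reverse ls)) (subst Clean (List.map-++ (norm ∘ proj₂) (reverse ls) (c ∷ rs)) h) =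
  subst Clean (trans (cong reverse (List.reverse-map (norm ∘ proj₂) ls)) (List.reverse-involutive _)) (all-reverse p) , q , r

marked-cell : Cell₂ → Cell₂
marked-cell (b , s) = b , just (proj₁ (norm s) , true , proj₂ (proj₂ (norm s)))

wellformed-marked : ∀ {z} → Wellformed z → Wellformed (write (marked-cell (Tape.current z)) z)
wellformed-marked (edge l)            = inside (more l) []
wellformed-marked (inside first r)    = inside first r
wellformed-marked (inside (more l) r) = inside (more l) r

unshadowed : ∀ {z} → Clean (track z) → All (λ s → proj₂ (proj₂ s) ≡ false) (track (write (marked-cell (Tape.current z)) z))
unshadowed {tape ls c rs} h with p , q , r ← clean-parts {ls} {c} {rs} h =
  subst (All _) (sym (List.map-++ (norm ∘ proj₂) (reverse ls) _))
    (All.++⁺ (subst (All _) (sym (List.reverse-map (norm ∘ proj₂) ls)) (all-reverse (All.map (cong proj₂) p)))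
      (cong proj₂ q ∷ All.map (cong proj₂) r))

marked-saved : ∀ {z t} → Wellformed z → Clean (track z) → mapTape proj₁ z ⊒ t →
  Saved t (track (swept (write (marked-cell (Tape.current z)) z)))
marked-saved {tape ls c rs} h s e = swept-saved (wellformed-marked h) (All.map (cong proj₁) (proj₁ (clean-parts {ls} {c} {rs} s))) e

-- The composite machine

data Operation : Set where
  sum product : Operation

module Compose (o : Operation) (N₁ N₂ : Machine) where

  module N₁ = Machine N₁
  module N₂ = Machine N₂
  open Instruction

  data Phase : Set where
    saving loading : Phase

  -- `pre₂` and `pre₁` run prefixes, `run₁` and `run₂` what follows; in a product `run₁` runs all of
  -- the first machine. The sweeps exchange the tapes and `seek` finds the saved head position. The
  -- state of the suspended second machine is kept in the finite control.
  data State : Set where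
    boot fail             : State
    pre₂ run₂ seek close  : N₂.Q → State
    goRight goLeft        : Phase → N₂.Q → State
    pre₁ run₁ pick        : N₁.Q → N₂.Q → State

  finite-State : Finite State
  finite-State = finite-↔ (mk↔ₛ′
    (λ { boot → inj₁ (inj₁ tt) ; fail → inj₁ (inj₂ tt)
       ; (pre₂ q) → inj₂ (inj₁ (inj₁ q)) ; (run₂ q) → inj₂ (inj₁ (inj₂ (inj₁ q)))
       ; (seek q) → inj₂ (inj₁ (inj₂ (inj₂ (inj₁ q)))) ; (close q) → inj₂ (inj₁ (inj₂ (inj₂ (inj₂ q))))
       ; (goRight saving q) → inj₂ (inj₂ (inj₁ (inj₁ q))) ; (goRight loading q) → inj₂ (inj₂ (inj₁ (inj₂ (inj₁ q))))
       ; (goLeft saving q) → inj₂ (inj₂ (inj₁ (inj₂ (inj₂ (inj₁ q))))) ; (goLeft loading q) → inj₂ (inj₂ (inj₁ (inj₂ (inj₂ (inj₂ q)))))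
       ; (pre₁ q r) → inj₂ (inj₂ (inj₂ (inj₁ (q , r)))) ; (run₁ q r) → inj₂ (inj₂ (inj₂ (inj₂ (inj₁ (q , r)))))
       ; (pick q r) → inj₂ (inj₂ (inj₂ (inj₂ (inj₂ (q , r))))) })
    (λ { (inj₁ (inj₁ _)) → boot ; (inj₁ (inj₂ _)) → fail
       ; (inj₂ (inj₁ (inj₁ q))) → pre₂ q ; (inj₂ (inj₁ (inj₂ (inj₁ q)))) → run₂ q
       ; (inj₂ (inj₁ (inj₂ (inj₂ (inj₁ q))))) → seek q ; (inj₂ (inj₁ (inj₂ (inj₂ (inj₂ q))))) → close q
       ; (inj₂ (inj₂ (inj₁ (inj₁ q)))) → goRight saving q ; (inj₂ (inj₂ (inj₁ (inj₂ (inj₁ q))))) → goRight loading q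
       ; (inj₂ (inj₂ (inj₁ (inj₂ (inj₂ (inj₁ q)))))) → goLeft saving q ; (inj₂ (inj₂ (inj₁ (inj₂ (inj₂ (inj₂ q)))))) → goLeft loading q
       ; (inj₂ (inj₂ (inj₂ (inj₁ (q , r))))) → pre₁ q r ; (inj₂ (inj₂ (inj₂ (inj₂ (inj₁ (q , r)))))) → run₁ q r
       ; (inj₂ (inj₂ (inj₂ (inj₂ (inj₂ (q , r)))))) → pick q r })
    (λ { (inj₁ (inj₁ _)) → refl ; (inj₁ (inj₂ _)) → refl
       ; (inj₂ (inj₁ (inj₁ q))) → refl ; (inj₂ (inj₁ (inj₂ (inj₁ q)))) → refl
       ; (inj₂ (inj₁ (inj₂ (inj₂ (inj₁ q))))) → refl ; (inj₂ (inj₁ (inj₂ (inj₂ (inj₂ q))))) → refl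
       ; (inj₂ (inj₂ (inj₁ (inj₁ q)))) → refl ; (inj₂ (inj₂ (inj₁ (inj₂ (inj₁ q))))) → refl
       ; (inj₂ (inj₂ (inj₁ (inj₂ (inj₂ (inj₁ q)))))) → refl ; (inj₂ (inj₂ (inj₁ (inj₂ (inj₂ (inj₂ q)))))) → refl
       ; (inj₂ (inj₂ (inj₂ (inj₁ (q , r))))) → refl ; (inj₂ (inj₂ (inj₂ (inj₂ (inj₁ (q , r)))))) → refl
       ; (inj₂ (inj₂ (inj₂ (inj₂ (inj₂ (q , r)))))) → refl })
    (λ { boot → refl ; fail → refl ; (pre₂ q) → refl ; (run₂ q) → refl ; (seek q) → refl ; (close q) → refl
       ; (goRight saving q) → refl ; (goRight loading q) → refl ; (goLeft saving q) → refl ; (goLeft loading q) → refl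
       ; (pre₁ q r) → refl ; (run₁ q r) → refl ; (pick q r) → refl }))
    (finite-⊎ (finite-⊎ finite-⊤ finite-⊤)
      (finite-⊎ (finite-⊎ Q₂ (finite-⊎ Q₂ (finite-⊎ Q₂ Q₂)))
        (finite-⊎ (finite-⊎ Q₂ (finite-⊎ Q₂ (finite-⊎ Q₂ Q₂))) (finite-⊎ Q₁₂ (finite-⊎ Q₁₂ Q₁₂)))))
    where
    Q₂  = N₂.Q-finite
    Q₁₂ = finite-× N₁.Q-finite N₂.Q-finite

  TOp : Set
  TOp = Op State (Maybe Shadow) N₁.Γ N₂.Γ N₁.tapes N₂.tapes

  W₁ W₂ : Set
  W₁ = Vec N₁.Γ N₁.tapes
  W₂ = Vec N₂.Γ N₂.tapes

  keep : Cell₂ → Bool → Cell₂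
  keep (_ , s) b = b , just (norm s)

  dual-action : Bool × Move → Cell₂ → Cell₂ × Move
  dual-action (b , m) c = keep c b , m

  follow₁ : State → Instruction N₁.Q N₁.Γ N₁.tapes → Cell₂ → W₂ → TOp
  follow₁ s i c γs = op s (dual-action (indexAction i) c) (workActions i) (idle γs) (choiceMove i)

  follow₂ : State → Instruction N₂.Q N₂.Γ N₂.tapes → Cell₂ → W₁ → TOp
  follow₂ s i c γs = op s (dual-action (indexAction i) c) (idle γs) (workActions i) (choiceMove i)

  control : State → Cell₂ × Move → Move → W₁ → W₂ → TOp
  control s p m γs γs′ = op s p (idle γs) (idle γs′) m

  flag : Maybe Shadow → Maybe Shadow
  flag s = just (proj₁ (norm s) , true , proj₂ (proj₂ (norm s)))

  -- In a sum the selecting bit is already nondeterministic, so the prefix of the first machine has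
  -- to be run before it. In a product that prefix comes before any choice anyway.
  entry-for : Operation → N₂.Q → State
  entry-for sum     q = pre₁ N₁.start q
  entry-for product q = run₁ N₁.start q

  arrival : Phase → N₂.Q → State
  arrival saving  = entry-for o
  arrival loading = seek

  rightward : Phase → N₂.Q → Cell₂ → State × Cell₂ × Move
  rightward p q c@(_ , nothing) = goLeft p q , swap c , left
  rightward p q c@(_ , just _)  = goRight p q , c , right

  leftward : Phase → N₂.Q → Cell₂ → State × Cell₂ × Move
  leftward p q c@(_ , nothing)              = fail , c , stay
  leftward p q c@(_ , just (true , _ , _))  = arrival p q , swap c , stay
  leftward p q c@(_ , just (false , _ , _)) = goLeft p q , swap c , left

  seek-by : Bool → N₂.Q → Cell₂ → State × Cell₂ × Move
  seek-by true  q c = run₂ q , c , stay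
  seek-by false q c = seek q , c , right

  seeking : N₂.Q → Cell₂ → State × Cell₂ × Move
  seeking q c = seek-by (proj₁ (proj₂ (norm (proj₂ c)))) q c

  dispatch : State × Cell₂ × Move → W₁ → W₂ → TOp
  dispatch (s , p) = control s p stay

  -- On an unread choice tape moving right is the first nondeterministic step. A halted machine is
  -- suspended as well: its verdict has to wait for its turn.
  pauses : Maybe Bool → Move → Bool
  pauses (just _) _     = true
  pauses nothing  right = true
  pauses nothing  left  = false
  pauses nothing  stay  = false

  choose : Bool → TOp → TOp → TOp
  choose true  a b = a
  choose false a b = b

  isJustTrue : Maybe Bool → Bool
  isJustTrue (just b) = b
  isJustTrue nothing  = false

  program : State → Maybe InputSymbol → Cell₂ → Maybe Bool → W₁ → W₂ → TOp
  -- A head cannot notice the left end of its tape, so the leftmost cell is marked for the sweeps.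
  program boot          x (b , _) c γs γs′ = control (pre₂ N₂.start) ((b , just (true , false , false)) , stay) stay γs γs′
  program fail          x d c γs γs′ = control fail (d , stay) stay γs γs′
  program (pre₂ q)      x d c γs γs′ = choose (pauses (N₂.verdict q) (choiceMove i))
      (control (goRight saving q) ((proj₁ d , flag (proj₂ d)) , stay) stay γs γs′)
      (follow₂ (pre₂ (next i)) i d γs)
    where i = N₂.δ q x (proj₁ d) c γs′
  program (run₂ q)      x d c γs γs′ = follow₂ (run₂ (next i)) i d γs
    where i = N₂.δ q x (proj₁ d) c γs′
  program (seek q)      x d c γs γs′ = dispatch (seeking q d) γs γs′
  program (goRight p q) x d c γs γs′ = dispatch (rightward p q d) γs γs′
  program (goLeft p q)  x d c γs γs′ = dispatch (leftward p q d) γs γs′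
  program (pre₁ q r)    x d c γs γs′ = choose (pauses (N₁.verdict q) (choiceMove i))
      (control (pick q r) (d , stay) right γs γs′)
      (follow₁ (pre₁ (next i) r) i d γs′)
    where i = N₁.δ q x (proj₁ d) c γs
  program (run₁ q r)    x d c γs γs′ = choose (isJustTrue (N₁.verdict q))
      (control (close r) (d , stay) right γs γs′)
      (follow₁ (run₁ (next i) r) i d γs′)
    where i = N₁.δ q x (proj₁ d) c γs
  -- The bit that selects the first machine is `true`, so that it also is the endmarker of its
  -- segment.
  program (pick q r)    x d c γs γs′ = choose (isJustTrue c)
      (control (run₁ q r) (d , stay) stay γs γs′)
      (control (close r) (d , stay) right γs γs′)
  -- A further bit becomes the endmarker for the second machine. It has to be `true`; the other
  -- value fails, so it adds nothing to the count.
  program (close r)     x d c γs γs′ = choose (isJustTrue c)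
      (control (goRight loading r) (d , stay) stay γs γs′)
      (control fail (d , stay) stay γs γs′)

  conclude : Operation → Maybe Bool → Maybe Bool
  conclude sum     h            = h
  conclude product (just true)  = nothing
  conclude product (just false) = just false
  conclude product nothing      = nothing

  verdict′ : State → Maybe Bool
  verdict′ (run₁ q _) = conclude o (N₁.verdict q)
  verdict′ (run₂ q)   = N₂.verdict q
  verdict′ fail       = just false
  verdict′ _          = nothing

  typed : Typed
  typed = record
    { Q = State ; Q-finite = finite-State
    ; S = Maybe Shadow ; S-finite = finite-Maybe (finite-× finite-Bool (finite-× finite-Bool finite-Bool)) ; S-blank = nothing
    ; Γ₁ = N₁.Γ ; Γ₁-finite = N₁.Γ-finite ; blank₁ = N₁.blank ; n₁ = N₁.tapes
    ; Γ₂ = N₂.Γ ; Γ₂-finite = N₂.Γ-finite ; blank₂ = N₂.blank ; n₂ = N₂.tapes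
    ; start = boot ; verdict = verdict′ ; program = program }

  open Compile typed hiding (Γ)

  -- Sweeps over the dual tape

  module ComposeRuns (x : Word) (k : ℕ) (P : TConfig → Set) where

    private
      tv = tview x k

    control-view : ∀ s p m {s₀ z w₁ w₂ t} → verdict′ s₀ ≡ nothing →
      current-op x k (tconfig s₀ z w₁ w₂ t) ≡ control s p m (Vec.map Tape.current w₁) (Vec.map Tape.current w₂) →
      tv (tconfig s₀ z w₁ w₂ t) ≡ mapView (tconfig s (act blank₀ p z) w₁ w₂) (moved m t)
    control-view s p m {s₀} {z} {w₁} {w₂} {t} e e′ rewrite e | e′ =
      cong₂ (λ w₁ w₂ → mapView (tconfig s (act blank₀ p z) w₁ w₂) (moved m t)) (idle-act N₁.blank w₁) (idle-act N₂.blank w₂)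

    module _ (w₁ : Vec (Tape N₁.Γ) N₁.tapes) (w₂ : Vec (Tape N₂.Γ) N₂.tapes) (t : ChoiceTape) where

      at-dual : State → Tape Cell₂ → TConfig
      at-dual s z = tconfig s z w₁ w₂ t

      data Transit : State → Set where
        goRight : ∀ {p q} → Transit (goRight p q)
        goLeft  : ∀ {p q} → Transit (goLeft p q)
        seek    : ∀ {q} → Transit (seek q)

      module _ (B : ℕ) (ok : ∀ {s z} → Transit s → size z ≤ B → P (at-dual s z)) where

        sweep-left : ∀ p q ls c rs → Left (c ∷ ls) → length ls + suc (length rs) ≤ B →
          Run tv P (at-dual (goLeft p q) (tape ls c rs)) (suc (length ls)) (at-dual (arrival p q) (flat (List.map swap (c ∷ ls) List.ʳ++ rs)))
        sweep-left p q [] c rs first h = step (ok goLeft h)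
          (control-view (arrival p q) (swap c , stay) stay {goLeft p q} {tape [] c rs} {w₁} {w₂} {t} refl refl) []
        sweep-left p q (c′ ∷ ls) c rs (more l) h = step (ok goLeft (≤-trans (≤-reflexive (size-length (tape (c′ ∷ ls) c rs))) h))
          (control-view (goLeft p q) (swap c , left) stay {goLeft p q} {tape (c′ ∷ ls) c rs} {w₁} {w₂} {t} refl refl)
          (sweep-left p q ls c′ (swap c ∷ rs) l (≤-trans (≤-reflexive (+-suc (length ls) _)) h))

        turn : ∀ p q ls → Left ls → suc (length ls) ≤ B →
          Run tv P (at-dual (goRight p q) (tape ls blank₀ [])) (suc (length ls))
            (at-dual (arrival p q) (flat (List.map swap ls List.ʳ++ (swap blank₀ ∷ []))))
        turn p q (c ∷ ls) l h = step (ok goRight (≤-trans (≤-reflexive (trans (size-length (tape (c ∷ ls) blank₀ [])) (+-comm _ 1))) h))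
          (control-view (goLeft p q) (swap blank₀ , left) stay {goRight p q} {tape (c ∷ ls) blank₀ []} {w₁} {w₂} {t} refl refl)
          (sweep-left p q ls c (swap blank₀ ∷ []) l (≤-trans (≤-reflexive (+-comm (length ls) 2)) h))

        Sweep : Phase → N₂.Q → Tape Cell₂ → ℕ → Set
        Sweep p q z N = ∃[ n ] n ≤ N × Run tv P (at-dual (goRight p q) z) n (at-dual (arrival p q) (swept z))

        push : ∀ {c c′ ls m v b} → Left (c ∷ ls) → c′ ≡ (b , just (false , m , v)) → Left (c′ ∷ c ∷ ls)
        push first    refl = more first
        push (more l) refl = more (more l)

        sweep-right : ∀ p q ls {b s} rs → Left ((b , just s) ∷ ls) → Right rs → 2 + (length ls + length rs) ≤ B →
          Sweep p q (tape ls (b , just s) rs) (3 + length ls + 2 * length rs)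
        sweep-right p q ls {b} {s} [] l [] h = _ , ≤-reflexive (sym (+-identityʳ (3 + length ls))) ,
          step (ok goRight (≤-trans (≤-reflexive (trans (size-length (tape ls (b , just s) [])) (trans (+-suc (length ls) 0) (cong suc (+-identityʳ (length ls)))))) (≤-trans (n≤1+n _) h′)))
            (control-view (goRight p q) ((b , just s) , right) stay {goRight p q} {tape ls (b , just s) []} {w₁} {w₂} {t} refl refl)
            (turn p q ((b , just s) ∷ ls) l h′)
          where
          h′ : 2 + length ls ≤ B
          h′ = ≤-trans (+-monoʳ-≤ 2 (m≤m+n (length ls) 0)) h
        sweep-right p q ls {b} {s} (r@(b′ , just s′) ∷ rs) l (more r′) h
          with n , n≤ , ρ ← sweep-right p q ((b , just s) ∷ ls) {b′} {s′} rs (push l refl) r′ (≤-trans (≤-reflexive (cong (λ n → 2 + n) (sym (+-suc (length ls) (length rs))))) h) =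
          suc n , ≤-trans (s≤s n≤) (≤-reflexive (count (length ls) (length rs))) ,
          step (ok goRight (≤-trans (≤-trans (≤-reflexive (trans (size-length (tape ls (b , just s) (r ∷ rs))) (+-suc (length ls) _))) (n≤1+n _)) h))
            (control-view (goRight p q) ((b , just s) , right) stay {goRight p q} {tape ls (b , just s) (r ∷ rs)} {w₁} {w₂} {t} refl refl)
            ρ
          where
          count : ∀ m n → 1 + (3 + (1 + m) + 2 * n) ≡ 3 + m + 2 * (1 + n)
          count = solve-∀

        sweep : ∀ p q z → Wellformed z → suc (size z) ≤ B → Sweep p q z (2 * size z + 1)
        sweep p q z (edge {ls} l) h = suc (length ls) ,
          ≤-trans (≤-reflexive (trans (+-comm 1 _) (sym (size-length z)))) (≤-trans (m≤n*m (size z) 2) (m≤m+n (2 * size z) 1)) ,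
          turn p q ls l (≤-trans (≤-trans (≤-reflexive (trans (+-comm 1 _) (sym (size-length z)))) (n≤1+n _)) h)
        sweep p q z (inside {ls} {b , just s} {rs} l r) h
          with n , n≤ , ρ ← sweep-right p q ls {b} {s} rs l r (≤-trans (≤-reflexive (cong suc (trans (sym (+-suc (length ls) _)) (sym (size-length z))))) h) =
          n , ≤-trans n≤ (≤-trans (m≤m+n _ (length ls)) (≤-reflexive (trans (count (length ls) (length rs)) (cong (λ n → 2 * n + 1) (sym (size-length z)))))) , ρ
          where
          count : ∀ m n → 3 + m + 2 * n + m ≡ 2 * (m + suc n) + 1
          count = solve-∀

        seek-run : ∀ q ls us c rs → All (λ u → proj₁ (proj₂ (norm (proj₂ u))) ≡ false) us → proj₁ (proj₂ (norm (proj₂ c))) ≡ true →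
          length ls + (length us + suc (length rs)) ≤ B →
          Run tv P (at-dual (seek q) (point ls c us rs)) (suc (length us)) (at-dual (run₂ q) (tape (us List.ʳ++ ls) c rs))
        seek-run q ls [] c rs [] m h = step (ok seek (≤-trans (≤-reflexive (size-length (tape ls c rs))) h))
          (control-view (run₂ q) (c , stay) stay {seek q} {tape ls c rs} {w₁} {w₂} {t} refl
            (cong (λ b → dispatch (seek-by b q c) (Vec.map Tape.current w₁) (Vec.map Tape.current w₂)) m)) []
        seek-run q ls (u ∷ us) c rs (e ∷ es) m h = step
          (ok seek (≤-trans (≤-reflexive (trans (size-length (tape ls u (us ++ c ∷ rs))) (cong (λ n → length ls + suc n) (List.length-++ us)))) h))
          (trans (control-view (seek q) (u , right) stay {seek q} {tape ls u (us ++ c ∷ rs)} {w₁} {w₂} {t} refl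
              (cong (λ b → dispatch (seek-by b q u) (Vec.map Tape.current w₁) (Vec.map Tape.current w₂)) e))
            (cong (λ z → det (at-dual (seek q) z)) (shift-point us)))
          (seek-run q (u ∷ ls) us c rs es m (≤-trans (≤-reflexive (sym (+-suc (length ls) _))) h))
          where
          shift-point : ∀ us → shift blank₀ right (tape ls u (us ++ c ∷ rs)) ≡ point (u ∷ ls) c us rs
          shift-point []      = refl
          shift-point (_ ∷ _) = refl

-- `B` bounds the length that the dual tape had when the simulated machine took it over; beyond that
-- it grows only with `t`.
record Tracks (B : ℕ) (z : Tape Cell₂) (t : Tape Bool) : Set where
  constructor tracks
  field
    covers : mapTape proj₁ z ⊒ t
    size-≤ : size z ≤ B ⊔ size t

tracks-act : ∀ {B z t} b m → Tracks B z t → Tracks B (act blank₀ (revisiting z b , m) z) (act false (b , m) t)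
tracks-act {B} {z} {t} b m (tracks c s) = tracks
  (subst (_⊒ act false (b , m) t) (sym (map-act proj₁ blank₀ (revisiting z b) m z)) (⊒-act b m c))
  (begin
    size (act blank₀ (revisiting z b , m) z)               ≡⟨ size-map proj₁ (act blank₀ (revisiting z b , m) z) ⟨
    size (mapTape proj₁ (act blank₀ (revisiting z b , m) z)) ≡⟨ cong size (map-act proj₁ blank₀ (revisiting z b) m z) ⟩
    size (act false (b , m) (mapTape proj₁ z))             ≤⟨ size-act-⊒ b m c ⟩
    size (mapTape proj₁ z) ⊔ size t′                       ≡⟨ cong (_⊔ size t′) (size-map proj₁ z) ⟩
    size z ⊔ size t′                                       ≤⟨ ⊔-mono-≤ s (≤-refl {size t′}) ⟩
    (B ⊔ size t) ⊔ size t′                                 ≡⟨ ⊔-assoc B _ _ ⟩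
    B ⊔ (size t ⊔ size t′)                                 ≡⟨ cong (B ⊔_) (m≤n⇒m⊔n≡n (size-act false (b , m) t)) ⟩
    B ⊔ size t′                                            ∎)
  where
  open ≤-Reasoning
  t′ = act false (b , m) t

-- The composite machine imitates its components

module Composite (o : Operation) (N₁ N₂ : Machine) (x : Word) (k : ℕ) where

  open Compose o N₁ N₂
  open Compile typed hiding (Γ; machine)
  open Instruction

  module C₁ = Semantics N₁ x k
  module C₂ = Semantics N₂ x k

  v₁ : C₁.Config → View C₁.Config
  v₁ = view N₁ x k

  v₂ : C₂.Config → View C₂.Config
  v₂ = view N₂ x k

  tv : TConfig → View TConfig
  tv = tview x k

  Works₁ Works₂ : Set
  Works₁ = Vec (Tape N₁.Γ) N₁.tapes
  Works₂ = Vec (Tape N₂.Γ) N₂.tapes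

  symbol-≡ : ∀ {z : Tape Cell₂} {I} → mapTape proj₁ z ⊒ I → symbolAt x k (mapTape proj₁ z) ≡ symbolAt x k I
  symbol-≡ h = cong (λ n → List.head (drop n (encode x k))) (⊒-address h)

  instruction₁ : ∀ {q z I} w t → mapTape proj₁ z ⊒ I →
    N₁.δ q (symbolAt x k (mapTape proj₁ z)) (proj₁ (Tape.current z)) (scanned t) (Vec.map Tape.current w) ≡ C₁.instruction (C₁.config q I w t)
  instruction₁ {q} {z} {I} w t h = cong₂ (λ s b → N₁.δ q s b (scanned t) (Vec.map Tape.current w)) (symbol-≡ {z} {I} h) (⊒-current h)

  instruction₂ : ∀ {q z I} w t → mapTape proj₁ z ⊒ I →
    N₂.δ q (symbolAt x k (mapTape proj₁ z)) (proj₁ (Tape.current z)) (scanned t) (Vec.map Tape.current w) ≡ C₂.instruction (C₂.config q I w t)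
  instruction₂ {q} {z} {I} w t h = cong₂ (λ s b → N₂.δ q s b (scanned t) (Vec.map Tape.current w)) (symbol-≡ {z} {I} h) (⊒-current h)

  dual′ : Bool × Move → Tape Cell₂ → Tape Cell₂
  dual′ (b , m) z = act blank₀ (revisiting z b , m) z

  -- One step of the first machine, whose state q is recorded as κ q.
  imitated₁ : (N₁.Q → State) → C₁.Config → Tape Cell₂ → Works₂ → ChoiceTape → TConfig
  imitated₁ κ c z w₂ t = tconfig (κ (next i)) (dual′ (indexAction i) z) (Vec.zipWith (act N₁.blank) (workActions i) (C₁.work c)) w₂ t
    where i = C₁.instruction c

  imitated₂ : (N₂.Q → State) → C₂.Config → Tape Cell₂ → Works₁ → ChoiceTape → TConfig
  imitated₂ κ c z w₁ t = tconfig (κ (next i)) (dual′ (indexAction i) z) w₁ (Vec.zipWith (act N₂.blank) (workActions i) (C₂.work c)) t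
    where i = C₂.instruction c

  follow₁-view : ∀ κ s {q z I w₁ w₂ t} → mapTape proj₁ z ⊒ I →
    let c = C₁.config q I w₁ t
        i = N₁.δ q (symbolAt x k (mapTape proj₁ z)) (proj₁ (Tape.current z)) (scanned t) (Vec.map Tape.current w₁) in
    current-op x k (tconfig s z w₁ w₂ t) ≡ follow₁ (κ (next i)) i (Tape.current z) (Vec.map Tape.current w₂) →
    tv (tconfig s z w₁ w₂ t) ≡ resolve (verdict′ s) (mapView (imitated₁ κ c z w₂) (moved (choiceMove (C₁.instruction c)) t))
  follow₁-view κ s {q} {z} {I} {w₁} {w₂} {t} h e = trans
    (cong (λ u → resolve (verdict′ s) (mapView (perform u a) (moved (Op.move u) t))) e)
    (trans (cong (λ i → resolve (verdict′ s) (mapView (perform (follow₁ (κ (next i)) i (Tape.current z) (Vec.map Tape.current w₂)) a) (moved (choiceMove i) t)))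
        (instruction₁ {q} {z} {I} w₁ t h))
      (cong (λ w → resolve (verdict′ s) (mapView (imitated₁ κ (C₁.config q I w₁ t) z w) (moved (choiceMove (C₁.instruction (C₁.config q I w₁ t))) t)))
        (idle-act N₂.blank w₂)))
    where a = tconfig s z w₁ w₂ t

  follow₂-view : ∀ κ s {q z I w₁ w₂ t} → mapTape proj₁ z ⊒ I →
    let c = C₂.config q I w₂ t
        i = N₂.δ q (symbolAt x k (mapTape proj₁ z)) (proj₁ (Tape.current z)) (scanned t) (Vec.map Tape.current w₂) in
    current-op x k (tconfig s z w₁ w₂ t) ≡ follow₂ (κ (next i)) i (Tape.current z) (Vec.map Tape.current w₁) →
    tv (tconfig s z w₁ w₂ t) ≡ resolve (verdict′ s) (mapView (imitated₂ κ c z w₁) (moved (choiceMove (C₂.instruction c)) t))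
  follow₂-view κ s {q} {z} {I} {w₁} {w₂} {t} h e = trans
    (cong (λ u → resolve (verdict′ s) (mapView (perform u a) (moved (Op.move u) t))) e)
    (trans (cong (λ i → resolve (verdict′ s) (mapView (perform (follow₂ (κ (next i)) i (Tape.current z) (Vec.map Tape.current w₁)) a) (moved (choiceMove i) t)))
        (instruction₂ {q} {z} {I} w₂ t h))
      (cong (λ w → resolve (verdict′ s) (mapView (imitated₂ κ (C₂.config q I w₂ t) z w) (moved (choiceMove (C₂.instruction (C₂.config q I w₂ t))) t)))
        (idle-act N₁.blank w₁)))
    where a = tconfig s z w₁ w₂ t

  data Active₂ (B : ℕ) (w₁ : Works₁) : TConfig → C₂.Config → Set where
    active : ∀ {q z I w₂ t} → Tracks B z I → Active₂ B w₁ (tconfig (run₂ q) z w₁ w₂ t) (C₂.config q I w₂ t)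

  active₂-rel : ∀ {B w₁ a c} → Active₂ B w₁ a c → ViewRel (Active₂ B w₁) (tv a) (v₂ c)
  active₂-rel (active {q} {z} {I} {w₂} {t} h) = subst (λ w → ViewRel _ w _) (sym (follow₂-view run₂ (run₂ q) {z = z} (Tracks.covers h) refl))
    (resolve-rel (N₂.verdict q) (map-rel (λ t′ → active {z = dual′ (indexAction i) z} (tracks-act {z = z} (proj₁ (indexAction i)) (proj₂ (indexAction i)) h)) (moved (choiceMove i) t)))
    where i = C₂.instruction (C₂.config q I w₂ t)

  -- J and w₂ are the tapes of the suspended second machine.
  data Active₁ (κ : N₁.Q → State) (B : ℕ) (J : Tape Bool) (w₂ : Works₂) : TConfig → C₁.Config → Set where
    active : ∀ {q z I w₁ t} → Tracks B z I → Wellformed z → Saved J (track z) →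
      Active₁ κ B J w₂ (tconfig (κ q) z w₁ w₂ t) (C₁.config q I w₁ t)

  imitated-active₁ : ∀ {κ B J w₂ q z I w₁ t} → Tracks B z I → Wellformed z → Saved J (track z) → ∀ t′ →
    Active₁ κ B J w₂ (imitated₁ κ (C₁.config q I w₁ t) z w₂ t′) (C₁.advance (C₁.config q I w₁ t) t′)
  imitated-active₁ {q = q} {z} {I} {w₁} {t} h w s t′ = active {z = dual′ (indexAction i) z}
    (tracks-act {z = z} (proj₁ (indexAction i)) (proj₂ (indexAction i)) h)
    (wellformed-act (proj₁ (indexAction i)) (proj₂ (indexAction i)) z w)
    (saved-act (proj₁ (indexAction i)) (proj₂ (indexAction i)) z s)
    where i = C₁.instruction (C₁.config q I w₁ t)

  -- Acceptance is excluded because in a product the composite then goes on to the separator instead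
  -- of halting.
  active₁-rel : ∀ {r B J w₂ a q I w t} → Active₁ (λ q → run₁ q r) B J w₂ a (C₁.config q I w t) →
    N₁.verdict q ≢ just true → ViewRel (Active₁ (λ q → run₁ q r) B J w₂) (tv a) (v₁ (C₁.config q I w t))
  active₁-rel {r} {B} {J} {w₂} (active {q} {z} {I} {w₁} {t} h w s) n = by (N₁.verdict q) refl
    where
    a = tconfig (run₁ q r) z w₁ w₂ t
    c = C₁.config q I w₁ t
    cs₁ = Vec.map Tape.current w₁
    cs₂ = Vec.map Tape.current w₂
    i′ = N₁.δ q (symbolAt x k (mapTape proj₁ z)) (proj₁ (Tape.current z)) (scanned t) cs₁
    ending : ∀ o → conclude o (just false) ≡ just false
    ending sum     = refl
    ending product = refl
    running : ∀ o → conclude o nothing ≡ nothing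
    running sum     = refl
    running product = refl
    by : ∀ h → N₁.verdict q ≡ h → ViewRel (Active₁ (λ q → run₁ q r) B J w₂) (tv a) (v₁ c)
    by (just true)  e = contradiction e n
    by (just false) e = subst₂ (ViewRel _) (sym (tview-halt x k a (trans (cong (conclude o) e) (ending o))))
      (sym (Paths.view-halt N₁ x k {c} e)) halt
    by nothing      e = subst₂ (ViewRel _)
      (sym (trans (follow₁-view (λ q → run₁ q r) (run₁ q r) {z = z} (Tracks.covers h) (cong (λ b → choose (isJustTrue b)
            (control (close r) (Tape.current z , stay) right cs₁ cs₂) (follow₁ (run₁ (next i′) r) i′ (Tape.current z) cs₂)) e))
        (cong (λ h → resolve h (mapView (imitated₁ (λ q → run₁ q r) c z w₂) (moved (choiceMove (C₁.instruction c)) t)))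
          (trans (cong (conclude o) e) (running o)))))
      (sym (Paths.view-step N₁ x k {c} e))
      (map-rel (imitated-active₁ {λ q → run₁ q r} {z = z} {w₁ = w₁} {t = t} h w s) (moved (choiceMove (C₁.instruction c)) t))

-- Bounds along the runs of the composite

module CompositeRuns (o : Operation) (N₁ N₂ : Machine) (x : Word) (k : ℕ) where

  open Compose o N₁ N₂
  open Compile typed hiding (Γ; machine)
  open Instruction
  open Composite o N₁ N₂ x k

  LeftReachable₁ LeftReachable₂ : Set
  LeftReachable₁ = ∃[ u ] ∃[ c ] Base u × Reach v₁ (initialOn N₁ x k u) c × N₁.verdict (C₁.state c) ≡ nothing × choiceMove (C₁.instruction c) ≡ left
  LeftReachable₂ = ∃[ u ] ∃[ c ] Base u × Reach v₂ (initialOn N₂ x k u) c × N₂.verdict (C₂.state c) ≡ nothing × choiceMove (C₂.instruction c) ≡ left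

  Bounds₁ Bounds₂ : ℕ → ℕ → ℕ → Set
  Bounds₁ Z S H = ∀ {u c} → Base u → Reach v₁ (initialOn N₁ x k u) c →
    size (C₁.index c) ≤ Z × sizes (C₁.work c) ≤ S × bitsRead (C₁.choice c) ≤ length u + H
  Bounds₂ Z S H = ∀ {u c} → Base u → Reach v₂ (initialOn N₂ x k u) c →
    size (C₂.index c) ≤ Z × sizes (C₂.work c) ≤ S × bitsRead (C₂.choice c) ≤ length u + H

  module Bounded (Z S₁ S₂ H₁ H₂ : ℕ) (bounded₁ : Bounds₁ Z S₁ H₁) (bounded₂ : Bounds₂ Z S₂ H₂) where

    -- There are at most two exchanges, for saving and for loading, each adding at most one cell:
    -- hence `2 + Z`. Besides the bits of the components only a selector and a separator are read; 3
    -- is a generous bound.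
    record Safe (a : TConfig) : Set where
      constructor safe-by
      field
        dual-≤    : size (dual a) ≤ 2 + Z
        work₁-≤   : sizes (work₁ a) ≤ S₁
        work₂-≤   : sizes (work₂ a) ≤ S₂
        bits-≤    : bitsRead (choice a) ≤ 3 + (H₁ + H₂)
        left-only : verdict′ (state a) ≡ nothing → Op.move (current-op x k a) ≡ left → LeftReachable₁ ⊎ LeftReachable₂

    open ComposeRuns x k Safe

    1≤Z : 1 ≤ Z
    1≤Z = proj₁ (bounded₁ bare here)

    tracks-bound : ∀ {B z I} → B ≤ 2 + Z → Tracks B z I → size I ≤ Z → size z ≤ 2 + Z
    tracks-bound B≤ (tracks _ s) h = ≤-trans s (⊔-lub B≤ (≤-trans h (m≤n+m Z 2)))

    module _ {w₁ : Works₁} {w₂ : Works₂} {t : ChoiceTape} (w₁≤ : sizes w₁ ≤ S₁) (w₂≤ : sizes w₂ ≤ S₂) (t≤ : bitsRead t ≤ 3 + (H₁ + H₂)) where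

      transit-safe : ∀ {s z} → Transit w₁ w₂ t s → size z ≤ 2 + Z → Safe (tconfig s z w₁ w₂ t)
      transit-safe goRight h = safe-by h w₁≤ w₂≤ t≤ λ _ ()
      transit-safe goLeft  h = safe-by h w₁≤ w₂≤ t≤ λ _ ()
      transit-safe seek    h = safe-by h w₁≤ w₂≤ t≤ λ _ ()

      -- The exchange of at most `1 + Z` cells takes `2 * (1 + Z) + 1` steps, and finding the mark
      -- on the result another `2 + Z`. This happens in the tail, so its time has to be bounded.
      load : ∀ {q z J} → Wellformed z → Saved J (track z) → size z ≤ 1 + Z →
        ∃[ n ] ∃[ z′ ] n ≤ 3 * Z + 5 × Run tv Safe (tconfig (goRight loading q) z w₁ w₂ t) n (tconfig (run₂ q) z′ w₁ w₂ t) × Tracks (2 + Z) z′ J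
      load {q} {z} {J} h s z≤
        with m , m≤ , ρ ← sweep w₁ w₂ t (2 + Z) transit-safe loading q z h (s≤s z≤)
        = m + suc (length us) , z′ , steps ,
          (ρ +++ subst (λ z → Run tv Safe (tconfig (seek q) z w₁ w₂ t) (suc (length us)) (tconfig (run₂ q) z′ w₁ w₂ t)) (sym start)
            (seek-run w₁ w₂ t (2 + Z) transit-safe q [] us c rs unmarked marked total≤)) ,
          tracks covers (m≤n⇒m≤n⊔o (size J) (≤-trans (≤-reflexive size-≡) total≤))
        where
        open Restored (restored h s)
        z′ = tape (us List.ʳ++ []) c rs
        total≤ : length us + suc (length rs) ≤ 2 + Z
        total≤ = ≤-trans (≤-reflexive length-≡) (≤-trans (swept-size h) (s≤s z≤))
        size-≡ : size z′ ≡ length us + suc (length rs)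
        size-≡ = trans (size-length z′) (cong (_+ suc (length rs)) (trans (cong length (trans (List.ʳ++-defn us) (List.++-identityʳ _))) (List.length-reverse us)))
        steps : _ + suc (length us) ≤ 3 * Z + 5
        steps = ≤-trans (+-mono-≤ (≤-trans m≤ (+-monoˡ-≤ 1 (*-monoʳ-≤ 2 z≤))) (≤-trans (≤-trans (s≤s (m≤m+n (length us) (length rs))) (≤-reflexive (sym (+-suc (length us) (length rs))))) total≤))
          (≤-reflexive (count Z))
          where
          count : ∀ z → 2 * (1 + z) + 1 + (2 + z) ≡ 3 * z + 5
          count = solve-∀

    initial₁ : Works₁
    initial₁ = Vec.replicate N₁.tapes (blankTape N₁.blank)

    initial₁-≤ : sizes initial₁ ≤ S₁
    initial₁-≤ = proj₁ (proj₂ (bounded₁ bare here))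

    follow₂-safe : ∀ {s z w₁ q I w₂ t u B} → B ≤ 2 + Z → Tracks B z I → sizes w₁ ≤ S₁ → Base u → length u + H₂ ≤ 3 + (H₁ + H₂) →
      Reach v₂ (initialOn N₂ x k u) (C₂.config q I w₂ t) →
      (verdict′ s ≡ nothing → Op.move (current-op x k (tconfig s z w₁ w₂ t)) ≡ left →
        N₂.verdict q ≡ nothing × choiceMove (C₂.instruction (C₂.config q I w₂ t)) ≡ left) →
      Safe (tconfig s z w₁ w₂ t)
    follow₂-safe B≤ h w base u≤ r l with i≤ , w₂≤ , t≤ ← bounded₂ base r =
      safe-by (tracks-bound B≤ h i≤) w w₂≤ (≤-trans t≤ u≤) λ e e′ → let e₁ , e₂ = l e e′ in inj₂ (_ , _ , base , r , e₁ , e₂)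

    follow₁-safe : ∀ {s z w₁ q I w₂ t u B} → B ≤ 2 + Z → Tracks B z I → sizes w₂ ≤ S₂ → Base u → length u + H₁ ≤ 3 + (H₁ + H₂) →
      Reach v₁ (initialOn N₁ x k u) (C₁.config q I w₁ t) →
      (verdict′ s ≡ nothing → Op.move (current-op x k (tconfig s z w₁ w₂ t)) ≡ left →
        N₁.verdict q ≡ nothing × choiceMove (C₁.instruction (C₁.config q I w₁ t)) ≡ left) →
      Safe (tconfig s z w₁ w₂ t)
    follow₁-safe B≤ h w base u≤ r l with i≤ , w₁≤ , t≤ ← bounded₁ base r =
      safe-by (tracks-bound B≤ h i≤) w₁≤ w (≤-trans t≤ u≤) λ e e′ → let e₁ , e₂ = l e e′ in inj₁ (_ , _ , base , r , e₁ , e₂)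

    moved-pauses : ∀ m {t} → moved m unread ≡ det t → t ≡ unread × pauses nothing m ≡ false
    moved-pauses left refl = refl , refl
    moved-pauses stay refl = refl , refl

    data Prelude₂ : TConfig → C₂.Config → Set where
      prelude : ∀ {q z I w₂} → Tracks 1 z I → Wellformed z → Clean (track z) →
        Prelude₂ (tconfig (pre₂ q) z initial₁ w₂ unread) (C₂.config q I w₂ unread)

    data Prelude₁ (r : N₂.Q) (J : Tape Bool) (w₂ : Works₂) : TConfig → C₁.Config → Set where
      prelude : ∀ {q z I w₁} → Tracks (1 + Z) z I → Wellformed z → Saved J (track z) →
        Prelude₁ r J w₂ (tconfig (pre₁ q r) z w₁ w₂ unread) (C₁.config q I w₁ unread)

    pre-move : ∀ h m {a b : TOp} → Op.move a ≡ stay ⊎ Op.move a ≡ right → Op.move b ≡ m →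
      Op.move (choose (pauses h m) a b) ≡ left → h ≡ nothing × m ≡ left
    pre-move nothing  left  _ e l = refl , refl
    pre-move nothing  stay  _ e l with () ← trans (sym e) l
    pre-move nothing  right (inj₁ e) _ l with () ← trans (sym e) l
    pre-move nothing  right (inj₂ e) _ l with () ← trans (sym e) l
    pre-move (just _) m     (inj₁ e) _ l with () ← trans (sym e) l
    pre-move (just _) m     (inj₂ e) _ l with () ← trans (sym e) l

    prelude₂-safe : ∀ {a c} → Prelude₂ a c → Reach v₂ (initialOn N₂ x k []) c → Safe a
    prelude₂-safe (prelude {q} {z} {I} {w₂} h _ _) r = follow₂-safe {z = z} (s≤s z≤n) h initial₁-≤ bare (≤-trans (m≤n+m H₂ H₁) (m≤n+m _ 3)) r
      λ _ l → let e , e′ = pre-move (N₂.verdict q) (choiceMove (N₂.δ q (symbolAt x k (mapTape proj₁ z)) (proj₁ (Tape.current z)) nothing (Vec.map Tape.current w₂))) (inj₁ refl) refl l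
              in e , trans (cong choiceMove (sym (instruction₂ {q} {z} {I} w₂ unread (Tracks.covers h)))) e′

    prelude₁-safe : ∀ {r J w₂ a c} → sizes w₂ ≤ S₂ → Prelude₁ r J w₂ a c → Reach v₁ (initialOn N₁ x k []) c → Safe a
    prelude₁-safe w (prelude {q} {z} {I} {w₁} h _ _) r = follow₁-safe {z = z} (n≤1+n _) h w bare (≤-trans (m≤m+n H₁ H₂) (m≤n+m _ 3)) r
      λ _ l → let e , e′ = pre-move (N₁.verdict q) (choiceMove (N₁.δ q (symbolAt x k (mapTape proj₁ z)) (proj₁ (Tape.current z)) nothing (Vec.map Tape.current w₁))) (inj₂ refl) refl l
              in e , trans (cong choiceMove (sym (instruction₁ {q} {z} {I} w₁ unread (Tracks.covers h)))) e′

    prelude₂-step : ∀ {a c c′} → Prelude₂ a c → v₂ c ≡ det c′ → ∃[ a′ ] tv a ≡ det a′ × Prelude₂ a′ c′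
    prelude₂-step (prelude {q} {z} {I} {w₂} h w s) e
      with e₁ , t , e₂ , refl ← resolve-det (N₂.verdict q) (C₂.advance (C₂.config q I w₂ unread)) (moved (choiceMove (C₂.instruction (C₂.config q I w₂ unread))) unread) e
      with refl , e₃ ← moved-pauses (choiceMove (C₂.instruction (C₂.config q I w₂ unread))) e₂ =
      _ , trans (follow₂-view pre₂ (pre₂ q) {z = z} (Tracks.covers h)
            (cong (λ b → choose b (control (goRight saving q) ((proj₁ (Tape.current z) , flag (proj₂ (Tape.current z))) , stay) stay cs₁ cs₂) (follow₂ (pre₂ (next i′)) i′ (Tape.current z) cs₁))
              (trans (cong₂ (λ h i → pauses h (choiceMove i)) e₁ (instruction₂ {q} {z} {I} w₂ unread (Tracks.covers h))) e₃)))
          (cong (mapView _) e₂) ,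
      prelude {z = dual′ (indexAction i) z} (tracks-act {z = z} (proj₁ (indexAction i)) (proj₂ (indexAction i)) h)
        (wellformed-act (proj₁ (indexAction i)) (proj₂ (indexAction i)) z w) (clean-act (proj₁ (indexAction i)) (proj₂ (indexAction i)) z s)
      where
      i = C₂.instruction (C₂.config q I w₂ unread)
      cs₁ = Vec.map Tape.current initial₁
      cs₂ = Vec.map Tape.current w₂
      i′ = N₂.δ q (symbolAt x k (mapTape proj₁ z)) (proj₁ (Tape.current z)) nothing cs₂

    prelude₁-step : ∀ {r J w₂ a c c′} → Prelude₁ r J w₂ a c → v₁ c ≡ det c′ → ∃[ a′ ] tv a ≡ det a′ × Prelude₁ r J w₂ a′ c′
    prelude₁-step {r} {w₂ = w₂} (prelude {q} {z} {I} {w₁} h w s) e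
      with e₁ , t , e₂ , refl ← resolve-det (N₁.verdict q) (C₁.advance (C₁.config q I w₁ unread)) (moved (choiceMove (C₁.instruction (C₁.config q I w₁ unread))) unread) e
      with refl , e₃ ← moved-pauses (choiceMove (C₁.instruction (C₁.config q I w₁ unread))) e₂ =
      _ , trans (follow₁-view (λ q → pre₁ q r) (pre₁ q r) {z = z} (Tracks.covers h)
            (cong (λ b → choose b (control (pick q r) (Tape.current z , stay) right cs₁ cs₂) (follow₁ (pre₁ (next i′) r) i′ (Tape.current z) cs₂))
              (trans (cong₂ (λ h i → pauses h (choiceMove i)) e₁ (instruction₁ {q} {z} {I} w₁ unread (Tracks.covers h))) e₃)))
          (cong (mapView _) e₂) ,
      prelude {z = dual′ (indexAction i) z} (tracks-act {z = z} (proj₁ (indexAction i)) (proj₂ (indexAction i)) h)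
        (wellformed-act (proj₁ (indexAction i)) (proj₂ (indexAction i)) z w) (saved-act (proj₁ (indexAction i)) (proj₂ (indexAction i)) z s)
      where
      i = C₁.instruction (C₁.config q I w₁ unread)
      cs₁ = Vec.map Tape.current w₁
      cs₂ = Vec.map Tape.current w₂
      i′ = N₁.δ q (symbolAt x k (mapTape proj₁ z)) (proj₁ (Tape.current z)) nothing cs₁

    prelude₂-run : ∀ {a c n c′} → Prelude₂ a c → Reach v₂ (initialOn N₂ x k []) c → Run v₂ Any c n c′ → ∃[ a′ ] Run tv Safe a n a′ × Prelude₂ a′ c′
    prelude₂-run p r [] = _ , [] , p
    prelude₂-run p r (step _ e ρ) with _ , e′ , p′ ← prelude₂-step p e with a′ , ρ′ , p″ ← prelude₂-run p′ (reach-det r e) ρ =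
      a′ , step (prelude₂-safe p r) e′ ρ′ , p″

    prelude₁-run : ∀ {s J w₂ a c n c′} → sizes w₂ ≤ S₂ → Prelude₁ s J w₂ a c → Reach v₁ (initialOn N₁ x k []) c → Run v₁ Any c n c′ →
      ∃[ a′ ] Run tv Safe a n a′ × Prelude₁ s J w₂ a′ c′
    prelude₁-run w p r [] = _ , [] , p
    prelude₁-run w p r (step _ e ρ) with _ , e′ , p′ ← prelude₁-step p e with a′ , ρ′ , p″ ← prelude₁-run w p′ (reach-det r e) ρ =
      a′ , step (prelude₁-safe w p r) e′ ρ′ , p″

-- The whole computation of the composite

module Combined {C : Class} {F₁ F₂ : ParamFun} (o : Operation) (G₁ : Good C F₁) (G₂ : Good C F₂) (x : Word) (k : ℕ) where

  module G₁ = Good G₁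
  module G₂ = Good G₂

  open Compose o G₁.M G₂.M
  open Compile typed hiding (Γ; machine)
  open Instruction
  open Composite o G₁.M G₂.M x k
  open CompositeRuns o G₁.M G₂.M x k

  p₁ : List Bool → C₁.Config
  p₁ = G₁.paused x k

  p₂ : List Bool → C₂.Config
  p₂ = G₂.paused x k

  private
    init₁ = initialOn G₁.M x k
    init₂ = initialOn G₂.M x k

  module Process (Z S₁ S₂ H₁ H₂ : ℕ) (bounded₁ : Bounds₁ Z S₁ H₁) (bounded₂ : Bounds₂ Z S₂ H₂) where

    open Bounded Z S₁ S₂ H₁ H₂ bounded₁ bounded₂
    open ComposeRuns x k Safe

    reach-p₁ : ∀ u → Reach v₁ (init₁ u) (p₁ u)
    reach-p₁ u = run-reach (proj₂ (G₁.paused-run x k) u) here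

    reach-p₂ : ∀ u → Reach v₂ (init₂ u) (p₂ u)
    reach-p₂ u = run-reach (proj₂ (G₂.paused-run x k) u) here

    save : ∀ {a c} → Prelude₂ a c → Reach v₂ (init₂ []) c → pauses (Machine.verdict G₂.M (C₂.state c)) (choiceMove (C₂.instruction c)) ≡ true →
      ∃[ n ] ∃[ z ] Run tv Safe a n (tconfig (entry-for o (C₂.state c)) z initial₁ (C₂.work c) unread) ×
        Tracks (1 + Z) z (blankTape false) × Wellformed z × Saved (C₂.index c) (track z)
    save {a} P@(prelude {q} {z} {I} {w₂} h w s) r e
      with m , _ , ρ ← sweep initial₁ w₂ unread (2 + Z) (transit-safe initial₁-≤ (proj₁ (proj₂ (bounded₂ bare r))) z≤n) saving q
             (write (marked-cell (Tape.current z)) z) (wellformed-marked w)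
             (s≤s (≤-trans (≤-reflexive (size-write (marked-cell (Tape.current z)) z)) (≤-trans (Tracks.size-≤ h) (≤-trans (⊔-lub 1≤Z (proj₁ (bounded₂ bare r))) (n≤1+n Z))))) =
      suc m , swept z₁ , step (prelude₂-safe P r) first-step ρ ,
      tracks (swept-⊒-blank {z₁} (wellformed-marked w) (unshadowed {z} s))
        (m≤n⇒m≤n⊔o 1 (≤-trans (swept-size {z₁} (wellformed-marked w)) (s≤s (≤-trans (≤-reflexive (size-write (marked-cell (Tape.current z)) z)) (≤-trans (Tracks.size-≤ h) (⊔-lub 1≤Z (proj₁ (bounded₂ bare r)))))))) ,
      wellformed-swept (wellformed-marked w) , marked-saved {z} w s (Tracks.covers h)
      where
      z₁ = write (marked-cell (Tape.current z)) z
      cs₁ = Vec.map Tape.current initial₁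
      cs₂ = Vec.map Tape.current w₂
      i′ = Machine.δ G₂.M q (symbolAt x k (mapTape proj₁ z)) (proj₁ (Tape.current z)) nothing cs₂
      first-step : tv (tconfig (pre₂ q) z initial₁ w₂ unread) ≡ det (tconfig (goRight saving q) z₁ initial₁ w₂ unread)
      first-step = control-view (goRight saving q) (marked-cell (Tape.current z) , stay) stay {pre₂ q} {z} {initial₁} {w₂} {unread} refl
        (cong (λ b → choose b (control (goRight saving q) (marked-cell (Tape.current z) , stay) stay cs₁ cs₂) (follow₂ (pre₂ (next i′)) i′ (Tape.current z) cs₁))
          (trans (cong (λ i → pauses (Machine.verdict G₂.M q) (choiceMove i)) (instruction₂ {q} {z} {I} w₂ unread (Tracks.covers h))) e))

    pausing : ∀ {h m} → (∃[ b ] h ≡ just b) ⊎ (h ≡ nothing × m ≡ right) → pauses h m ≡ true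
    pausing (inj₁ (b , refl))    = refl
    pausing (inj₂ (refl , refl)) = refl

    pauses₂ : pauses (Machine.verdict G₂.M (C₂.state (p₂ []))) (choiceMove (C₂.instruction (p₂ []))) ≡ true
    pauses₂ = pausing (Sum.map id (λ h → h []) (G₂.paused-at x k))

    pauses₁ : pauses (Machine.verdict G₁.M (C₁.state (p₁ []))) (choiceMove (C₁.instruction (p₁ []))) ≡ true
    pauses₁ = pausing (Sum.map id (λ h → h []) (G₁.paused-at x k))

    r₀ : Machine.Q G₂.M
    r₀ = C₂.state (p₂ [])

    J₀ : Tape Bool
    J₀ = C₂.index (p₂ [])

    w₀ : Works₂
    w₀ = C₂.work (p₂ [])

    w₀≤ : sizes w₀ ≤ S₂
    w₀≤ = proj₁ (proj₂ (bounded₂ bare (reach-p₂ [])))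

    abstract
      entered : ∃[ n ] ∃[ z ] Run tv Safe (tinitial []) n (tconfig (entry-for o r₀) z initial₁ w₀ unread) ×
        Tracks (1 + Z) z (blankTape false) × Wellformed z × Saved J₀ (track z)
      entered with a , ρ , P ← prelude₂-run (prelude {z = blankTape (false , just (true , false , false))} (tracks (padded 0) ≤-refl) (inside first []) (refl ∷ [])) here
                                 (proj₂ (G₂.paused-run x k) [])
              with m , z , ρ′ , h ← save P (reach-p₂ []) pauses₂ =
        _ , z , step boot-safe (control-view (pre₂ (Machine.start G₂.M)) ((false , just (true , false , false)) , stay) stay {boot} {blankTape blank₀} refl refl) (ρ +++ ρ′) , h
        where
        boot-safe : Safe (tinitial [])
        boot-safe = safe-by (s≤s z≤n) initial₁-≤ (proj₁ (proj₂ (bounded₂ bare here))) z≤n λ _ ()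

    resumed : ∀ u → p₂ u ≡ C₂.config r₀ J₀ w₀ (choiceTape u [])
    resumed u = G₂.paused-on x k u

    closing : Tape Cell₂ → Works₁ → List Bool → Bool → TConfig
    closing z w₁ us b = tconfig (close r₀) z w₁ w₀ (choiceTape (b ∷ us) [])

    module Closing {z : Tape Cell₂} {w₁ : Works₁} {us : List Bool} (w : Wellformed z) (s : Saved J₀ (track z)) (z≤ : size z ≤ 1 + Z) (w₁≤ : sizes w₁ ≤ S₁) (us≤ : length us ≤ 2 + H₁) where

      bits-bound : ∀ b → bitsRead (choiceTape (b ∷ us) []) ≤ 3 + (H₁ + H₂)
      bits-bound b = ≤-trans (≤-reflexive (cong suc (+-identityʳ (length us)))) (≤-trans (s≤s us≤) (+-monoʳ-≤ 3 (m≤m+n H₁ H₂)))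

      static-safe : ∀ {st} → (∀ {b} → verdict′ st ≡ nothing → Op.move (current-op x k (tconfig st z w₁ w₀ (choiceTape (b ∷ us) []))) ≢ left) →
        ∀ b → Safe (tconfig st z w₁ w₀ (choiceTape (b ∷ us) []))
      static-safe l b = safe-by (≤-trans z≤ (n≤1+n _)) w₁≤ w₀≤ (bits-bound b) λ e e′ → contradiction e′ (l e)

      close-safe : ∀ b → Safe (closing z w₁ us b)
      close-safe true  = static-safe (λ { {true} _ () ; {false} _ () }) true
      close-safe false = static-safe (λ { {true} _ () ; {false} _ () }) false

      refused : tv (closing z w₁ us false) ≡ det (tconfig fail z w₁ w₀ (choiceTape (false ∷ us) []))
      refused = control-view fail (Tape.current z , stay) stay {close r₀} {z} {w₁} {w₀} {choiceTape (false ∷ us) []} refl refl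

      fail-safe : Safe (tconfig fail z w₁ w₀ (choiceTape (false ∷ us) []))
      fail-safe = static-safe (λ ()) false

      abstract
        -- The prefix of the second machine was run on an unread choice tape, yet the machine
        -- continues as if started on `true ∷ us`: by `paused-on` the paused configuration depends
        -- on that tape only in its choice component.
        resume : ∃[ n ] ∃[ a ] n ≤ 3 * Z + 6 × Run tv Safe (closing z w₁ us true) (suc n) a × Active₂ (2 + Z) w₁ a (p₂ (true ∷ us))
        resume with n , z′ , n≤ , ρ , h ← load {w₁} {w₀} {choiceTape (true ∷ us) []} w₁≤ w₀≤ (bits-bound true) {r₀} w s z≤ =
          n , _ , ≤-trans n≤ (+-monoʳ-≤ (3 * Z) (n≤1+n 5)) ,
          step (close-safe true) (control-view (goRight loading r₀) (Tape.current z , stay) stay {close r₀} {z} {w₁} {w₀} {choiceTape (true ∷ us) []} refl refl) ρ ,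
          subst (Active₂ (2 + Z) w₁ _) (sym (resumed (true ∷ us))) (active h)

      close→ : ∀ {bs} → Acc v₂ (init₂ []) bs → Acc tv (closing z w₁ us true) bs
      close→ {bs} p with _ , _ , _ , ρ , A ← resume = run-acc ρ (Bisimulation.acc← (Active₂ (2 + Z) w₁) (λ _ _ → active₂-rel) A
        (proj₁ (acc-run (proj₂ (G₂.paused-run x k) (true ∷ us)) (Equivalence.from (G₂.language x k marker bs) p))))

      close← : ∀ b {ws} → Acc tv (closing z w₁ us b) ws → b ≡ true × Acc v₂ (init₂ []) ws
      close← false p = contradiction (proj₁ (acc-det refused p)) (not-rejected refl)
      close← true {ws} p with _ , _ , _ , ρ , A ← resume = refl , Equivalence.to (G₂.language x k marker ws)
        (run-acc (proj₂ (G₂.paused-run x k) (true ∷ us)) (Bisimulation.acc→ (Active₂ (2 + Z) w₁) (λ _ _ → active₂-rel) A (proj₁ (acc-run ρ p))))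

      close-within : ∀ {n} → Within v₂ n (p₂ (true ∷ us)) → ∀ b → Within tv (3 * Z + 7 + n) (closing z w₁ us b)
      close-within {n} h false = within-≤ (≤-trans (s≤s z≤n) (≤-trans (m≤n+m 1 (3 * Z + 6)) (≤-trans (≤-reflexive (+-assoc (3 * Z) 6 1)) (m≤m+n _ n)))) (det {n = 0} refused (halt refl))
      close-within {n} h true with m , _ , m≤ , ρ , A ← resume = within-≤ (+-monoˡ-≤ n (≤-trans (s≤s m≤) (≤-reflexive (sym (+-suc (3 * Z) 6)))))
        (run-within ρ (Bisimulation.within← (Active₂ (2 + Z) w₁) (λ _ _ → active₂-rel) A h))

    A₁ : TConfig → C₁.Config → Set
    A₁ = Active₁ (λ q → run₁ q r₀) (1 + Z) J₀ w₀

    -- In a product the move after acceptance is a branching because, by `at-end`, no visited cell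
    -- lies to the right of the head. Otherwise an old bit would be taken for the separator.
    data Accepting (u : List Bool) (a : TConfig) : Set where
      ends      : o ≡ sum → tv a ≡ halt true → Accepting u a
      continues : ∀ {z w₁ us} → o ≡ product → tv a ≡ branch (closing z w₁ us) → Wellformed z → Saved J₀ (track z) →
                  size z ≤ 1 + Z → sizes w₁ ≤ S₁ → length us ≤ length u + H₁ → Accepting u a

    accepting : ∀ {u a c} → A₁ a c → Base u → Reach v₁ (init₁ u) c → v₁ c ≡ halt true → Accepting u a
    accepting {u} (active {q} {z} {I} {w₁} {choiceTape us ds} h w s) base r e = by-operation o refl ds (G₁.at-end x k base r e) r
      where
      v≡ : Machine.verdict G₁.M q ≡ just true
      v≡ = Paths.halt-view G₁.M x k {C₁.config q I w₁ (choiceTape us ds)} e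
      by-operation : ∀ o′ → o ≡ o′ → ∀ ds → ds ≡ [] → Reach v₁ (init₁ u) (C₁.config q I w₁ (choiceTape us ds)) →
        Accepting u (tconfig (run₁ q r₀) z w₁ w₀ (choiceTape us ds))
      by-operation sum p ds _ _ = ends p (tview-halt x k (tconfig (run₁ q r₀) z w₁ w₀ (choiceTape us ds)) (cong₂ conclude p v≡))
      by-operation product p [] refl r with i≤ , w≤ , t≤ ← bounded₁ base r = continues p
        (control-view (close r₀) (Tape.current z , stay) right {run₁ q r₀} {z} {w₁} {w₀} {choiceTape us []} (cong₂ conclude p v≡)
          (cong (λ b → choose (isJustTrue b) (control (close r₀) (Tape.current z , stay) right cs₁ cs₂) (follow₁ (run₁ (next i′) r₀) i′ (Tape.current z) cs₂)) v≡))
        w s (≤-trans (Tracks.size-≤ h) (⊔-lub ≤-refl (m≤n⇒m≤1+n i≤))) w≤ (≤-trans (≤-reflexive (sym (+-identityʳ (length us)))) t≤)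
        where
        cs₁ = Vec.map Tape.current w₁
        cs₂ = Vec.map Tape.current w₀
        i′ = Machine.δ G₁.M q (symbolAt x k (mapTape proj₁ z)) (proj₁ (Tape.current z)) (List.head us) cs₁

    abstract
      related₁ : ∀ {a c} → A₁ a c → v₁ c ≢ halt true → ViewRel A₁ (tv a) (v₁ c)
      related₁ A@(active {q} {z} {I} {w₁} {t} _ _ _) n = active₁-rel A λ e → n (Paths.view-halt G₁.M x k {C₁.config q I w₁ t} e)

      related-sum : o ≡ sum → ∀ {a c} → A₁ a c → ViewRel A₁ (tv a) (v₁ c)
      related-sum p {a} {c} A@(active {q} {z} {I} {w₁} {t} _ _ _) = by (Machine.verdict G₁.M q) refl
        where
        by : ∀ h → Machine.verdict G₁.M q ≡ h → ViewRel A₁ (tv a) (v₁ c)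
        by (just true)  e = subst₂ (ViewRel A₁) (sym (tview-halt x k a (cong₂ conclude p e))) (sym (Paths.view-halt G₁.M x k {c} e)) halt
        by (just false) e = active₁-rel A λ e′ → contradiction (trans (sym e) e′) λ ()
        by nothing      e = active₁-rel A λ e′ → contradiction (trans (sym e) e′) λ ()

    first-safe : ∀ {u a c} → A₁ a c → Base u → length u ≤ 2 → Reach v₁ (init₁ u) c → Safe a
    first-safe (active {q} {z} {I} {w₁} {t} h _ _) base u≤ r =
      follow₁-safe {z = z} (n≤1+n _) h w₀≤ base (+-mono-≤ (m≤n⇒m≤1+n u≤) (m≤m+n H₁ H₂)) r
        λ e l → let e₁ , e₂ = by o (Machine.verdict G₁.M q) e l in
          e₁ , trans (cong choiceMove (sym (instruction₁ {q} {z} {I} w₁ t (Tracks.covers h)))) e₂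
      where
      by : ∀ o h {b : TOp} → conclude o h ≡ nothing → Op.move (choose (isJustTrue h) (control (close r₀) (Tape.current z , stay) right (Vec.map Tape.current w₁) (Vec.map Tape.current w₀)) b) ≡ left →
        h ≡ nothing × Op.move b ≡ left
      by o       nothing      e l = refl , l
      by sum     (just false) () l
      by product (just false) () l
      by o       (just true)  e ()

    second-safe : ∀ {u w₁ a c} → Active₂ (2 + Z) w₁ a c → sizes w₁ ≤ S₁ → Base u → length u ≤ 3 + H₁ → Reach v₂ (init₂ u) c → Safe a
    second-safe (active {q} {z} {I} {w₂} {t} h) w≤ base u≤ r =
      follow₂-safe {z = z} ≤-refl h w≤ base (≤-trans (+-monoˡ-≤ H₂ u≤) (≤-reflexive (+-assoc 3 H₁ H₂))) r
        λ e l → e , trans (cong choiceMove (sym (instruction₂ {q} {z} {I} w₂ t (Tracks.covers h)))) l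

    data Key (a : TConfig) : Set where
      first  : ∀ {u c} → A₁ a c → Base u → length u ≤ 2 → Reach v₁ (init₁ u) c → Key a
      second : ∀ {u w₁ c} → Active₂ (2 + Z) w₁ a c → sizes w₁ ≤ S₁ → Base u → length u ≤ 3 + H₁ → Reach v₂ (init₂ u) c → Key a
      fork   : ∀ {f} → Safe a → tv a ≡ branch f → (∀ b → Key (f b)) → Key a
      join   : ∀ {n a′} → Run tv Safe a (suc n) a′ → Key a′ → Key a
      stop   : ∀ {b} → Safe a → tv a ≡ halt b → Key a

    close-key : ∀ {z w₁ us} → Wellformed z → Saved J₀ (track z) → size z ≤ 1 + Z → sizes w₁ ≤ S₁ → length us ≤ 2 + H₁ →
      ∀ b → Key (closing z w₁ us b)
    close-key {us = us} w s z≤ w≤ us≤ true with _ , _ , _ , ρ , A ← Closing.resume {us = us} w s z≤ w≤ us≤ =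
      join ρ (second A w≤ marker (s≤s us≤) (reach-p₂ (true ∷ us)))
    close-key {us = us} w s z≤ w≤ us≤ false = join (step (Closing.close-safe {us = us} w s z≤ w≤ us≤ false) (Closing.refused {us = us} w s z≤ w≤ us≤) [])
      (stop (Closing.fail-safe {us = us} w s z≤ w≤ us≤) refl)

    progress : ∀ {a} → Key a → Progress {v = tv} Safe Key a
    progress (fork s e h) = branches s e h
    progress (join r h)   = runs r h
    progress (stop s e)   = halts s e
    progress (second {c = c} A w≤ base u≤ r) with v₂ c in e
    ... | halt b = halts (second-safe A w≤ base u≤ r) (halt-rel′ (active₂-rel A) e)
    ... | det c′ with _ , e′ , A′ ← det-rel′ (active₂-rel A) e = runs (step (second-safe A w≤ base u≤ r) e′ []) (second A′ w≤ base u≤ (reach-det r e))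
    ... | branch f with _ , e′ , A′ ← branch-rel′ (active₂-rel A) e =
      branches (second-safe A w≤ base u≤ r) e′ λ b → second (A′ b) w≤ base u≤ (reach-branch r e b)
    progress (first {c = c} A base u≤ r) with v₁ c in e
    ... | halt false = halts (first-safe A base u≤ r) (halt-rel′ (related₁ A λ e′ → contradiction (trans (sym e) e′) λ ()) e)
    ... | det c′ with _ , e′ , A′ ← det-rel′ (related₁ A λ e′ → contradiction (trans (sym e) e′) λ ()) e =
      runs (step (first-safe A base u≤ r) e′ []) (first A′ base u≤ (reach-det r e))
    ... | branch f with _ , e′ , A′ ← branch-rel′ (related₁ A λ e′ → contradiction (trans (sym e) e′) λ ()) e =
      branches (first-safe A base u≤ r) e′ λ b → first (A′ b) base u≤ (reach-branch r e b)
    ... | halt true with accepting A base r e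
    ...   | ends _ e′ = halts (first-safe A base u≤ r) e′
    ...   | continues {us = us} _ e′ w s z≤ w≤ us≤ = branches (first-safe A base u≤ r) e′ (close-key {us = us} w s z≤ w≤ (≤-trans us≤ (+-monoˡ-≤ H₁ u≤)))

    product→ : o ≡ product → ∀ {u a c us vs} → A₁ a c → Base u → length u ≤ 2 → Reach v₁ (init₁ u) c →
      Acc v₁ c us → Acc v₂ (init₂ []) vs → Acc tv a (us ++ true ∷ vs)
    product→ p A base u≤ r (done e) q with accepting A base r e
    ... | ends p′ _ with () ← trans (sym p) p′
    ... | continues {us = us} _ e′ w s z≤ w≤ us≤ = branch e′ true (Closing.close→ {us = us} w s z≤ w≤ (≤-trans us≤ (+-monoˡ-≤ H₁ u≤)) q)
    product→ p A base u≤ r (det e a) q with _ , e′ , A′ ← det-rel′ (related₁ A λ e′ → contradiction (trans (sym e) e′) λ ()) e =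
      det e′ (product→ p A′ base u≤ (reach-det r e) a q)
    product→ p A base u≤ r (branch e b a) q with _ , e′ , A′ ← branch-rel′ (related₁ A λ e′ → contradiction (trans (sym e) e′) λ ()) e =
      branch e′ b (product→ p (A′ b) base u≤ (reach-branch r e b) a q)

    product← : o ≡ product → ∀ N {u a c ws} → A₁ a c → Base u → length u ≤ 2 → Reach v₁ (init₁ u) c →
      (q : Acc tv a ws) → len q ≤ N → ∃[ us ] ∃[ vs ] ws ≡ us ++ true ∷ vs × Acc v₁ c us × Acc v₂ (init₂ []) vs
    product← p N {c = c} A base u≤ r q l with v₁ c in e
    ... | halt false = contradiction q (not-rejected (halt-rel′ (related₁ A λ e′ → contradiction (trans (sym e) e′) λ ()) e))
    product← p N A base u≤ r q l | halt true with accepting A base r e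
    ... | ends p′ _ with () ← trans (sym p) p′
    ... | continues {us = us} _ e′ w s z≤ w≤ us≤ with b , vs , refl , q′ , _ ← acc-branch e′ q
      with refl , q″ ← Closing.close← {us = us} w s z≤ w≤ (≤-trans us≤ (+-monoˡ-≤ H₁ u≤)) b q′ = [] , vs , refl , done e , q″
    product← p N A base u≤ r q l | det c′ with _ , e′ , A′ ← det-rel′ (related₁ A λ e′ → contradiction (trans (sym e) e′) λ ()) e
      with acc-det e′ q
    product← p (suc N) A base u≤ r q l | det c′ | q′ , l′
      with us , vs , w≡ , a , a′ ← product← p N A′ base u≤ (reach-det r e) q′ (≤-pred (≤-trans (≤-reflexive (sym l′)) l)) = us , vs , w≡ , det e a , a′
    product← p zero A base u≤ r q l | det c′ | q′ , l′ with () ← ≤-trans (≤-reflexive (sym l′)) l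
    product← p N A base u≤ r q l | branch f with _ , e′ , A′ ← branch-rel′ (related₁ A λ e′ → contradiction (trans (sym e) e′) λ ()) e
      with acc-branch e′ q
    product← p (suc N) A base u≤ r q l | branch f | b , _ , refl , q′ , l′
      with us , vs , w≡ , a , a′ ← product← p N (A′ b) base u≤ (reach-branch r e b) q′ (≤-pred (≤-trans (≤-reflexive (sym l′)) l)) =
      b ∷ us , vs , cong (b ∷_) w≡ , branch e b a , a′
    product← p zero A base u≤ r q l | branch f | b , _ , refl , q′ , l′ with () ← ≤-trans (≤-reflexive (sym l′)) l

    -- The bound `m` must be uniform in `us`, since the bits left behind by the first machine are
    -- not known in advance. The 8 is the 7 of `close-within` and one step for revealing the
    -- separator.
    first-within : ∀ {n m u a c} → A₁ a c → Base u → length u ≤ 2 → Reach v₁ (init₁ u) c → (∀ us → Within v₂ m (p₂ (true ∷ us))) →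
      Within v₁ n c → Within tv (n + (3 * Z + 8 + m)) a
    first-within {n} {m} A base u≤ r h (halt {b = true} e) with accepting A base r e
    ... | ends _ e′ = halt e′
    ... | continues {us = us} _ e′ w s z≤ w≤ us≤ = within-≤ (≤-trans (≤-reflexive (cong (_+ m) (sym (+-suc (3 * Z) 7)))) (m≤n+m _ n))
      (branch e′ (Closing.close-within {us = us} w s z≤ w≤ (≤-trans us≤ (+-monoˡ-≤ H₁ u≤)) (h us)))
    first-within A base u≤ r h (halt {b = false} e) = halt (halt-rel′ (related₁ A λ e′ → contradiction (trans (sym e) e′) λ ()) e)
    first-within A base u≤ r h (det e w) with _ , e′ , A′ ← det-rel′ (related₁ A λ e′ → contradiction (trans (sym e) e′) λ ()) e =
      det e′ (first-within A′ base u≤ (reach-det r e) h w)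
    first-within A base u≤ r h (branch e w) with _ , e′ , A′ ← branch-rel′ (related₁ A λ e′ → contradiction (trans (sym e) e′) λ ()) e =
      branch e′ λ b → first-within (A′ b) base u≤ (reach-branch r e b) h (w b)

    first-run : ∀ {a c c′ n} → A₁ a c → Run v₁ Any c n c′ → ∃[ a′ ] Run tv Any a n a′ × A₁ a′ c′
    first-run A [] = _ , [] , A
    first-run A (step _ e ρ) with _ , e′ , A′ ← det-rel′ (related₁ A λ e′ → contradiction (trans (sym e) e′) λ ()) e
      with a′ , ρ′ , A″ ← first-run A′ ρ = a′ , step tt e′ ρ′ , A″

words-≡ : ∀ {S : Set} {v : S → View S} {s ws ws′} {a : Acc v s ws} {a′ : Acc v s ws′} → ws ≡ ws′ →
  _≡_ {A = ∃[ ws ] Acc v s ws} (ws , a) (ws′ , a′)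
words-≡ refl = cong (_ ,_) (acc-unique _ _)

Combine : Operation → Set → Set → Set
Combine sum     = _⊎_
Combine product = _×_

-- A common interface to both operations. `Z` is any bound on the index tapes of the components and
-- is left open, as two different ones are needed.
record Facts {C F₁ F₂} (o : Operation) (G₁ : Good C F₁) (G₂ : Good C F₂) (x : Word) (k Z S₁ S₂ H₁ H₂ : ℕ)
  (bounded₁ : CompositeRuns.Bounds₁ o (Good.M G₁) (Good.M G₂) x k Z S₁ H₁)
  (bounded₂ : CompositeRuns.Bounds₂ o (Good.M G₁) (Good.M G₂) x k Z S₂ H₂) : Set where
  open Compile (Compose.typed o (Good.M G₁) (Good.M G₂)) using (TConfig; tview; tinitial)
  open CompositeRuns.Bounded o (Good.M G₁) (Good.M G₂) x k Z S₁ S₂ H₁ H₂ bounded₁ bounded₂ using (Safe)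
  field
    all-safe : ∀ {a} → Reach (tview x k) (tinitial []) a → Safe a
    words    : (∃[ ws ] Acc (tview x k) (tinitial []) ws) ↔
               Combine o (∃[ us ] Acc (Good.v G₁ x k) (initialOn (Good.M G₁) x k []) us)
                         (∃[ vs ] Acc (Good.v G₂ x k) (initialOn (Good.M G₂) x k []) vs)
    tail     : ∀ {n m} → (∀ {u} → Base u → Within (Good.v G₁ x k) n (Good.paused G₁ x k u)) →
               (∀ {u} → Base u → Within (Good.v G₂ x k) m (Good.paused G₂ x k u)) →
               ∃[ l ] ∃[ a ] Run (tview x k) Any (tinitial []) l a × Within (tview x k) (9 + 3 * Z + (n + m)) a

module _ {C F₁ F₂} (G₁ : Good C F₁) (G₂ : Good C F₂) (x : Word) (k Z S₁ S₂ H₁ H₂ : ℕ) where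

  module ProductFacts (bounded₁ : CompositeRuns.Bounds₁ product (Good.M G₁) (Good.M G₂) x k Z S₁ H₁)
                      (bounded₂ : CompositeRuns.Bounds₂ product (Good.M G₁) (Good.M G₂) x k Z S₂ H₂) where

    open Compose product (Good.M G₁) (Good.M G₂) using (typed; run₁)
    open Compile typed using (TConfig; tinitial; tconfig)
    open Composite product (Good.M G₁) (Good.M G₂) x k using (tv; v₁; v₂; active)
    open Combined product G₁ G₂ x k using (module Process; p₁; p₂)
    open Process Z S₁ S₂ H₁ H₂ bounded₁ bounded₂
    open CompositeRuns.Bounded product (Good.M G₁) (Good.M G₂) x k Z S₁ S₂ H₁ H₂ bounded₁ bounded₂ using (Safe; initial₁)

    Words₁ = ∃[ us ] Acc v₁ (initialOn (Good.M G₁) x k []) us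
    Words₂ = ∃[ vs ] Acc v₂ (initialOn (Good.M G₂) x k []) vs

    module Entered {l a₁} (ρ : Run tv Safe (tinitial []) l a₁) (A : A₁ a₁ (initialOn (Good.M G₁) x k [])) where

      all-safe : ∀ {a} → Reach tv (tinitial []) a → Safe a
      all-safe r with reach-run ρ r
      ... | inj₁ p  = p
      ... | inj₂ r′ = safe progress (first A bare z≤n here) r′

      abstract
       split : ∀ {ws} → Acc tv (tinitial []) ws → ∃[ us ] ∃[ vs ] ws ≡ us ++ true ∷ vs ×
         Acc v₁ (initialOn (Good.M G₁) x k []) us × Acc v₂ (initialOn (Good.M G₂) x k []) vs
       split p = product← refl _ A bare z≤n here (proj₁ (acc-run ρ p)) ≤-refl

       joined : ∀ {us vs} → Acc v₁ (initialOn (Good.M G₁) x k []) us → Acc v₂ (initialOn (Good.M G₂) x k []) vs →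
         Acc tv (tinitial []) (us ++ true ∷ vs)
       joined q r = run-acc ρ (product→ refl A bare z≤n here q r)

      to : (∃[ ws ] Acc tv (tinitial []) ws) → Words₁ × Words₂
      to (_ , p) = let us , vs , _ , q , r = split p in (us , q) , (vs , r)

      combine : Words₁ × Words₂ → ∃[ ws ] Acc tv (tinitial []) ws
      combine ((us , q) , (vs , r)) = us ++ true ∷ vs , joined q r

      to-combine : ∀ y → to (combine y) ≡ y
      to-combine ((us , q) , (vs , r)) with us′ , vs′ , e , q′ , r′ ← split (joined q r)
        -- A priori `split` might cut the word at another `true`; prefix-freeness of the first
        -- language excludes this.
        with refl ← acc-prefix-free q q′ e =
        cong₂ _,_ (words-≡ refl) (words-≡ (sym (proj₂ (List.∷-injective (List.++-cancelˡ us _ _ e)))))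

      combine-to : ∀ y → combine (to y) ≡ y
      combine-to (_ , p) = words-≡ (sym (proj₁ (proj₂ (proj₂ (split p)))))

      tail : ∀ {n m} → (∀ {u} → Base u → Within v₁ n (p₁ u)) → (∀ {u} → Base u → Within v₂ m (p₂ u)) →
        ∃[ l ] ∃[ a ] Run tv Any (tinitial []) l a × Within tv (9 + 3 * Z + (n + m)) a
      tail {n} {m} h h′ with a , ρ′ , A′ ← first-run A (proj₂ (Good.paused-run G₁ x k) []) =
        _ , a , weaken _ ρ +++ ρ′ , within-≤ (≤-trans (n≤1+n _) (≤-reflexive (count n m (3 * Z))))
          (first-within A′ bare z≤n (reach-p₁ []) (λ us → h′ marker) (h bare))
        where
        count : ∀ n m z → 1 + (n + (z + 8 + m)) ≡ 9 + z + (n + m)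
        count = solve-∀

      result : Facts product G₁ G₂ x k Z S₁ S₂ H₁ H₂ bounded₁ bounded₂
      result = record { all-safe = all-safe ; words = mk↔ₛ′ to combine to-combine combine-to ; tail = tail }

    product-facts : Facts product G₁ G₂ x k Z S₁ S₂ H₁ H₂ bounded₁ bounded₂
    product-facts = let _ , _ , ρ , h , w , s = entered in Entered.result ρ (active h w s)

  module SumFacts (bounded₁ : CompositeRuns.Bounds₁ sum (Good.M G₁) (Good.M G₂) x k Z S₁ H₁)
                  (bounded₂ : CompositeRuns.Bounds₂ sum (Good.M G₁) (Good.M G₂) x k Z S₂ H₂) where

    open Compose sum (Good.M G₁) (Good.M G₂)
    open Compile typed using (TConfig; tinitial; tconfig; current-op)
    open Composite sum (Good.M G₁) (Good.M G₂) x k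
    open Combined sum G₁ G₂ x k using (module Process; p₁; p₂)
    open Process Z S₁ S₂ H₁ H₂ bounded₁ bounded₂
    open CompositeRuns.Bounded sum (Good.M G₁) (Good.M G₂) x k Z S₁ S₂ H₁ H₂ bounded₁ bounded₂
    open ComposeRuns x k Safe using (control-view)
    open Instruction

    record Picking (a : TConfig) (c : C₁.Config) : Set where
      field
        z      : Tape Cell₂
        branches-≡ : tv a ≡ branch (λ b → tconfig (pick (C₁.state c) r₀) z (C₁.work c) w₀ (choiceTape (b ∷ []) []))
        tracked : Tracks (1 + Z) z (C₁.index c)
        formed  : Wellformed z
        saved   : Saved J₀ (track z)

    picking : ∀ {a c} → Prelude₁ r₀ J₀ w₀ a c → pauses (Machine.verdict (Good.M G₁) (C₁.state c)) (choiceMove (C₁.instruction c)) ≡ true → Picking a c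
    picking (prelude {q} {z} {I} {w₁} h w s) e = record { z = z ; tracked = h ; formed = w ; saved = s ; branches-≡ =
      control-view (pick q r₀) (Tape.current z , stay) right {pre₁ q r₀} {z} {w₁} {w₀} {unread} refl
        (cong (λ b → choose b (control (pick q r₀) (Tape.current z , stay) right cs₁ cs₂) (follow₁ (pre₁ (next i′) r₀) i′ (Tape.current z) cs₂))
          (trans (cong (λ i → pauses (Machine.verdict (Good.M G₁) q) (choiceMove i)) (instruction₁ {q} {z} {I} w₁ unread (Tracks.covers h))) e)) }
      where
      cs₁ = Vec.map Tape.current w₁
      cs₂ = Vec.map Tape.current w₀
      i′ = Machine.δ (Good.M G₁) q (Compile.symbolAt typed x k (mapTape proj₁ z)) (proj₁ (Tape.current z)) nothing cs₁

    reached : ∃[ n ] ∃[ a ] Run tv Safe (tinitial []) n a × Prelude₁ r₀ J₀ w₀ a (p₁ [])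
    reached with _ , z , ρ , h , w , s ← entered
      with a , ρ′ , P ← prelude₁-run w₀≤ (prelude h w s) here (proj₂ (Good.paused-run G₁ x k) []) = _ , a , ρ +++ ρ′ , P

    Words₁ = ∃[ us ] Acc v₁ (initialOn (Good.M G₁) x k []) us
    Words₂ = ∃[ vs ] Acc v₂ (initialOn (Good.M G₂) x k []) vs

    module Reached {l a₀} (ρ : Run tv Safe (tinitial []) l a₀) (P₀ : Prelude₁ r₀ J₀ w₀ a₀ (p₁ [])) (pick₀ : Picking a₀ (p₁ [])) where

      open Picking pick₀
      w₁ = C₁.work (p₁ [])

      w₁≤ : sizes w₁ ≤ S₁
      w₁≤ = proj₁ (proj₂ (bounded₁ bare (reach-p₁ [])))

      z≤ : size z ≤ 1 + Z
      z≤ = ≤-trans (Tracks.size-≤ tracked) (⊔-lub ≤-refl (m≤n⇒m≤1+n (proj₁ (bounded₁ bare (reach-p₁ [])))))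

      picked : Bool → TConfig
      picked b = tconfig (pick (C₁.state (p₁ [])) r₀) z w₁ w₀ (choiceTape (b ∷ []) [])

      picked-safe : ∀ b → Safe (picked b)
      picked-safe true  = safe-by (m≤n⇒m≤1+n z≤) w₁≤ w₀≤ (s≤s z≤n) λ _ ()
      picked-safe false = safe-by (m≤n⇒m≤1+n z≤) w₁≤ w₀≤ (s≤s z≤n) λ _ ()

      launched : TConfig
      launched = tconfig (run₁ (C₁.state (p₁ [])) r₀) z w₁ w₀ (choiceTape (true ∷ []) [])

      launched-≡ : tv (picked true) ≡ det launched
      launched-≡ = control-view (run₁ (C₁.state (p₁ [])) r₀) (Tape.current z , stay) stay {pick (C₁.state (p₁ [])) r₀} {z} {w₁} {w₀} {choiceTape (true ∷ []) []} refl refl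

      skipped-≡ : tv (picked false) ≡ branch (closing z w₁ (false ∷ []))
      skipped-≡ = control-view (close r₀) (Tape.current z , stay) right {pick (C₁.state (p₁ [])) r₀} {z} {w₁} {w₀} {choiceTape (false ∷ []) []} refl refl

      A : A₁ launched (p₁ (true ∷ []))
      A = subst (A₁ launched) (sym (Good.paused-on G₁ x k (true ∷ []))) (active tracked formed saved)

      module Skip = Closing {z} {w₁} {false ∷ []} formed saved z≤ w₁≤ (s≤s z≤n)

      key : Key a₀
      key = fork (prelude₁-safe w₀≤ P₀ (reach-p₁ [])) branches-≡ λ
        { true  → join (step (picked-safe true) launched-≡ []) (first A marker (s≤s z≤n) (reach-p₁ (true ∷ [])))
        ; false → fork (picked-safe false) skipped-≡ (close-key {us = false ∷ []} formed saved z≤ w₁≤ (s≤s z≤n)) }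

      all-safe : ∀ {a} → Reach tv (tinitial []) a → Safe a
      all-safe r with reach-run ρ r
      ... | inj₁ p  = p
      ... | inj₂ r′ = safe progress key r′

      module Resumed = Bisimulation A₁ (λ _ _ → related-sum refl)

      Split : List Bool → Set
      Split ws = (∃[ us ] ws ≡ true ∷ us × Acc v₁ (initialOn (Good.M G₁) x k []) us) ⊎
                 (∃[ vs ] ws ≡ false ∷ true ∷ vs × Acc v₂ (initialOn (Good.M G₂) x k []) vs)

      abstract
       split : ∀ {ws} → Acc tv (tinitial []) ws → Split ws
       split p with acc-branch branches-≡ (proj₁ (acc-run ρ p))
       ... | true , us , refl , q , _ = inj₁ (us , refl , Equivalence.to (Good.language G₁ x k marker us)
         (run-acc (proj₂ (Good.paused-run G₁ x k) (true ∷ [])) (Resumed.acc→ A (proj₁ (acc-det launched-≡ q)))))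
       ... | false , _ , refl , q , _ with b , vs , refl , r , _ ← acc-branch skipped-≡ q with refl , r′ ← Skip.close← b r =
         inj₂ (vs , refl , r′)

       joined₁ : ∀ {us} → Acc v₁ (initialOn (Good.M G₁) x k []) us → Acc tv (tinitial []) (true ∷ us)
       joined₁ {us} q = run-acc ρ (branch branches-≡ true (det launched-≡ (Resumed.acc← A
         (proj₁ (acc-run (proj₂ (Good.paused-run G₁ x k) (true ∷ [])) (Equivalence.from (Good.language G₁ x k marker us) q))))))

       joined₂ : ∀ {vs} → Acc v₂ (initialOn (Good.M G₂) x k []) vs → Acc tv (tinitial []) (false ∷ true ∷ vs)
       joined₂ q = run-acc ρ (branch branches-≡ false (branch skipped-≡ true (Skip.close→ q)))

      to : (∃[ ws ] Acc tv (tinitial []) ws) → Words₁ ⊎ Words₂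
      to (_ , p) = Sum.map (λ (us , _ , q) → us , q) (λ (vs , _ , q) → vs , q) (split p)

      combine : Words₁ ⊎ Words₂ → ∃[ ws ] Acc tv (tinitial []) ws
      combine (inj₁ (us , q)) = true ∷ us , joined₁ q
      combine (inj₂ (vs , q)) = false ∷ true ∷ vs , joined₂ q

      to-combine : ∀ y → to (combine y) ≡ y
      to-combine (inj₁ (us , q)) with split (joined₁ q)
      ... | inj₁ (us′ , e , q′) = cong inj₁ (words-≡ (sym (proj₂ (List.∷-injective e))))
      ... | inj₂ (vs′ , () , _)
      to-combine (inj₂ (vs , q)) with split (joined₂ q)
      ... | inj₁ (us′ , () , _)
      ... | inj₂ (vs′ , e , q′) = cong inj₂ (words-≡ (sym (proj₂ (List.∷-injective (proj₂ (List.∷-injective e))))))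

      combine-to : ∀ y → combine (to y) ≡ y
      combine-to (_ , p) with split p
      ... | inj₁ (us , e , q) = words-≡ (sym e)
      ... | inj₂ (vs , e , q) = words-≡ (sym e)

      tail : ∀ {n m} → (∀ {u} → Base u → Within v₁ n (p₁ u)) → (∀ {u} → Base u → Within v₂ m (p₂ u)) →
        ∃[ l ] ∃[ a ] Run tv Any (tinitial []) l a × Within tv (9 + 3 * Z + (n + m)) a
      tail {n} {m} h h′ = _ , a₀ , weaken _ ρ , branch branches-≡ λ
        { true  → det launched-≡ (within-≤ (≤-trans (m≤m+n n m) (m≤n+m (n + m) (7 + 3 * Z))) (Resumed.within← A (h marker)))
        ; false → branch skipped-≡ λ b → within-≤ (≤-trans (m≤n+m (3 * Z + 7 + m) n) (≤-reflexive (count n m (3 * Z)))) (Skip.close-within (h′ marker) b) }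
        where
        count : ∀ n m z → n + (z + 7 + m) ≡ 7 + z + (n + m)
        count = solve-∀

      result : Facts sum G₁ G₂ x k Z S₁ S₂ H₁ H₂ bounded₁ bounded₂
      result = record { all-safe = all-safe ; words = mk↔ₛ′ to combine to-combine combine-to ; tail = tail }

    sum-facts : Facts sum G₁ G₂ x k Z S₁ S₂ H₁ H₂ bounded₁ bounded₂
    sum-facts = let _ , _ , ρ , P₀ = reached in Reached.result ρ P₀ (picking P₀ pauses₁)

facts : ∀ {C F₁ F₂} o (G₁ : Good C F₁) (G₂ : Good C F₂) x k Z S₁ S₂ H₁ H₂
  (bounded₁ : CompositeRuns.Bounds₁ o (Good.M G₁) (Good.M G₂) x k Z S₁ H₁)
  (bounded₂ : CompositeRuns.Bounds₂ o (Good.M G₁) (Good.M G₂) x k Z S₂ H₂) →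
  Facts o G₁ G₂ x k Z S₁ S₂ H₁ H₂ bounded₁ bounded₂
facts sum     G₁ G₂ x k Z S₁ S₂ H₁ H₂ = SumFacts.sum-facts G₁ G₂ x k Z S₁ S₂ H₁ H₂
facts product G₁ G₂ x k Z S₁ S₂ H₁ H₂ = ProductFacts.product-facts G₁ G₂ x k Z S₁ S₂ H₁ H₂

combine-↔ : ∀ o {A B A′ B′ : Set} → A ↔ A′ → B ↔ B′ → Combine o A B ↔ Combine o A′ B′
combine-↔ sum     i j = i ⊎-↔ j
combine-↔ product i j = i ×-↔ j

apply : Operation → ℕ → ℕ → ℕ
apply sum     = _+_
apply product = _*_

combine-Fin : ∀ o m n → Fin (apply o m n) ↔ Combine o (Fin m) (Fin n)
combine-Fin sum     m n = Fin.+↔⊎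
combine-Fin product m n = Fin.*↔×

-- Resource bounds of the composite and closure of the classes

module Closure {C : Class} {F₁ F₂ : ParamFun} (o : Operation) (G₁ : Good C F₁) (G₂ : Good C F₂) where

  open Compose o (Good.M G₁) (Good.M G₂) using (typed)
  open Compile typed using (machine; lower-initial; space-lower; instruction-lower; reach→; run←; within←; acc→; acc←; tview; tspace; tinitial; TConfig; Lowers)
    renaming (⌊_⌋ to lowered)

  f₁ = proj₁ (Good.spaceBound G₁)
  f₂ = proj₁ (Good.spaceBound G₂)
  a₁ = proj₁ (proj₂ (proj₂ (Good.spaceBound G₁)))
  a₂ = proj₁ (proj₂ (proj₂ (Good.spaceBound G₂)))
  h₁ = proj₁ (Good.bitBound G₁)
  h₂ = proj₁ (Good.bitBound G₂)

  module _ (x : Word) (k : ℕ) where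

    S₁ = a₁ * (log (length x) + f₁ k)
    S₂ = a₂ * (log (length x) + f₂ k)
    I₁ = a₁ * log (length (encode x k))
    I₂ = a₂ * log (length (encode x k))
    H₁ = h₁ k * log (length x)
    H₂ = h₂ k * log (length x)

    open CompositeRuns o (Good.M G₁) (Good.M G₂) x k using (Bounds₁; Bounds₂)

    space₁ : Bounds₁ (S₁ + S₂) S₁ H₁
    space₁ base r = let s , _ = proj₂ (proj₂ (proj₂ (Good.spaceBound G₁))) x k base r in
      ≤-trans (≤-trans (m≤m+n _ _) s) (m≤m+n S₁ S₂) , ≤-trans (m≤n+m _ _) s , proj₂ (proj₂ (Good.bitBound G₁)) x k base r

    space₂ : Bounds₂ (S₁ + S₂) S₂ H₂
    space₂ base r = let s , _ = proj₂ (proj₂ (proj₂ (Good.spaceBound G₂))) x k base r in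
      ≤-trans (≤-trans (m≤m+n _ _) s) (m≤n+m S₂ S₁) , ≤-trans (m≤n+m _ _) s , proj₂ (proj₂ (Good.bitBound G₂)) x k base r

    index₁ : Bounds₁ (I₁ + I₂) S₁ H₁
    index₁ base r = let s , i = proj₂ (proj₂ (proj₂ (Good.spaceBound G₁))) x k base r in
      ≤-trans i (m≤m+n I₁ I₂) , ≤-trans (m≤n+m _ _) s , proj₂ (proj₂ (Good.bitBound G₁)) x k base r

    index₂ : Bounds₂ (I₁ + I₂) S₂ H₂
    index₂ base r = let s , i = proj₂ (proj₂ (proj₂ (Good.spaceBound G₂))) x k base r in
      ≤-trans i (m≤n+m I₂ I₁) , ≤-trans (m≤n+m _ _) s , proj₂ (proj₂ (Good.bitBound G₂)) x k base r

    -- `ParaL` measures the index tape twice, against log|x| + f(k) and against the logarithm of the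
    -- length of the encoded input. Neither bound gives the other in general, so the invariant is
    -- instantiated with both.
    by-space = facts o G₁ G₂ x k (S₁ + S₂) S₁ S₂ H₁ H₂ space₁ space₂
    by-index = facts o G₁ G₂ x k (I₁ + I₂) S₁ S₂ H₁ H₂ index₁ index₂

    module SpaceSafe = CompositeRuns.Bounded o (Good.M G₁) (Good.M G₂) x k (S₁ + S₂) S₁ S₂ H₁ H₂ space₁ space₂
    module IndexSafe = CompositeRuns.Bounded o (Good.M G₁) (Good.M G₂) x k (I₁ + I₂) S₁ S₂ H₁ H₂ index₁ index₂

    record Reached (c : Semantics.Config machine x k) : Set where
      field
        source     : TConfig
        lowers-≡   : c ≡ lowered x k source
        space-safe : SpaceSafe.Safe source
        index-safe : IndexSafe.Safe source

    reached : ∀ {c} → Semantics._⟶*_ machine x k (Semantics.initial machine x k) c → Reached c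
    reached p = let a , r , e = reach→ x k (lower-initial x k []) (Paths.path→reach machine x k p) in
      record { source = a ; lowers-≡ = e ; space-safe = Facts.all-safe by-space r ; index-safe = Facts.all-safe by-index r }

    words : (∃[ ws ] Acc (view machine x k) (initialOn machine x k []) ws) ↔
      Combine o (∃[ us ] Acc (Good.v G₁ x k) (initialOn (Good.M G₁) x k []) us) (∃[ vs ] Acc (Good.v G₂ x k) (initialOn (Good.M G₂) x k []) vs)
    words = ↔-trans (words-↔ λ ws → mk⇔ (acc→ x k (lower-initial x k [])) (acc← x k (lower-initial x k []))) (Facts.words by-space)

    counts : #acc[ machine ]⟨ x , k ⟩≡ apply o (F₁ x k) (F₂ x k)
    counts = Paths.count← machine x k (↔-trans (combine-Fin o _ _)
      (↔-trans (combine-↔ o (Good.count G₁ x k) (Good.count G₂ x k)) (↔-sym words)))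

  paraL : ParaL machine
  paraL = (λ k → f₁ k + f₂ k) , computable-+ (proj₁ (proj₂ (Good.spaceBound G₁))) (proj₁ (proj₂ (Good.spaceBound G₂))) ,
    -- With S the sum of both space bounds, the dual tape counted twice and the work tapes give 2 *
    -- (2 + S) + S.
    3 * (a₁ + a₂) + 4 , λ x k p → space-bound x k p , index-bound x k p
    where
    module _ x k {c} (p : Semantics._⟶*_ machine x k (Semantics.initial machine x k) c) where
      open Reached (reached x k p)
      X = log (length x) + (f₁ k + f₂ k)
      S≤ : S₁ x k + S₂ x k ≤ (a₁ + a₂) * X
      S≤ = ≤-trans (+-mono-≤ (*-monoʳ-≤ a₁ (+-monoʳ-≤ (log (length x)) (m≤m+n (f₁ k) (f₂ k)))) (*-monoʳ-≤ a₂ (+-monoʳ-≤ (log (length x)) (m≤n+m (f₂ k) (f₁ k)))))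
        (≤-reflexive (sym (*-distribʳ-+ X a₁ a₂)))
      space-bound : Semantics.space machine x k c ≤ (3 * (a₁ + a₂) + 4) * X
      space-bound = +-bound (3 * (a₁ + a₂)) 4 (≤-trans (1≤log (length x)) (m≤m+n _ (f₁ k + f₂ k))) (begin
        Semantics.space machine x k c        ≡⟨ trans (cong (Semantics.space machine x k) lowers-≡) (space-lower x k source) ⟩
        tspace source                        ≤⟨ +-mono-≤ (dual-≤) (+-mono-≤ dual-≤ (+-mono-≤ work₁-≤ work₂-≤)) ⟩
        2 + S + (2 + S + S)                  ≡⟨ collect S ⟩
        3 * S + 4                            ≤⟨ +-monoˡ-≤ 4 (*-monoʳ-≤ 3 S≤) ⟩
        3 * ((a₁ + a₂) * X) + 4              ≡⟨ cong (_+ 4) (*-assoc 3 (a₁ + a₂) X) ⟨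
        3 * (a₁ + a₂) * X + 4                ∎)
        where
        open ≤-Reasoning
        open SpaceSafe.Safe x k space-safe
        S = S₁ x k + S₂ x k
        collect : ∀ s → 2 + s + (2 + s + s) ≡ 3 * s + 4
        collect = solve-∀
      index-bound : size (Semantics.Config.index c) ≤ (3 * (a₁ + a₂) + 4) * log (length (encode x k))
      index-bound = +-bound (3 * (a₁ + a₂)) 4 (1≤log (length (encode x k))) (begin
        size (Semantics.Config.index c)  ≡⟨ trans (cong (size ∘ Semantics.Config.index) lowers-≡) (size-map proj₁ (TConfig.dual source)) ⟩
        size (TConfig.dual source)       ≤⟨ dual-≤ ⟩
        2 + (I₁ x k + I₂ x k)            ≡⟨ cong (2 +_) (*-distribʳ-+ (log (length (encode x k))) a₁ a₂) ⟨
        2 + (a₁ + a₂) * L                ≡⟨ +-comm 2 _ ⟩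
        (a₁ + a₂) * L + 2                ≤⟨ +-mono-≤ (*-monoˡ-≤ L (m≤n*m (a₁ + a₂) 3)) (s≤s (s≤s z≤n)) ⟩
        3 * (a₁ + a₂) * L + 4            ∎)
        where
        open ≤-Reasoning
        open IndexSafe.Safe x k index-safe
        L = log (length (encode x k))

  kBounded : KBounded machine
  kBounded = (λ k → 3 + (h₁ k + h₂ k)) ,
    computable-+ (computable-const 3) (computable-+ (proj₁ (proj₂ (Good.bitBound G₁))) (proj₁ (proj₂ (Good.bitBound G₂)))) ,
    λ x k p →
      ≤-trans (≤-reflexive (cong (bitsRead ∘ Semantics.Config.choice) (Reached.lowers-≡ (reached x k p)))) (≤-trans (SpaceSafe.Safe.bits-≤ (Reached.space-safe (reached x k p)))
        (≤-trans (+-mono-≤ (*-monoʳ-≤ 3 (1≤log (length x))) (≤-reflexive (sym (*-distribʳ-+ (log (length x)) (h₁ k) (h₂ k)))))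
          (≤-reflexive (sym (*-distribʳ-+ (log (length x)) 3 (h₁ k + h₂ k))))))

  NoLeft : ∀ {F} → Good C F → Set
  NoLeft G = ∀ x k {u c} → Base u → Reach (Good.v G x k) (initialOn (Good.M G) x k u) c →
    Machine.verdict (Good.M G) (Semantics.Config.state c) ≡ nothing → Instruction.choiceMove (Semantics.instruction (Good.M G) x k c) ≢ left

  Tailed : ∀ {F} → Good C F → Set
  Tailed G = Σ[ g ∈ (ℕ → ℕ) ] Computable g × (∀ x k {u} → Base u → Within (Good.v G x k) (g k * log (length x)) (Good.paused G x k u))

  read-once : NoLeft G₁ × NoLeft G₂ → ReadOnce machine
  read-once (never₁ , never₂) x k p = go (reached x k p)
    where
    go : ∀ {c} → Reached x k c → Machine.verdict machine (Semantics.Config.state c) ≡ nothing →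
      Instruction.choiceMove (Semantics.instruction machine x k c) ≢ left
    go record { source = a ; lowers-≡ = refl ; space-safe = s } e e′
      with SpaceSafe.Safe.left-only s e (trans (cong Instruction.choiceMove (sym (instruction-lower x k a))) e′)
    ... | inj₁ (_ , _ , base , r , q , q′) = never₁ x k base r q q′
    ... | inj₂ (_ , _ , base , r , q , q′) = never₂ x k base r q q′

  tail : Tailed G₁ × Tailed G₂ → TailNondeterministic machine
  tail ((g₁ , c₁ , t₁) , (g₂ , c₂ , t₂)) = within→tail {machine} {g}
    (computable-+ (computable-const 9) (computable-+ (computable-* 3 (computable-+ (scaled a₁ (proj₁ (proj₂ (Good.spaceBound G₁)))) (scaled a₂ (proj₁ (proj₂ (Good.spaceBound G₂))))))
      (computable-+ c₁ c₂)))
    λ x k → let l , a , r , w = Facts.tail (by-space x k) (t₁ x k) (t₂ x k) ; d , r′ , e = run← x k (lower-initial x k []) r in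
      l , d , r′ , within-≤ (bound x k) (within← x k e w)
    where
    scaled : ∀ a {f} → Computable f → Computable (λ k → a * (1 + f k))
    scaled a c = computable-* a (computable-+ (computable-const 1) c)
    g : ℕ → ℕ
    -- The bound of `Facts.tail` for `Z = S₁ + S₂`, divided by log|x|: since the logarithm is at
    -- least 1, log|x| + f(k) is at most (1 + f(k)) · log|x|.
    g k = 9 + (3 * (a₁ * (1 + f₁ k) + a₂ * (1 + f₂ k)) + (g₁ k + g₂ k))
    bound : ∀ x k → 9 + 3 * (S₁ x k + S₂ x k) + (g₁ k * log (length x) + g₂ k * log (length x)) ≤ g k * log (length x)
    bound x k = begin
      9 + 3 * (a₁ * (X + f₁ k) + a₂ * (X + f₂ k)) + (g₁ k * X + g₂ k * X)
        ≤⟨ +-monoˡ-≤ _ (+-mono-≤ (*-monoʳ-≤ 9 1≤X) (*-monoʳ-≤ 3 (+-mono-≤ (scale a₁ (f₁ k)) (scale a₂ (f₂ k))))) ⟩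
      9 * X + 3 * (a₁ * ((1 + f₁ k) * X) + a₂ * ((1 + f₂ k) * X)) + (g₁ k * X + g₂ k * X)
        ≡⟨ collect a₁ a₂ (f₁ k) (f₂ k) (g₁ k) (g₂ k) X ⟩
      g k * X ∎
      where
      open ≤-Reasoning
      X = log (length x)
      1≤X = 1≤log (length x)
      scale : ∀ a f → a * (X + f) ≤ a * ((1 + f) * X)
      scale a f = *-monoʳ-≤ a (+-monoʳ-≤ X (≤-trans (≤-reflexive (sym (*-identityʳ f))) (*-monoʳ-≤ f 1≤X)))
      collect : ∀ a b f f′ g g′ X → 9 * X + 3 * (a * ((1 + f) * X) + b * ((1 + f′) * X)) + (g * X + g′ * X) ≡
        (9 + (3 * (a * (1 + f) + b * (1 + f′)) + (g + g′))) * X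
      collect = solve-∀

  closed : (λ x k → apply o (F₁ x k) (F₂ x k)) ∈#para[ C ]-L
  closed = machine , paraL , kBounded ,
    both→restriction C (both-map read-once tail C (both-zip C (Good.restriction G₁) (Good.restriction G₂))) , counts

theorem12 : (C : Class) (F₁ F₂ : ParamFun) →
    F₁ ∈#para[ C ]-L → F₂ ∈#para[ C ]-L →
    ((λ x k → F₁ x k + F₂ x k) ∈#para[ C ]-L) ×
    ((λ x k → F₁ x k * F₂ x k) ∈#para[ C ]-L)
theorem12 C F₁ F₂ c₁ c₂ = Closure.closed sum (good c₁) (good c₂) , Closure.closed product (good c₁) (good c₂)
  where
  good : ∀ {F} → F ∈#para[ C ]-L → Good C F
  good c = TidyClass.good (clocked c)
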